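{- For every positive integer $n$, there exists a 3-dimensional $n$-bit adder tile assembly computer with average-case run time $O(\log n)$ and worst-case run time $O(\sqrt[3]{n})$.
   Context: Abstract tile assembly model (aTAM) in $\mathbb{Z}^3$: tiles are unit cubes with a glue type (with nonnegative integer strength) on each face and a label; assemblies are finite sets of translated tiles at distinct integer points; an assembly is $\tau$-stable if the min-cut of its bond graph (adjacent tiles joined with weight equal to the strength of a matching glue, $0$ if glues differ) is at least $\tau$; a tile attaches if the result stays $\tau$-stable. A tile system $(T,S,\tau)$ is deterministic (uniquely assembles $A$) if $A$ is its only terminal producible assembly. Parallel run time: with $\mathrm{PARALLEL}(A)$ the union of all assemblies obtained from $A$ by one attachment and $A\rightrightarrows A'$ meaning $A'=\mathrm{PARALLEL}(A)$, the run time is the $k$ with $S=A_1\rightrightarrows\cdots\rightrightarrows A_k$ terminal. Tile assembly computer (TAC) $(T,U,V,\tau)$: $T$ has exactly one tile $t_0$ labeled "0" and one $t_1$ labeled "1"; input template $U=(R,B)$ with $R$ an assembly over $T\setminus\{t_0,t_1\}$ and $B$ a sequence of unoccupied positions; $U_b$ places $t_{b_i}$ at $B(i)$; output template $V$ is a sequence of positions $C(i)$, and an assembly represents $c$ if the tile at $C(i)$ has label $c_i$. The TAC computes $f$ if for every input $b$, $(T,U_b,\tau)$ uniquely assembles an assembly representing $f(b)$. An $n$-bit adder TAC computes the $(n+1)$-bit binary sum of two $n$-bit numbers given as its $2n$ input bits. Run time on input $b$ is the parallel run time of $(T,U_b,\tau)$; worst case is the maximum over inputs, average case is the expectation over a uniformly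 random input in $\{0,1\}^{2n}$. -}

module Defs where

open import Data.Nat using (ℕ; zero; suc; _+_; _*_; _≤_; _^_; _≡ᵇ_)
open import Data.Integer as ℤ using (ℤ; +_; -[1+_])
open import Data.Product using (Σ; ∃; _×_; _,_)
open import Data.Bool using (Bool; true; false; if_then_else_)
open import Data.Maybe using (Maybe; just; nothing)
open import Data.List using (List; []; _∷_; map; concatMap)
open import Data.Nat.ListAction using (sum)
open import Data.List.Membership.Propositional using (_∈_)
open import Data.List.Relation.Unary.Unique.Propositional using (Unique)
open import Data.Vec as V using (Vec)
open import Data.Fin using (Fin)
open import Relation.Binary.PropositionalEquality using (_≡_)
open import Relation.Binary.Construct.Closure.ReflexiveTransitive using (Star)
open import Relation.Nullary using (¬_)

Pos : Set
Pos = ℤ × ℤ × ℤ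

data Dir : Set where
  xp xm yp ym zp zm : Dir

allDirs : List Dir
allDirs = xp ∷ xm ∷ yp ∷ ym ∷ zp ∷ zm ∷ []

opp : Dir → Dir
opp xp = xm
opp xm = xp
opp yp = ym
opp ym = yp
opp zp = zm
opp zm = zp

one : ℤ
one = + 1

mone : ℤ
mone = -[1+ 0 ]

_⊕_ : Pos → Dir → Pos
(x , y , z) ⊕ xp = (x ℤ.+ one , y , z)
(x , y , z) ⊕ xm = (x ℤ.+ mone , y , z)
(x , y , z) ⊕ yp = (x , y ℤ.+ one , z)
(x , y , z) ⊕ ym = (x , y ℤ.+ mone , z)
(x , y , z) ⊕ zp = (x , y , z ℤ.+ one)
(x , y , z) ⊕ zm = (x , y , z ℤ.+ mone)

data Label : Set where
  lab0 lab1 : Label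
  other : ℕ → Label

record Tile : Set where
  constructor mkTile
  field
    gxp gxm gyp gym gzp gzm : ℕ
    label : Label
open Tile public

glue : Tile → Dir → ℕ
glue t xp = gxp t
glue t xm = gxm t
glue t yp = gyp t
glue t ym = gym t
glue t zp = gzp t
glue t zm = gzm t

record Assembly : Set where
  field
    at : Pos → Maybe Tile
    dom : List Pos
    dom-unique : Unique dom
    dom-occ : ∀ p → p ∈ dom → ∃ λ t → at p ≡ just t
    occ-dom : ∀ p t → at p ≡ just t → p ∈ dom
open Assembly public

_≈A_ : Assembly → Assembly → Set
A ≈A B = ∀ p → at A p ≡ at B p

bond : (ℕ → ℕ) → Tile → Dir → Tile → ℕ
bond str t d t' = if glue t d ≡ᵇ glue t' (opp d) then str (glue t d) else 0

-- bond strength from tile t at p, in direction d, to a tile on the other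
-- side of the cut S (S p = true assumed)
crossBond : (ℕ → ℕ) → Assembly → (Pos → Bool) → Pos → Tile → Dir → ℕ
crossBond str A S p t d with at A (p ⊕ d)
... | nothing = 0
... | just t' = if S (p ⊕ d) then 0 else bond str t d t'

outWeight : (ℕ → ℕ) → Assembly → (Pos → Bool) → Pos → ℕ
outWeight str A S p with at A p
... | nothing = 0
... | just t = sum (map (crossBond str A S p t) allDirs)

cut : (ℕ → ℕ) → Assembly → (Pos → Bool) → ℕ
cut str A S = sum (map (λ p → if S p then outWeight str A S p else 0) (dom A))

Stable : (ℕ → ℕ) → ℕ → Assembly → Set
Stable str τ A = (S : Pos → Bool)
  → (∃ λ p → p ∈ dom A × S p ≡ true)
  → (∃ λ p → p ∈ dom A × S p ≡ false)
  → τ ≤ cut str A S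

-- Tile systems (the seed is supplied separately)

record TileSystem : Set where
  field
    tiles : List Tile
    str : ℕ → ℕ
    τ : ℕ
open TileSystem public

Attaches : TileSystem → Assembly → Pos → Tile → Assembly → Set
Attaches 𝒯 A p t B =
  t ∈ tiles 𝒯 × at A p ≡ nothing × at B p ≡ just t
  × (∀ q → ¬ q ≡ p → at B q ≡ at A q)
  × Stable (str 𝒯) (τ 𝒯) B

Step : TileSystem → Assembly → Assembly → Set
Step 𝒯 A B = ∃ λ p → ∃ λ t → Attaches 𝒯 A p t B

Producible : TileSystem → Assembly → Assembly → Set
Producible 𝒯 seed A = Star (Step 𝒯) seed A

Terminal : TileSystem → Assembly → Set
Terminal 𝒯 A = ∀ p t B → ¬ Attaches 𝒯 A p t B

UniquelyAssembles : TileSystem → Assembly → Assembly → Set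
UniquelyAssembles 𝒯 seed A =
  Producible 𝒯 seed A × Terminal 𝒯 A
  × (∀ B → Producible 𝒯 seed B → Terminal 𝒯 B → B ≈A A)

Parallel : TileSystem → Assembly → Assembly → Set
Parallel 𝒯 A A' =
  (∀ q t → at A q ≡ just t → at A' q ≡ just t)
  × (∀ p t B → Attaches 𝒯 A p t B → at A' p ≡ just t)
  × (∀ q t → at A q ≡ nothing → at A' q ≡ just t → ∃ λ B → Attaches 𝒯 A q t B)

-- ParRun 𝒯 A k : A = A₁ ⇉ A₂ ⇉ ⋯ ⇉ A_k with A_k the first terminal one
data ParRun (𝒯 : TileSystem) : Assembly → ℕ → Set where
  final : ∀ {A} → Terminal 𝒯 A → ParRun 𝒯 A 1
  step  : ∀ {A A' k} → ¬ Terminal 𝒯 A → Parallel 𝒯 A A'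
        → ParRun 𝒯 A' k → ParRun 𝒯 A (suc k)

record TAC (nin nout : ℕ) : Set where
  field
    sys : TileSystem
    t0 t1 : Tile
    t0∈ : t0 ∈ tiles sys
    t0-label : label t0 ≡ lab0
    t0-unique : ∀ t → t ∈ tiles sys → label t ≡ lab0 → t ≡ t0
    t1∈ : t1 ∈ tiles sys
    t1-label : label t1 ≡ lab1
    t1-unique : ∀ t → t ∈ tiles sys → label t ≡ lab1 → t ≡ t1
    -- input template U = (R , B)
    R : Assembly
    R-tiles : ∀ p t → at R p ≡ just t → t ∈ tiles sys × ¬ t ≡ t0 × ¬ t ≡ t1
    B : Vec Pos nin
    B-free : ∀ i → at R (V.lookup B i) ≡ nothing
    C : Vec Pos nout
open TAC public

bitTile : ∀ {nin nout} → TAC nin nout → Bool → Tile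
bitTile M false = t0 M
bitTile M true = t1 M

IsInput : ∀ {nin nout} → TAC nin nout → Vec Bool nin → Assembly → Set
IsInput M b A =
  (∀ i → at A (V.lookup (B M) i) ≡ just (bitTile M (V.lookup b i)))
  × (∀ p → (∀ i → ¬ p ≡ V.lookup (B M) i) → at A p ≡ at (R M) p)

bitLabel : Bool → Label
bitLabel false = lab0
bitLabel true = lab1

Represents : ∀ {nin nout} → TAC nin nout → Assembly → Vec Bool nout → Set
Represents M A c = ∀ (i : Fin _) →
  ∃ λ t → at A (V.lookup (C M) i) ≡ just t × label t ≡ bitLabel (V.lookup c i)

-- Binary numbers (little-endian: index 0 is the least significant bit)

val : ∀ {k} → Vec Bool k → ℕ
val V.[] = 0
val (x V.∷ xs) = (if x then 1 else 0) + 2 * val xs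

IsSum : (n : ℕ) → Vec Bool (n + n) → Vec Bool (suc n) → Set
IsSum n b c = val c ≡ val (V.take n b) + val (V.drop n b)

AdderRun : (n : ℕ) → TAC (n + n) (suc n) → Vec Bool (n + n) → ℕ → Set
AdderRun n M b k = Σ Assembly λ seed → IsInput M b seed
  × (∃ λ A → UniquelyAssembles (sys M) seed A
       × ∃ λ c → IsSum n b c × Represents M A c)
  × ParRun (sys M) seed k

allBits : (k : ℕ) → List (Vec Bool k)
allBits zero = V.[] ∷ []
allBits (suc k) = concatMap (λ v → (false V.∷ v) ∷ (true V.∷ v) ∷ []) (allBits k)

sumAll : ∀ {k} → (Vec Bool k → ℕ) → ℕ
sumAll {k} f = sum (map f (allBits k))

{-# OPTIONS --safe #-}
module Submission where

-- Addition is carry propagation: digit i yields a partial carry, `just c` if it generates or kills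
-- a carry and `nothing` if it propagates one, and the carry into any position is a composition of
-- partial carries applied to an earlier carry.  A selector tile attaches by one strong bond as soon
-- as its first argument is `just c`, and only if that is `nothing` does it wait for a second, weak
-- bond; so a chain of selectors is delayed only by runs of propagating digits.  The digits are laid
-- out along a path folded three times, in loops that start and end next to each other: rows of
-- cells away from a spine and back, groups of rows up one side of the spine and down the other, and
-- layers stacked along a shaft.  On each level a chain of selectors composes the partial carries
-- from the start of the loop, and a second chain turns them into carries, so the time is linear in
-- the sum of the three side lengths, and also linear in the longest propagating run.
-- Glues name the position of the tile they serve, hence tiles that are not bit tiles attach only at
-- their own places.  A tile can only be attached after the tiles it requires, so the final
-- assembly is determined tile by tile, and every assembly on the way is stable because each tile
-- is bonded with strength τ to earlier tiles.

open import Defs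
open import Data.Nat
  using (ℕ; zero; suc; _+_; _*_; _∸_; _≤_; _<_; _^_; _≡ᵇ_; _<ᵇ_; _≤?_; _<?_; z≤n; s≤s; _⊓_; _⊔_)
open import Data.Nat.Properties
open import Data.Nat.DivMod using (_%_; [m+kn]%n≡m%n; m<n⇒m%n≡m)
open import Data.Nat.Induction using (<-wellFounded)
open import Data.Nat.ListAction using (sum)
open import Data.Nat.Logarithm using (⌊log₂_⌋; ⌊log₂⌋-mono-≤; ⌊log₂[2^n]⌋≡n)
open import Data.Nat.Solver using (module +-*-Solver)
open import Induction.WellFounded using (Acc; acc)
open import Data.Integer as ℤ using (ℤ; -[1+_]; 0ℤ) renaming (+_ to +ℤ_)
import Data.Integer.Properties as ℤₚ
open import Data.Product using (Σ; ∃; _×_; _,_; proj₁; proj₂)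
open import Data.Product.Properties using (≡-dec; ,-injectiveˡ; ,-injectiveʳ)
open import Data.Sum using (_⊎_; inj₁; inj₂; [_,_]′)
open import Data.Empty using (⊥; ⊥-elim)
open import Data.Unit using (⊤; tt)
open import Data.Bool using (Bool; true; false; if_then_else_; not; _∧_; _∨_; _xor_; T)
import Data.Bool.Properties as Boolₚ
open import Data.Maybe using (Maybe; just; nothing; fromMaybe)
open import Data.Maybe.Properties using (just-injective)
open import Data.List using (List; []; _∷_; map; concatMap; filter; deduplicate; upTo; _++_)
open import Data.List.Properties using (map-∘)
open import Data.List.Membership.Propositional using (_∈_)
open import Data.List.Membership.Propositional.Properties
  using (∈-map⁺; ∈-filter⁺; ∈-filter⁻; ∈-deduplicate⁺; ∈-upTo⁺; ∈-++⁺ˡ; ∈-++⁺ʳ; ∈-++⁻; ∈-∃++;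
         ∈-concatMap⁺; ∈-concatMap⁻)
open import Data.List.Relation.Unary.All as All using ([]; _∷_)
open import Data.List.Relation.Unary.AllPairs using ([]; _∷_)
open import Data.List.Relation.Unary.Any as Any using (here; there; any?)
open import Data.List.Relation.Unary.Unique.Propositional using (Unique)
import Data.List.Relation.Unary.Unique.Propositional.Properties as Uniqueₚ
open import Data.List.Relation.Unary.Unique.DecPropositional.Properties using (deduplicate-!)
open import Data.Vec as V using (Vec)
open import Data.Vec.Properties using (lookup∘tabulate; lookup-splitAt; take++drop≡id)
open import Data.Fin using (Fin; toℕ; fromℕ<; splitAt; _↑ˡ_; _↑ʳ_)
open import Data.Fin.Properties using (toℕ<n; toℕ-fromℕ<; splitAt-↑ˡ; splitAt-↑ʳ)
open import Function using (_∘_; case_of_)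
open import Relation.Binary.PropositionalEquality
  using (_≡_; refl; sym; trans; cong; cong₂; subst; _≢_; module ≡-Reasoning)
open import Relation.Binary.Definitions using (DecidableEquality; tri<; tri≈; tri>)
open import Relation.Binary.Construct.Closure.ReflexiveTransitive using (ε; _◅_)
open import Relation.Nullary using (¬_; Dec; yes; no; does; contradiction)
open import Relation.Nullary.Decidable using (_×-dec_; ¬?)

if-else : ∀ {A : Set} {x y : A} {c} → c ≡ false → (if c then x else y) ≡ y
if-else refl = refl

if-then : ∀ {A : Set} {x y : A} {c} → c ≡ true → (if c then x else y) ≡ x
if-then refl = refl

∨-true : ∀ {a b} → (a ∨ b) ≡ true → a ≡ true ⊎ b ≡ true
∨-true {true}  _ = inj₁ refl
∨-true {false} e = inj₂ e

-- Sums over lists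

sum-map-≤ : ∀ {A : Set} {f g : A → ℕ} (xs : List A) → (∀ x → f x ≤ g x) →
  sum (map f xs) ≤ sum (map g xs)
sum-map-≤ []       f≤g = z≤n
sum-map-≤ (x ∷ xs) f≤g = +-mono-≤ (f≤g x) (sum-map-≤ xs f≤g)

∈⇒≤sum : ∀ {A : Set} (f : A → ℕ) {x} {xs : List A} → x ∈ xs → f x ≤ sum (map f xs)
∈⇒≤sum f {xs = _ ∷ xs} (here refl) = m≤m+n _ _
∈⇒≤sum f {xs = y ∷ xs} (there x∈)  = ≤-trans (∈⇒≤sum f x∈) (m≤n+m _ (f y))

sum-map-middle : ∀ {A : Set} (f : A → ℕ) as x bs →
  sum (map f (as ++ x ∷ bs)) ≡ f x + sum (map f (as ++ bs))
sum-map-middle f []       x bs = refl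
sum-map-middle f (a ∷ as) x bs = begin
  f a + sum (map f (as ++ x ∷ bs))     ≡⟨ cong (f a +_) (sum-map-middle f as x bs) ⟩
  f a + (f x + sum (map f (as ++ bs))) ≡⟨ +-assoc (f a) _ _ ⟨
  f a + f x + sum (map f (as ++ bs))   ≡⟨ cong (_+ sum (map f (as ++ bs))) (+-comm (f a) (f x)) ⟩
  f x + f a + sum (map f (as ++ bs))   ≡⟨ +-assoc (f x) _ _ ⟩
  f x + (f a + sum (map f (as ++ bs))) ∎
  where open ≡-Reasoning

∈-middle⁻ : ∀ {A : Set} {x y : A} as {bs} → x ≢ y → x ∈ as ++ y ∷ bs → x ∈ as ++ bs
∈-middle⁻ as x≢y x∈ with ∈-++⁻ as x∈
... | inj₁ x∈as         = ∈-++⁺ˡ x∈as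
... | inj₂ (here refl)  = contradiction refl x≢y
... | inj₂ (there x∈bs) = ∈-++⁺ʳ as x∈bs

sum-map-⊆ : ∀ {A : Set} (f : A → ℕ) {xs ys : List A} → Unique xs →
  (∀ {x} → x ∈ xs → f x ≡ 0 ⊎ x ∈ ys) → sum (map f xs) ≤ sum (map f ys)
sum-map-⊆ f {[]}     {ys} []           xs⊆ys = z≤n
sum-map-⊆ f {x ∷ xs} {ys} (x∉ ∷ uniq) xs⊆ys with xs⊆ys (here refl)
... | inj₁ fx≡0 rewrite fx≡0 = sum-map-⊆ f uniq (xs⊆ys ∘ there)
... | inj₂ x∈ys with ∈-∃++ x∈ys
...   | as , bs , refl = begin
  f x + sum (map f xs)          ≤⟨ +-monoʳ-≤ (f x) (sum-map-⊆ f uniq rest) ⟩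
  f x + sum (map f (as ++ bs))  ≡⟨ sum-map-middle f as x bs ⟨
  sum (map f (as ++ x ∷ bs))    ∎
  where
  open ≤-Reasoning
  rest : ∀ {z} → z ∈ xs → f z ≡ 0 ⊎ z ∈ as ++ bs
  rest z∈ with xs⊆ys (there z∈)
  ... | inj₁ fz≡0 = inj₁ fz≡0
  ... | inj₂ z∈ys = inj₂ (∈-middle⁻ as (λ { refl → All.lookup x∉ z∈ refl }) z∈ys)

sum-map-< : ∀ {A : Set} {f g : A → ℕ} {x} {xs : List A} → (∀ y → f y ≤ g y) →
  x ∈ xs → f x < g x → sum (map f xs) < sum (map g xs)
sum-map-< {xs = _ ∷ xs} f≤g (here refl) fx<gx = +-mono-<-≤ fx<gx (sum-map-≤ xs f≤g)
sum-map-< {xs = y ∷ _}  f≤g (there x∈)  fx<gx = +-mono-≤-< (f≤g y) (sum-map-< f≤g x∈ fx<gx)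

-- Directions and neighbouring positions

abstract
  _≟P_ : DecidableEquality Pos
  _≟P_ = ≡-dec ℤ._≟_ (≡-dec ℤ._≟_ ℤ._≟_)

private
  dirCode : Dir → ℕ
  dirCode xp = 0
  dirCode xm = 1
  dirCode yp = 2
  dirCode ym = 3
  dirCode zp = 4
  dirCode zm = 5

  nthDir : ℕ → Dir
  nthDir 0 = xp
  nthDir 1 = xm
  nthDir 2 = yp
  nthDir 3 = ym
  nthDir 4 = zp
  nthDir _ = zm

  nthDir-dirCode : ∀ d → nthDir (dirCode d) ≡ d
  nthDir-dirCode xp = refl
  nthDir-dirCode xm = refl
  nthDir-dirCode yp = refl
  nthDir-dirCode ym = refl
  nthDir-dirCode zp = refl
  nthDir-dirCode zm = refl

_≟D_ : DecidableEquality Dir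
d ≟D e with dirCode d ≟ dirCode e
... | yes eq = yes (trans (sym (nthDir-dirCode d)) (trans (cong nthDir eq) (nthDir-dirCode e)))
... | no neq = no (neq ∘ cong dirCode)

opp-involutive : ∀ d → opp (opp d) ≡ d
opp-involutive xp = refl
opp-involutive xm = refl
opp-involutive yp = refl
opp-involutive ym = refl
opp-involutive zp = refl
opp-involutive zm = refl

opp-≢ : ∀ d → d ≢ opp d
opp-≢ xp ()
opp-≢ xm ()
opp-≢ yp ()
opp-≢ ym ()
opp-≢ zp ()
opp-≢ zm ()

∈allDirs : ∀ d → d ∈ allDirs
∈allDirs xp = here refl
∈allDirs xm = there (here refl)
∈allDirs yp = there (there (here refl))
∈allDirs ym = there (there (there (here refl)))
∈allDirs zp = there (there (there (there (here refl))))
∈allDirs zm = there (there (there (there (there (here refl)))))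

allDirs-unique : Unique allDirs
allDirs-unique =
  ((λ ()) ∷ (λ ()) ∷ (λ ()) ∷ (λ ()) ∷ (λ ()) ∷ []) ∷
  ((λ ()) ∷ (λ ()) ∷ (λ ()) ∷ (λ ()) ∷ []) ∷
  ((λ ()) ∷ (λ ()) ∷ (λ ()) ∷ []) ∷
  ((λ ()) ∷ (λ ()) ∷ []) ∷
  ((λ ()) ∷ []) ∷ [] ∷ []

up-down : ∀ i → (i ℤ.+ one) ℤ.+ mone ≡ i
up-down i = trans (ℤₚ.+-assoc i one mone) (ℤₚ.+-identityʳ i)

down-up : ∀ i → (i ℤ.+ mone) ℤ.+ one ≡ i
down-up i = trans (ℤₚ.+-assoc i mone one) (ℤₚ.+-identityʳ i)

⊕-opp : ∀ p d → (p ⊕ d) ⊕ opp d ≡ p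
⊕-opp (x , y , z) xp = cong (_, y , z) (up-down x)
⊕-opp (x , y , z) xm = cong (_, y , z) (down-up x)
⊕-opp (x , y , z) yp = cong (λ v → x , v , z) (up-down y)
⊕-opp (x , y , z) ym = cong (λ v → x , v , z) (down-up y)
⊕-opp (x , y , z) zp = cong (λ v → x , y , v) (up-down z)
⊕-opp (x , y , z) zm = cong (λ v → x , y , v) (down-up z)

private
  shift : ℤ × ℤ × ℤ → Dir → ℤ × ℤ × ℤ
  shift (x , y , z) d = (x ℤ.+ proj₁ v , y ℤ.+ proj₁ (proj₂ v) , z ℤ.+ proj₂ (proj₂ v))
    where v = (0ℤ , 0ℤ , 0ℤ) ⊕ d

  ⊕≡shift : ∀ p d → p ⊕ d ≡ shift p d
  ⊕≡shift (x , y , z) xp rewrite ℤₚ.+-identityʳ y | ℤₚ.+-identityʳ z = refl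
  ⊕≡shift (x , y , z) xm rewrite ℤₚ.+-identityʳ y | ℤₚ.+-identityʳ z = refl
  ⊕≡shift (x , y , z) yp rewrite ℤₚ.+-identityʳ x | ℤₚ.+-identityʳ z = refl
  ⊕≡shift (x , y , z) ym rewrite ℤₚ.+-identityʳ x | ℤₚ.+-identityʳ z = refl
  ⊕≡shift (x , y , z) zp rewrite ℤₚ.+-identityʳ x | ℤₚ.+-identityʳ y = refl
  ⊕≡shift (x , y , z) zm rewrite ℤₚ.+-identityʳ x | ℤₚ.+-identityʳ y = refl

  ℤ-cancelˡ : ∀ {i j k} → i ℤ.+ j ≡ i ℤ.+ k → j ≡ k
  ℤ-cancelˡ {i} {j} {k} e = trans (sym (undo j)) (trans (cong (λ v → (ℤ.- i) ℤ.+ v) e) (undo k))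
    where
    undo : ∀ j → (ℤ.- i) ℤ.+ (i ℤ.+ j) ≡ j
    undo j = trans (sym (ℤₚ.+-assoc (ℤ.- i) i j)) (trans (cong (ℤ._+ j) (ℤₚ.+-inverseˡ i)) (ℤₚ.+-identityˡ j))

  unit-injective : ∀ d d' → (0ℤ , 0ℤ , 0ℤ) ⊕ d ≡ (0ℤ , 0ℤ , 0ℤ) ⊕ d' → d ≡ d'
  unit-injective xp xp _ = refl
  unit-injective xm xm _ = refl
  unit-injective yp yp _ = refl
  unit-injective ym ym _ = refl
  unit-injective zp zp _ = refl
  unit-injective zm zm _ = refl

  unit-nonzero : ∀ d → (0ℤ , 0ℤ , 0ℤ) ⊕ d ≢ (0ℤ , 0ℤ , 0ℤ)
  unit-nonzero xp ()
  unit-nonzero xm ()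
  unit-nonzero yp ()
  unit-nonzero ym ()
  unit-nonzero zp ()
  unit-nonzero zm ()

⊕-dir-injective : ∀ p {d d'} → p ⊕ d ≡ p ⊕ d' → d ≡ d'
⊕-dir-injective p@(x , y , z) {d} {d'} eq = unit-injective d d' (cong₂ _,_
  (ℤ-cancelˡ {x} (,-injectiveˡ e))
  (cong₂ _,_ (ℤ-cancelˡ {y} (,-injectiveˡ (,-injectiveʳ e)))
             (ℤ-cancelˡ {z} (,-injectiveʳ (,-injectiveʳ e)))))
  where e = trans (sym (⊕≡shift p d)) (trans eq (⊕≡shift p d'))

⊕-≢ : ∀ p d → p ⊕ d ≢ p
⊕-≢ p@(x , y , z) d eq = unit-nonzero d (cong₂ _,_ (z≡ (,-injectiveˡ e))
  (cong₂ _,_ (z≡ (,-injectiveˡ (,-injectiveʳ e))) (z≡ (,-injectiveʳ (,-injectiveʳ e)))))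
  where
  e = trans (sym (⊕≡shift p d)) eq
  z≡ : ∀ {i j} → i ℤ.+ j ≡ i → j ≡ 0ℤ
  z≡ {i} h = ℤ-cancelˡ {i} (trans h (sym (ℤₚ.+-identityʳ i)))

-- Assemblies as partial functions

Occupied : Assembly → Pos → Set
Occupied A p = ∃ λ t → at A p ≡ just t

just≢nothing : ∀ {A : Set} {x : A} {m : Maybe A} → m ≡ just x → m ≢ nothing
just≢nothing refl ()

occupied? : ∀ A p → Dec (Occupied A p)
occupied? A p with at A p
... | just t  = yes (t , refl)
... | nothing = no λ ()

¬occupied : ∀ {A p} → ¬ Occupied A p → at A p ≡ nothing
¬occupied {A} {p} ¬occ with at A p
... | just t  = contradiction (t , refl) ¬occ
... | nothing = refl

fromPartial : (f : Pos → Maybe Tile) (support : List Pos) →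
  (∀ p t → f p ≡ just t → p ∈ support) → Assembly
fromPartial f support covers = record
  { at         = f
  ; dom        = filter just? (deduplicate _≟P_ support)
  ; dom-unique = Uniqueₚ.filter⁺ just? (deduplicate-! _≟P_ support)
  ; dom-occ    = λ p p∈ → proj₂ (∈-filter⁻ just? {xs = deduplicate _≟P_ support} p∈)
  ; occ-dom    = λ p t e → ∈-filter⁺ just? (∈-deduplicate⁺ _≟P_ (covers p t e)) (t , e)
  }
  where
  just? : ∀ p → Dec (∃ λ t → f p ≡ just t)
  just? p with f p
  ... | just t  = yes (t , refl)
  ... | nothing = no λ ()

addTile : (A : Assembly) (p : Pos) → Tile → at A p ≡ nothing → Assembly
addTile A p t empty = record
  { at         = at'
  ; dom        = p ∷ dom A
  ; dom-unique = All.tabulate (λ q∈ → λ { refl → just≢nothing (proj₂ (dom-occ A p q∈)) empty }) ∷ dom-unique A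
  ; dom-occ    = occ
  ; occ-dom    = λ q u → occ⁻ q u
  }
  where
  at' : Pos → Maybe Tile
  at' q with q ≟P p
  ... | yes _ = just t
  ... | no  _ = at A q
  occ : ∀ q → q ∈ p ∷ dom A → ∃ λ u → at' q ≡ just u
  occ q q∈ with q ≟P p | q∈
  ... | yes _   | _         = t , refl
  ... | no  q≢p | here q≡p  = contradiction q≡p q≢p
  ... | no  _   | there q∈A = dom-occ A q q∈A
  occ⁻ : ∀ q u → at' q ≡ just u → q ∈ p ∷ dom A
  occ⁻ q u e with q ≟P p
  ... | yes q≡p = here q≡p
  ... | no  _   = there (occ-dom A q u e)

addTile-here : ∀ A p t empty → at (addTile A p t empty) p ≡ just t
addTile-here A p t empty with p ≟P p
... | yes _   = refl
... | no  p≢p = contradiction refl p≢p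

addTile-there : ∀ A p t empty q → q ≢ p → at (addTile A p t empty) q ≡ at A q
addTile-there A p t empty q q≢p with q ≟P p
... | yes q≡p = contradiction q≡p q≢p
... | no  _   = refl

-- Bonds

≡ᵇ-refl : ∀ n → (n ≡ᵇ n) ≡ true
≡ᵇ-refl zero    = refl
≡ᵇ-refl (suc n) = ≡ᵇ-refl n

≡ᵇ-sound : ∀ m n → (m ≡ᵇ n) ≡ true → m ≡ n
≡ᵇ-sound zero    zero    _ = refl
≡ᵇ-sound (suc m) (suc n) e = cong suc (≡ᵇ-sound m n e)

≡ᵇ-sym : ∀ m n → (m ≡ᵇ n) ≡ (n ≡ᵇ m)
≡ᵇ-sym zero    zero    = refl
≡ᵇ-sym zero    (suc n) = refl
≡ᵇ-sym (suc m) zero    = refl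
≡ᵇ-sym (suc m) (suc n) = ≡ᵇ-sym m n

bond-sym : ∀ str t d t' → bond str t d t' ≡ bond str t' (opp d) t
bond-sym str t d t' rewrite opp-involutive d | ≡ᵇ-sym (glue t' (opp d)) (glue t d)
  with glue t d ≡ᵇ glue t' (opp d) in eq
... | true  = cong str (≡ᵇ-sound _ _ eq)
... | false = refl

bondAt : (ℕ → ℕ) → (Pos → Maybe Tile) → Pos → Tile → Dir → ℕ
bondAt str f p t d with f (p ⊕ d)
... | nothing = 0
... | just t' = bond str t d t'

bondSum : (ℕ → ℕ) → (Pos → Maybe Tile) → Pos → Tile → ℕ
bondSum str f p t = sum (map (bondAt str f p t) allDirs)

bondAt-just : ∀ str f p t d {t'} → f (p ⊕ d) ≡ just t' → bondAt str f p t d ≡ bond str t d t'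
bondAt-just str f p t d e rewrite e = refl

crossBond-≡ : ∀ str A S p t d {t'} → at A (p ⊕ d) ≡ just t' → S (p ⊕ d) ≡ false →
  crossBond str A S p t d ≡ bond str t d t'
crossBond-≡ str A S p t d e s rewrite e | s = refl

crossBond-nothing : ∀ str A S p t d → at A (p ⊕ d) ≡ nothing → crossBond str A S p t d ≡ 0
crossBond-nothing str A S p t d e rewrite e = refl

outWeight-≡ : ∀ str A S p {t} → at A p ≡ just t →
  outWeight str A S p ≡ sum (map (crossBond str A S p t) allDirs)
outWeight-≡ str A S p e rewrite e = refl

attaches⇒bonded : ∀ {𝒯 A B p t} → Attaches 𝒯 A p t B → ∃ (λ q → q ∈ dom A) →
  τ 𝒯 ≤ bondSum (str 𝒯) (at A) p t
attaches⇒bonded {𝒯} {A} {B} {p} {t} (t∈ , empty , new , old , stable) (q , q∈) = begin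
  τ 𝒯                                                     ≤⟨ stable S (p , p∈B , S-p) (q , q∈B , S-other q≢p) ⟩
  sum (map weight (dom B))                                ≤⟨ sum-map-⊆ weight (dom-unique B) only-p ⟩
  sum (map weight (p ∷ []))                               ≡⟨ +-identityʳ (weight p) ⟩
  weight p                                                ≡⟨ cong (if_then outWeight (str 𝒯) B S p else 0) S-p ⟩
  outWeight (str 𝒯) B S p                                 ≡⟨ outWeight-≡ (str 𝒯) B S p new ⟩
  sum (map (crossBond (str 𝒯) B S p t) allDirs)           ≤⟨ sum-map-≤ allDirs cross≤ ⟩
  bondSum (str 𝒯) (at A) p t                              ∎
  where
  open ≤-Reasoning
  S : Pos → Bool
  S r with r ≟P p
  ... | yes _ = true
  ... | no  _ = false
  S-p : S p ≡ true
  S-p with p ≟P p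
  ... | yes _   = refl
  ... | no  p≢p = contradiction refl p≢p
  S-other : ∀ {r} → r ≢ p → S r ≡ false
  S-other {r} r≢p with r ≟P p
  ... | yes r≡p = contradiction r≡p r≢p
  ... | no  _   = refl
  weight : Pos → ℕ
  weight r = if S r then outWeight (str 𝒯) B S r else 0
  p∈B : p ∈ dom B
  p∈B = occ-dom B p t new
  q≢p : q ≢ p
  q≢p refl = just≢nothing (proj₂ (dom-occ A q q∈)) empty
  q∈B : q ∈ dom B
  q∈B = occ-dom B q _ (trans (old q q≢p) (proj₂ (dom-occ A q q∈)))
  only-p : ∀ {r} → r ∈ dom B → weight r ≡ 0 ⊎ r ∈ p ∷ []
  only-p {r} _ with r ≟P p
  ... | yes r≡p = inj₂ (here r≡p)
  ... | no  _   = inj₁ refl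
  cross≤ : ∀ d → crossBond (str 𝒯) B S p t d ≤ bondAt (str 𝒯) (at A) p t d
  cross≤ d with at A (p ⊕ d) in e
  ... | nothing = ≤-reflexive (crossBond-nothing (str 𝒯) B S p t d (trans (old _ (⊕-≢ p d)) e))
  ... | just t' = ≤-reflexive
    (crossBond-≡ (str 𝒯) B S p t d (trans (old _ (⊕-≢ p d)) e) (S-other (⊕-≢ p d)))

-- Growth towards a prescribed final assembly

_⊑_ : (f g : Pos → Maybe Tile) → Set
f ⊑ g = ∀ {p t} → f p ≡ just t → g p ≡ just t

record Growth (𝒯 : TileSystem) : Set where
  field
    F       : Pos → Maybe Tile
    support : List Pos
    F-supp  : ∀ p t → F p ≡ just t → p ∈ support
    F-tiles : ∀ p t → F p ≡ just t → t ∈ tiles 𝒯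
    seed    : Pos → Bool
    root    : Pos
    root-seed : seed root ≡ true
    seed-F  : ∀ {p} → seed p ≡ true → ∃ λ t → F p ≡ just t
    req     : Pos → Dir → Bool
    rank    : Pos → ℕ
    req-F   : ∀ {p t d} → F p ≡ just t → req p d ≡ true →
              (∃ λ t' → F (p ⊕ d) ≡ just t') × rank (p ⊕ d) < rank p
    req-τ   : ∀ {p t} → F p ≡ just t → p ≢ root →
              τ 𝒯 ≤ sum (map (λ d → if req p d then bondAt (str 𝒯) F p t d else 0) allDirs)
    seed-req : ∀ {p d} → seed p ≡ true → req p d ≡ true → seed (p ⊕ d) ≡ true
    -- The side condition on consumers holds whenever every tile of f was placed after the tiles
    -- it requires; without it a tile could be forced backwards by a tile that depends on it.
    determined : ∀ {f p t} → f ⊑ F → f p ≡ nothing → seed p ≡ false →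
      (∀ {d t'} → f (p ⊕ d) ≡ just t' → req (p ⊕ d) (opp d) ≡ false) →
      t ∈ tiles 𝒯 → τ 𝒯 ≤ bondSum (str 𝒯) f p t →
      F p ≡ just t × (∀ d → req p d ≡ true → ∃ λ t' → f (p ⊕ d) ≡ just t')
    time    : Pos → ℕ
    time-req : ∀ {p t d} → F p ≡ just t → seed p ≡ false → req p d ≡ true →
               seed (p ⊕ d) ≡ true ⊎ time (p ⊕ d) < time p

module GrowthProperties (𝒯 : TileSystem) (G : Growth 𝒯) where
  open Growth G

  record Valid (A : Assembly) : Set where
    field
      below  : at A ⊑ F
      seeded : ∀ p → seed p ≡ true → at A p ≡ F p
      closed : ∀ {p t d} → at A p ≡ just t → req p d ≡ true → Occupied A (p ⊕ d)
  open Valid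

  Full : Assembly → Set
  Full A = ∀ p t → F p ≡ just t → at A p ≡ just t

  valid-full : ∀ {A p t} → Valid A → Occupied A p → F p ≡ just t → at A p ≡ just t
  valid-full v (_ , e) Fp = trans e (trans (sym (below v e)) Fp)

  valid-≢ : ∀ {A p q t} → at A p ≡ just t → at A q ≡ nothing → p ≢ q
  valid-≢ e n refl = just≢nothing e n

  root-occ : ∀ {A} → Valid A → Occupied A root
  root-occ v = proj₁ (seed-F root-seed) , trans (seeded v root root-seed) (proj₂ (seed-F root-seed))

  private
    weight : Assembly → (Pos → Bool) → Pos → ℕ
    weight A S p = if S p then outWeight (str 𝒯) A S p else 0

    weight-true : ∀ {A S p} → S p ≡ true → weight A S p ≡ outWeight (str 𝒯) A S p
    weight-true e rewrite e = refl

    weight-vacant : ∀ {A S} p → at A p ≡ nothing → weight A S p ≡ 0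
    weight-vacant {A} {S} p e with S p
    ... | false = refl
    ... | true rewrite e = refl

    bool-≢ : ∀ {a b c : Bool} → a ≢ c → b ≢ c → a ≡ b
    bool-≢ {false} {false} _ _ = refl
    bool-≢ {true}  {true}  _ _ = refl
    bool-≢ {false} {true}  {false} a≢ b≢ = contradiction refl a≢
    bool-≢ {false} {true}  {true}  a≢ b≢ = contradiction refl b≢
    bool-≢ {true}  {false} {false} a≢ b≢ = contradiction refl b≢
    bool-≢ {true}  {false} {true}  a≢ b≢ = contradiction refl a≢

    required : Pos → Tile → Dir → ℕ
    required p t d = if req p d then bondAt (str 𝒯) F p t d else 0

    bondAt-valid : ∀ {A p t} → Valid A → at A p ≡ just t → ∀ d → req p d ≡ true →
      ∃ λ t' → at A (p ⊕ d) ≡ just t' × bondAt (str 𝒯) F p t d ≡ bond (str 𝒯) t d t'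
    bondAt-valid {p = p} v e d r with closed v e r
    ... | t' , e' = t' , e' , bondAt-just (str 𝒯) F p _ d (below v e')

    -- A tile of least rank on the side of the cut away from the root has all its requirements
    -- on the other side, and these alone weigh τ.
    cut-least : ∀ {A} → Valid A → (S : Pos → Bool) → ∀ p {t} → at A p ≡ just t → S p ≢ S root →
      (∀ d → req p d ≡ true → S (p ⊕ d) ≡ S root) → τ 𝒯 ≤ cut (str 𝒯) A S
    cut-least {A} v S p {t} e Sp≢ all≡ = ≤-trans (req-τ (below v e) (λ { refl → Sp≢ refl })) (case-S (S p) refl)
      where
      opposite : ∀ {a} → S p ≡ a → S root ≡ not a
      opposite {a} h with S root Boolₚ.≟ a
      ... | yes r = contradiction (trans h (sym r)) Sp≢
      ... | no  r = sym (bool-≢ {not a} {S root} {a} (Boolₚ.not-¬ refl ∘ sym) r)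
      case-S : ∀ a → S p ≡ a → sum (map (required p t) allDirs) ≤ cut (str 𝒯) A S
      case-S true Sp = begin
        sum (map (required p t) allDirs)               ≤⟨ sum-map-≤ allDirs req≤ ⟩
        sum (map (crossBond (str 𝒯) A S p t) allDirs)  ≡⟨ outWeight-≡ (str 𝒯) A S p e ⟨
        outWeight (str 𝒯) A S p                        ≡⟨ weight-true {A} Sp ⟨
        weight A S p                                   ≤⟨ ∈⇒≤sum (weight A S) (occ-dom A p t e) ⟩
        cut (str 𝒯) A S                                ∎
        where
        open ≤-Reasoning
        req≤ : ∀ d → required p t d ≤ crossBond (str 𝒯) A S p t d
        req≤ d with req p d in r
        ... | false = z≤n
        ... | true with bondAt-valid v e d r
        ...   | t' , e' , b = ≤-reflexive (trans b
          (sym (crossBond-≡ (str 𝒯) A S p t d e' (trans (all≡ d r) (opposite Sp)))))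
      case-S false Sp = begin
        sum (map (required p t) allDirs)               ≤⟨ sum-map-≤ allDirs req≤ ⟩
        sum (map (weight A S ∘ (p ⊕_)) allDirs)        ≡⟨ cong sum (map-∘ {g = weight A S} {f = p ⊕_} allDirs) ⟩
        sum (map (weight A S) (map (p ⊕_) allDirs))    ≤⟨ sum-map-⊆ (weight A S) neighbours-unique in-dom ⟩
        cut (str 𝒯) A S                                ∎
        where
        open ≤-Reasoning
        neighbours-unique : Unique (map (p ⊕_) allDirs)
        neighbours-unique = Uniqueₚ.map⁺ (⊕-dir-injective p) allDirs-unique
        in-dom : ∀ {q} → q ∈ map (p ⊕_) allDirs → weight A S q ≡ 0 ⊎ q ∈ dom A
        in-dom {q} _ with occupied? A q
        ... | yes (u , o) = inj₂ (occ-dom A q u o)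
        ... | no  ¬o      = inj₁ (weight-vacant {A} {S} q (¬occupied {A} ¬o))
        req≤ : ∀ d → required p t d ≤ weight A S (p ⊕ d)
        req≤ d with req p d in r
        ... | false = z≤n
        ... | true with bondAt-valid v e d r
        ...   | t' , e' , b = begin
          bondAt (str 𝒯) F p t d                                       ≡⟨ trans b (bond-sym (str 𝒯) t d t') ⟩
          bond (str 𝒯) t' (opp d) t                                    ≡⟨ crossBond-≡ (str 𝒯) A S (p ⊕ d) t' (opp d)
                                                                            (trans (cong (at A) (⊕-opp p d)) e)
                                                                            (trans (cong S (⊕-opp p d)) Sp) ⟨
          crossBond (str 𝒯) A S (p ⊕ d) t' (opp d)                     ≤⟨ ∈⇒≤sum (crossBond (str 𝒯) A S (p ⊕ d) t') (∈allDirs (opp d)) ⟩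
          sum (map (crossBond (str 𝒯) A S (p ⊕ d) t') allDirs)         ≡⟨ outWeight-≡ (str 𝒯) A S (p ⊕ d) e' ⟨
          outWeight (str 𝒯) A S (p ⊕ d)                                ≡⟨ weight-true {A} {S} (trans (all≡ d r) (opposite Sp)) ⟨
          weight A S (p ⊕ d)                                           ∎

    cut-≥τ : ∀ {A} → Valid A → (S : Pos → Bool) → ∀ p {t} → at A p ≡ just t → S p ≢ S root →
      Acc _<_ (rank p) → τ 𝒯 ≤ cut (str 𝒯) A S
    cut-≥τ {A} v S p {t} e Sp≢ (acc rs) with any? (λ d → (req p d Boolₚ.≟ true) ×-dec ¬? (S (p ⊕ d) Boolₚ.≟ S root)) allDirs
    ... | no  ¬any = cut-least v S p e Sp≢ λ d r → same d r (S (p ⊕ d) Boolₚ.≟ S root)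
      where
      same : ∀ d → req p d ≡ true → Dec (S (p ⊕ d) ≡ S root) → S (p ⊕ d) ≡ S root
      same d r (yes eq) = eq
      same d r (no neq) = contradiction (Any.map (λ { refl → r , neq }) (∈allDirs d)) ¬any
    ... | yes some with Any.satisfied some
    ...   | d , r , neq = cut-≥τ v S (p ⊕ d) (proj₂ (closed v e r)) neq (rs (proj₂ (req-F (below v e) r)))

  valid-stable : ∀ {A} → Valid A → Stable (str 𝒯) (τ 𝒯) A
  valid-stable {A} v S (p , p∈ , Sp) (q , q∈ , Sq) with S root in r
  ... | false = cut-≥τ v S p (proj₂ (dom-occ A p p∈)) (λ eq → contradiction (trans (sym Sp) (trans eq r)) λ ()) (<-wellFounded _)
  ... | true  = cut-≥τ v S q (proj₂ (dom-occ A q q∈)) (λ eq → contradiction (trans (sym Sq) (trans eq r)) λ ()) (<-wellFounded _)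

  Ready : Assembly → Pos → Set
  Ready A p = ∀ d → req p d ≡ true → Occupied A (p ⊕ d)

  extend-valid : ∀ {A p t} → Valid A → F p ≡ just t → Ready A p → ∀ {B} →
    at B p ≡ just t → (∀ q → ¬ q ≡ p → at B q ≡ at A q) → at A p ≡ nothing → Valid B
  extend-valid {A} {p} {t} v Fp ready {B} new old empty = record
    { below  = below'
    ; seeded = seeded'
    ; closed = closed'
    }
    where
    keep : ∀ {q} → Occupied A q → Occupied B q
    keep {q} (u , e) = u , trans (old q (valid-≢ {A} e empty)) e
    below' : at B ⊑ F
    below' {q} e with q ≟P p
    ... | yes refl = trans Fp (trans (sym new) e)
    ... | no  q≢p  = below v (trans (sym (old q q≢p)) e)
    seeded' : ∀ q → seed q ≡ true → at B q ≡ F q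
    seeded' q s with q ≟P p
    ... | yes refl = contradiction (trans (sym (seeded v q s)) empty) (just≢nothing Fp)
    ... | no  q≢p  = trans (old q q≢p) (seeded v q s)
    closed' : ∀ {q u d} → at B q ≡ just u → req q d ≡ true → Occupied B (q ⊕ d)
    closed' {q} {u} {d} e r with q ≟P p
    ... | yes refl = keep (ready d r)
    ... | no  q≢p  = keep (closed v (trans (sym (old q q≢p)) e) r)

  ready-attaches : ∀ {A p t} → Valid A → F p ≡ just t → (empty : at A p ≡ nothing) → Ready A p →
    Attaches 𝒯 A p t (addTile A p t empty)
  ready-attaches {A} {p} {t} v Fp empty ready =
    F-tiles p t Fp , empty , addTile-here A p t empty , addTile-there A p t empty ,
    valid-stable (extend-valid v Fp ready (addTile-here A p t empty) (addTile-there A p t empty) empty)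

  attaches-ready : ∀ {A p t B} → Valid A → Attaches 𝒯 A p t B → F p ≡ just t × Ready A p
  attaches-ready {A} {p} {t} {B} v att@(t∈ , empty , _) =
    determined (below v) empty not-seed not-required t∈
      (attaches⇒bonded {𝒯} {A} {B} att (root , occ-dom A root _ (proj₂ (root-occ v))))
    where
    not-required : ∀ {d t'} → at A (p ⊕ d) ≡ just t' → req (p ⊕ d) (opp d) ≡ false
    not-required {d} e with req (p ⊕ d) (opp d) in r
    ... | false = refl
    ... | true  = contradiction empty (just≢nothing (trans (cong (at A) (sym (⊕-opp p d))) (proj₂ (closed v e r))))
    not-seed : seed p ≡ false
    not-seed with seed p in s
    ... | false = refl
    ... | true  = contradiction empty (just≢nothing (trans (seeded v p s) (proj₂ (seed-F s))))

  Full? : ∀ A → Valid A → Full A ⊎ ∃ λ p → at A p ≡ nothing × ∃ λ t → F p ≡ just t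
  Full? A v with any? (λ p → ¬? (occupied? A p) ×-dec F-just? p) support
    where
    F-just? : ∀ p → Dec (∃ λ t → F p ≡ just t)
    F-just? p with F p
    ... | just t  = yes (t , refl)
    ... | nothing = no λ ()
  ... | yes some with Any.satisfied some
  ...   | p , ¬occ , t , Fp = inj₂ (p , ¬occupied {A} ¬occ , t , Fp)
  Full? A v | no ¬some = inj₁ full
    where
    full : Full A
    full p t Fp with occupied? A p
    ... | yes occ  = valid-full v occ Fp
    ... | no  ¬occ = contradiction (Any.map (λ { refl → ¬occ , t , Fp }) (F-supp p t Fp)) ¬some

  private
    progress-from : ∀ {A} → Valid A → ∀ p {t} → F p ≡ just t → at A p ≡ nothing → Acc _<_ (rank p) →
      ∃ λ q → at A q ≡ nothing × Ready A q × ∃ λ u → F q ≡ just u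
    progress-from {A} v p {t} Fp empty (acc rs)
      with any? (λ d → (req p d Boolₚ.≟ true) ×-dec ¬? (occupied? A (p ⊕ d))) allDirs
    ... | no  ¬any = p , empty , ready , t , Fp
      where
      ready : Ready A p
      ready d r with occupied? A (p ⊕ d)
      ... | yes occ  = occ
      ... | no  ¬occ = contradiction (Any.map (λ { refl → r , ¬occ }) (∈allDirs d)) ¬any
    ... | yes some with Any.satisfied some
    ...   | d , r , ¬occ with req-F Fp r
    ...     | (_ , Fq) , lt = progress-from v (p ⊕ d) Fq (¬occupied {A} ¬occ) (rs lt)

  progress : ∀ {A p t} → Valid A → F p ≡ just t → at A p ≡ nothing →
    ∃ λ q → at A q ≡ nothing × Ready A q × ∃ λ u → F q ≡ just u
  progress v Fp empty = progress-from v _ Fp empty (<-wellFounded _)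

  full-terminal : ∀ {A} → Valid A → Full A → Terminal 𝒯 A
  full-terminal v full p t B att with attaches-ready v att
  ... | Fp , _ = just≢nothing (full p t Fp) (proj₁ (proj₂ att))

  terminal-full : ∀ {A} → Valid A → Terminal 𝒯 A → Full A
  terminal-full {A} v term with Full? A v
  ... | inj₁ full = full
  ... | inj₂ (p , empty , t , Fp) with progress v Fp empty
  ...   | q , empty' , ready , u , Fq = contradiction (ready-attaches v Fq empty' ready) (term q u _)

  step-valid : ∀ {A B} → Valid A → Step 𝒯 A B → Valid B
  step-valid v (p , t , att@(_ , empty , new , old , _)) with attaches-ready v att
  ... | Fp , ready = extend-valid v Fp ready new old empty

  producible-valid : ∀ {A B} → Valid A → Producible 𝒯 A B → Valid B
  producible-valid v ε        = v
  producible-valid v (s ◅ ss) = producible-valid (step-valid v s) ss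

  full-unique : ∀ {A B} → Valid A → Valid B → Full A → Full B → A ≈A B
  full-unique {A} {B} vA vB fA fB p with at A p in eA | at B p in eB
  ... | just t  | _       = trans (sym (fB p t (below vA eA))) eB
  ... | nothing | nothing = refl
  ... | nothing | just u  = contradiction eA (just≢nothing (fA p u (below vB eB)))

  private
    vacant : Maybe Tile → ℕ
    vacant (just _) = 0
    vacant nothing  = 1

    vacancy : Assembly → Pos → ℕ
    vacancy A p = vacant (at A p)

    vacancies : Assembly → ℕ
    vacancies A = sum (map (vacancy A) support)

    vacancies-addTile : ∀ A p t empty → p ∈ support → vacancies (addTile A p t empty) < vacancies A
    vacancies-addTile A p t empty p∈ = sum-map-< (λ q → le q (q ≟P p)) p∈
      (subst (_< vacancy A p) (sym (cong vacant (addTile-here A p t empty)))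
        (subst (λ m → 0 < vacant m) (sym empty) (s≤s z≤n)))
      where
      A⁺ = addTile A p t empty
      le : ∀ q → Dec (q ≡ p) → vacancy A⁺ q ≤ vacancy A q
      le q (yes refl) = ≤-trans (≤-reflexive (cong vacant (addTile-here A p t empty))) z≤n
      le q (no  q≢p)  = ≤-reflexive (cong vacant (addTile-there A p t empty q q≢p))

    grow : ∀ {A} → Valid A → Acc _<_ (vacancies A) → ∃ λ B → Producible 𝒯 A B × Valid B × Full B
    grow {A} v (acc rs) with Full? A v
    ... | inj₁ full = A , ε , v , full
    ... | inj₂ (p , empty , t , Fp) with progress v Fp empty
    ...   | q , empty' , ready , u , Fq
      with grow (extend-valid v Fq ready (addTile-here A q u empty') (addTile-there A q u empty') empty')
                (rs (vacancies-addTile A q u empty' (F-supp q u Fq)))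
    ...     | B , steps , w , full = B , (q , u , ready-attaches v Fq empty' ready) ◅ steps , w , full

  assembles : ∀ {A} → Valid A → ∃ λ B → UniquelyAssembles 𝒯 A B × at B ⊑ F × Full B
  assembles v with grow v (<-wellFounded _)
  ... | B , steps , w , full = B ,
    (steps , full-terminal w full ,
     λ C produced term → full-unique (producible-valid v produced) w (terminal-full (producible-valid v produced) term) full) ,
    below w , full

  private
    ready? : ∀ A p → Dec (∃ λ d → req p d ≡ true × ¬ Occupied A (p ⊕ d))
    ready? A p with any? (λ d → (req p d Boolₚ.≟ true) ×-dec ¬? (occupied? A (p ⊕ d))) allDirs
    ... | yes some = yes (Any.satisfied some)
    ... | no  ¬any = no λ { (d , r) → ¬any (Any.map (λ { refl → r }) (∈allDirs d)) }

    next : Assembly → Pos → Maybe Tile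
    next A p with at A p
    ... | just t = just t
    ... | nothing with ready? A p
    ...   | yes _ = nothing
    ...   | no  _ = F p

    ready : ∀ {A p} → ¬ (∃ λ d → req p d ≡ true × ¬ Occupied A (p ⊕ d)) → Ready A p
    ready {A} {p} none d r with occupied? A (p ⊕ d)
    ... | yes occ  = occ
    ... | no  ¬occ = contradiction (d , r , ¬occ) none

    next-old : ∀ {A p t} → at A p ≡ just t → next A p ≡ just t
    next-old e rewrite e = refl

    next-new : ∀ {A p} → at A p ≡ nothing → Ready A p → next A p ≡ F p
    next-new {A} {p} e r rewrite e with ready? A p
    ... | no  _ = refl
    ... | yes (d , rd , ¬occ) = contradiction (r d rd) ¬occ

    next-inv : ∀ {A p t} → at A p ≡ nothing → next A p ≡ just t → Ready A p × F p ≡ just t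
    next-inv {A} {p} e n rewrite e with ready? A p
    next-inv {A} {p} e () | yes _
    next-inv {A} {p} e n  | no none = ready {A} {p} none , n

    next-below : ∀ {A} → Valid A → next A ⊑ F
    next-below {A} v {p} {t} n = help (at A p) refl
      where
      help : ∀ m → at A p ≡ m → F p ≡ just t
      help (just u) e = trans (below v e) (trans (sym (next-old {A} e)) n)
      help nothing  e = proj₂ (next-inv {A} e n)

    parallel : ∀ {A} → Valid A → Assembly
    parallel {A} v = fromPartial (next A) support λ p t n → F-supp p t (next-below v n)

    parallel-valid : ∀ {A} (v : Valid A) → Valid (parallel v)
    parallel-valid {A} v = record
      { below  = next-below v
      ; seeded = λ p s → trans (next-old {A} (trans (seeded v p s) (proj₂ (seed-F s)))) (sym (proj₂ (seed-F s)))
      ; closed = λ {p} {t} {d} n r → keep (help n r (at A p) refl)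
      }
      where
      keep : ∀ {q} → Occupied A q → Occupied (parallel v) q
      keep (u , e) = u , next-old {A} e
      help : ∀ {p t d} → next A p ≡ just t → req p d ≡ true → ∀ m → at A p ≡ m → Occupied A (p ⊕ d)
      help n r (just u) e = closed v e r
      help n r nothing  e = proj₁ (next-inv {A} e n) _ r

    parallel-step : ∀ {A} (v : Valid A) → Parallel 𝒯 A (parallel v)
    parallel-step {A} v =
      (λ q t e → next-old {A} e) ,
      (λ p t B att → trans (next-new {A} (proj₁ (proj₂ att)) (proj₂ (attaches-ready v att)))
                           (proj₁ (attaches-ready v att))) ,
      (λ q t e n → _ , ready-attaches v (proj₂ (next-inv {A} e n)) e (proj₁ (next-inv {A} e n)))

    Elapsed : ℕ → Assembly → Set
    Elapsed k A = ∀ p t → F p ≡ just t → time p < k → Occupied A p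

    parallel-elapsed : ∀ {A k} (v : Valid A) → Elapsed k A → Elapsed (suc k) (parallel v)
    parallel-elapsed {A} {k} v el p t Fp p<k with occupied? A p
    ... | yes (u , e) = u , next-old {A} e
    ... | no  ¬occ    = t , trans (next-new {A} (¬occupied {A} ¬occ) sources) Fp
      where
      not-seed : seed p ≡ false
      not-seed with seed p in s
      ... | false = refl
      ... | true  = contradiction (t , trans (seeded v p s) Fp) ¬occ
      sources : Ready A p
      sources d r with req-F Fp r | time-req Fp not-seed r
      ... | (u , Fq) , _ | inj₁ s  = u , trans (seeded v _ s) Fq
      ... | (u , Fq) , _ | inj₂ lt = el _ u Fq (<-≤-trans lt (m<1+n⇒m≤n p<k))

    run-from : ∀ {A} T j k → j + k ≡ T → (∀ p t → F p ≡ just t → time p < T) → Valid A → Elapsed k A →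
      ∃ λ r → ParRun 𝒯 A r × r ≤ suc j
    run-from {A} T j k e bound v el with Full? A v
    ... | inj₁ full = 1 , final (full-terminal v full) , s≤s z≤n
    run-from {A} T zero    k refl bound v el | inj₂ (p , empty , t , Fp) =
      contradiction empty (just≢nothing (proj₂ (el p t Fp (bound p t Fp))))
    run-from {A} T (suc j) k e bound v el | inj₂ (p , empty , t , Fp)
      with run-from T j (suc k) (trans (+-suc j k) e) bound (parallel-valid v) (parallel-elapsed v el)
    ... | r , run , r≤ = suc r , step not-terminal (parallel-step v) run , s≤s r≤
      where
      not-terminal : ¬ Terminal 𝒯 A
      not-terminal term = just≢nothing (terminal-full v term p t Fp) empty

  runs : ∀ {A T} → Valid A → (∀ p t → F p ≡ just t → time p < T) → ∃ λ r → ParRun 𝒯 A r × r ≤ suc T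
  runs {T = T} v bound = run-from T T 0 (+-identityʳ T) bound v (λ _ _ _ ())

-- Glues

-- A value is a partial carry together with a bit: `nothing` is the carry function that propagates
-- its argument, `just c` the constant function c.
Val : Set
Val = Maybe Bool × Bool

-- The glue `chan s p d v` passes the value v to the tile at p through its face d.  The other glues
-- do not depend on the position: those of the bit tiles towards the tile below and above, and
-- those of the walls at their two sides.
data Glue : Set where
  null      : Glue
  bit obit  : Bool → Glue
  side      : Bool → Glue
  chan      : Bool → Pos → Dir → Val → Glue

strength : Glue → ℕ
strength null             = 0
strength (bit _)          = 1
strength (obit _)         = 1
strength (side _)         = 1
strength (chan false _ _ _) = 1
strength (chan true _ _ _)  = 2

strength<3 : ∀ g → strength g < 3
strength<3 null               = s≤s z≤n
strength<3 (bit _)            = s≤s (s≤s z≤n)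
strength<3 (obit _)           = s≤s (s≤s z≤n)
strength<3 (side _)           = s≤s (s≤s z≤n)
strength<3 (chan false _ _ _) = s≤s (s≤s z≤n)
strength<3 (chan true _ _ _)  = s≤s (s≤s (s≤s z≤n))

pair : ℕ → ℕ → ℕ
pair zero    n = suc (2 * n)
pair (suc m) n = 2 * pair m n

pair-injective : ∀ {m m' n n'} → pair m n ≡ pair m' n' → m ≡ m' × n ≡ n'
pair-injective {zero}  {zero}  {n} {n'} e = refl , *-cancelˡ-≡ n n' 2 (suc-injective e)
pair-injective {zero}  {suc m'} {n} {n'} e = contradiction (sym e) (even≢odd (pair m' n') n)
pair-injective {suc m} {zero}  {n} {n'} e = contradiction e (even≢odd (pair m n) n')
pair-injective {suc m} {suc m'} {n} {n'} e with pair-injective {m} {m'} (*-cancelˡ-≡ (pair m n) (pair m' n') 2 e)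
... | refl , n≡n' = refl , n≡n'

private
  encℤ : ℤ → ℕ
  encℤ (+ℤ n)    = pair 0 n
  encℤ (-[1+ n ]) = pair 1 n

  encℤ-injective : ∀ {i j} → encℤ i ≡ encℤ j → i ≡ j
  encℤ-injective {+ℤ m}      {+ℤ n}      e = cong +ℤ_ (proj₂ (pair-injective {0} {0} e))
  encℤ-injective {+ℤ m}      { -[1+ n ]} e = contradiction (proj₁ (pair-injective {0} {1} {m} {n} e)) λ ()
  encℤ-injective { -[1+ m ]} {+ℤ n}      e = contradiction (proj₁ (pair-injective {1} {0} {m} {n} e)) λ ()
  encℤ-injective { -[1+ m ]} { -[1+ n ]} e = cong -[1+_] (proj₂ (pair-injective {1} {1} {m} {n} e))

  encDir : Dir → ℕ
  encDir xp = 0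
  encDir xm = 1
  encDir yp = 2
  encDir ym = 3
  encDir zp = 4
  encDir zm = 5

  decDir : ℕ → Dir
  decDir 0 = xp
  decDir 1 = xm
  decDir 2 = yp
  decDir 3 = ym
  decDir 4 = zp
  decDir _ = zm

  decDir-encDir : ∀ d → decDir (encDir d) ≡ d
  decDir-encDir xp = refl
  decDir-encDir xm = refl
  decDir-encDir yp = refl
  decDir-encDir ym = refl
  decDir-encDir zp = refl
  decDir-encDir zm = refl

  encVal : Val → ℕ
  encVal (nothing    , false) = 0
  encVal (nothing    , true)  = 1
  encVal (just false , false) = 2
  encVal (just false , true)  = 3
  encVal (just true  , false) = 4
  encVal (just true  , true)  = 5

  decVal : ℕ → Val
  decVal 0 = nothing    , false
  decVal 1 = nothing    , true
  decVal 2 = just false , false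
  decVal 3 = just false , true
  decVal 4 = just true  , false
  decVal _ = just true  , true

  decVal-encVal : ∀ v → decVal (encVal v) ≡ v
  decVal-encVal (nothing    , false) = refl
  decVal-encVal (nothing    , true)  = refl
  decVal-encVal (just false , false) = refl
  decVal-encVal (just false , true)  = refl
  decVal-encVal (just true  , false) = refl
  decVal-encVal (just true  , true)  = refl

  encBool : Bool → ℕ
  encBool false = 0
  encBool true  = 1

  encBool-injective : ∀ {a b} → encBool a ≡ encBool b → a ≡ b
  encBool-injective {false} {false} _ = refl
  encBool-injective {true}  {true}  _ = refl

  encChan : Bool → Pos → Dir → Val → ℕ
  encChan s (x , y , z) d v =
    pair (encBool s) (pair (encℤ x) (pair (encℤ y) (pair (encℤ z) (pair (encDir d) (encVal v)))))

  encChan-injective : ∀ {s s' p p' d d' v v'} → encChan s p d v ≡ encChan s' p' d' v' →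
    chan s p d v ≡ chan s' p' d' v'
  encChan-injective {s} {s'} {x , y , z} {x' , y' , z'} {d} {d'} {v} {v'} e
    with pair-injective {encBool s} {encBool s'} e
  ... | es , e₁ with pair-injective {encℤ x} {encℤ x'} e₁
  ... | ex , e₂ with pair-injective {encℤ y} {encℤ y'} e₂
  ... | ey , e₃ with pair-injective {encℤ z} {encℤ z'} e₃
  ... | ez , e₄ with pair-injective {encDir d} {encDir d'} e₄
  ... | ed , ev
    with encBool-injective {s} {s'} es | encℤ-injective {x} {x'} ex | encℤ-injective {y} {y'} ey | encℤ-injective {z} {z'} ez
       | trans (sym (decDir-encDir d)) (trans (cong decDir ed) (decDir-encDir d'))
       | trans (sym (decVal-encVal v)) (trans (cong decVal ev) (decVal-encVal v'))
  ... | refl | refl | refl | refl | refl | refl = refl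

  index : Glue → ℕ
  index null         = 0
  index (bit false)  = 1
  index (bit true)   = 2
  index (obit false) = 3
  index (obit true)  = 4
  index (side false) = 5
  index (side true)  = 6
  index (chan s p d v) = 7 + encChan s p d v

  generic : ℕ → Glue
  generic 1 = bit false
  generic 2 = bit true
  generic 3 = obit false
  generic 4 = obit true
  generic 5 = side false
  generic 6 = side true
  generic _ = null

  index-view : ∀ g → (index g < 7 × generic (index g) ≡ g) ⊎ ∃ λ s → ∃ λ p → ∃ λ d → ∃ λ v → g ≡ chan s p d v
  index-view null         = inj₁ (s≤s z≤n , refl)
  index-view (bit false)  = inj₁ (s≤s (s≤s z≤n) , refl)
  index-view (bit true)   = inj₁ (s≤s (s≤s (s≤s z≤n)) , refl)
  index-view (obit false) = inj₁ (s≤s (s≤s (s≤s (s≤s z≤n))) , refl)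
  index-view (obit true)  = inj₁ (s≤s (s≤s (s≤s (s≤s (s≤s z≤n)))) , refl)
  index-view (side false) = inj₁ (s≤s (s≤s (s≤s (s≤s (s≤s (s≤s z≤n))))) , refl)
  index-view (side true)  = inj₁ (≤-refl , refl)
  index-view (chan s p d v) = inj₂ (s , p , d , v , refl)

  index-injective : ∀ {g h} → index g ≡ index h → g ≡ h
  index-injective {g} {h} e with index-view g | index-view h
  ... | inj₁ (_ , eg) | inj₁ (_ , eh) = trans (sym eg) (trans (cong generic e) eh)
  ... | inj₁ (lt , _) | inj₂ (_ , _ , _ , _ , refl) = contradiction (subst (_< 7) e lt) (m+n≮m 7 _)
  ... | inj₂ (_ , _ , _ , _ , refl) | inj₁ (lt , _) = contradiction (subst (_< 7) (sym e) lt) (m+n≮m 7 _)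
  ... | inj₂ (s , p , d , v , refl) | inj₂ (s' , p' , d' , v' , refl) =
    encChan-injective {s} {s'} {p} {p'} {d} {d'} {v} {v'} (+-cancelˡ-≡ 7 _ _ e)

code : Glue → ℕ
code g = strength g + index g * 3

codeStrength : ℕ → ℕ
codeStrength n = n % 3

codeStrength-code : ∀ g → codeStrength (code g) ≡ strength g
codeStrength-code g = trans ([m+kn]%n≡m%n (strength g) (index g) 3) (m<n⇒m%n≡m (strength<3 g))

code-injective : ∀ {g h} → code g ≡ code h → g ≡ h
code-injective {g} {h} e = index-injective (*-cancelʳ-≡ (index g) (index h) 3
  (+-cancelˡ-≡ (strength g) _ _ (trans e (cong (_+ index h * 3) (sym s≡)))))
  where
  s≡ : strength g ≡ strength h
  s≡ = trans (sym (codeStrength-code g)) (trans (cong codeStrength e) (codeStrength-code h))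

tileOf : (Dir → Glue) → Label → Tile
tileOf f = mkTile (code (f xp)) (code (f xm)) (code (f yp)) (code (f ym)) (code (f zp)) (code (f zm))

glue-tileOf : ∀ f l d → glue (tileOf f l) d ≡ code (f d)
glue-tileOf f l xp = refl
glue-tileOf f l xm = refl
glue-tileOf f l yp = refl
glue-tileOf f l ym = refl
glue-tileOf f l zp = refl
glue-tileOf f l zm = refl

tileOf-cong : ∀ {f f' l} → (∀ d → f d ≡ f' d) → tileOf f l ≡ tileOf f' l
tileOf-cong {f} {f'} e rewrite e xp | e xm | e yp | e ym | e zp | e zm = refl

bond-≡ : ∀ {f l f' l'} d → f d ≡ f' (opp d) →
  bond codeStrength (tileOf f l) d (tileOf f' l') ≡ strength (f d)
bond-≡ {f} {l} {f'} {l'} d e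
  rewrite glue-tileOf f l d | glue-tileOf f' l' (opp d) | sym e | ≡ᵇ-refl (code (f d)) = codeStrength-code (f d)

bond-inv : ∀ {f l f' l'} d → bond codeStrength (tileOf f l) d (tileOf f' l') ≢ 0 →
  f d ≡ f' (opp d) × f d ≢ null
bond-inv {f} {l} {f'} {l'} d b≢0 rewrite glue-tileOf f l d | glue-tileOf f' l' (opp d)
  with code (f d) ≡ᵇ code (f' (opp d)) in e
... | false = contradiction refl b≢0
... | true  = code-injective (≡ᵇ-sound _ _ e) , λ n → b≢0 (trans (codeStrength-code (f d)) (cong strength n))

bond-≤ : ∀ {f l} d t → bond codeStrength (tileOf f l) d t ≤ strength (f d)
bond-≤ {f} {l} d t rewrite glue-tileOf f l d with code (f d) ≡ᵇ glue t (opp d)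
... | false = z≤n
... | true  = ≤-reflexive (codeStrength-code (f d))

-- Circuits

data Mode : Set where
  sel both read : Mode

data Spec : Set where
  none root inp outp : Spec
  stone wire : Dir → Spec
  gate : Mode → Dir → Dir → Spec

_==D_ : Dir → Dir → Bool
d ==D e = does (d ≟D e)

==D-refl : ∀ d → (d ==D d) ≡ true
==D-refl d with d ≟D d
... | yes _   = refl
... | no  d≢d = contradiction refl d≢d

==D-sound : ∀ {d e} → (d ==D e) ≡ true → d ≡ e
==D-sound {d} {e} h with d ≟D e
... | yes eq = eq

==D-≢ : ∀ {d e} → d ≢ e → (d ==D e) ≡ false
==D-≢ {d} {e} d≢e with d ≟D e
... | yes eq = contradiction eq d≢e
... | no  _  = refl

isIn : Spec → Dir → Bool
isIn none           _  = false
isIn root           _  = false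
isIn (stone d₁)     d  = d ==D d₁
isIn (wire d₁)      d  = d ==D d₁
isIn (gate _ d₁ d₂) d  = (d ==D d₁) ∨ (d ==D d₂)
isIn inp            zm = true
isIn inp            zp = true
isIn inp            _  = false
isIn outp           yp = true
isIn outp           zm = true
isIn outp           _  = false

needs : Mode → Val → Bool
needs sel  (nothing , _) = true
needs sel  (just _ , _)  = false
needs both _             = true
needs read _             = true

data Stone : Spec → Set where
  root  : Stone root
  stone : ∀ {d} → Stone (stone d)

data Chan : Spec → Set where
  stone : ∀ {s} → Stone s → Chan s
  wire  : ∀ {d} → Chan (wire d)
  gate  : ∀ {m d e} → Chan (gate m d e)

isStone : Spec → Bool
isStone root      = true
isStone (stone _) = true
isStone _         = false

isSeed : Spec → Bool
isSeed inp = true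
isSeed s   = isStone s

Stone-seed : ∀ {s} → Stone s → isSeed s ≡ true
Stone-seed root  = refl
Stone-seed stone = refl

data SourceOK : Spec → Dir → Spec → Set where
  stone  : ∀ {d s} → Stone s → SourceOK (stone d) d s
  wire   : ∀ {d s} → Chan s → SourceOK (wire d) d s
  first  : ∀ {m d e s} → Chan s → SourceOK (gate m d e) d s
  sel₂   : ∀ {d e s} → Chan s → SourceOK (gate sel d e) e s
  both₂  : ∀ {d e s} → Chan s → SourceOK (gate both d e) e s
  read₂  : ∀ {d} → SourceOK (gate read d yp) yp inp
  inp-zm : ∀ {s} → Stone s → SourceOK inp zm s
  inp-zp : ∀ {s} → Stone s → SourceOK inp zp s
  outp-yp : ∀ {d e} → SourceOK outp yp (gate both d e)
  outp-zm : ∀ {s} → Stone s → SourceOK outp zm s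

record Circuit : Set₁ where
  field
    Input   : Set
    inputs  : List Input
    input∈  : ∀ b → b ∈ inputs
    spec    : Pos → Spec
    value   : Input → Pos → Val
    digit   : Input → Pos → Bool
    support : List Pos
    covers  : ∀ p → spec p ≢ none → p ∈ support
    rank    : Pos → ℕ
    source  : ∀ p d → isIn (spec p) d ≡ true →
              SourceOK (spec p) d (spec (p ⊕ d)) × rank (p ⊕ d) < rank p
    gate-≢  : ∀ {p m d e} → spec p ≡ gate m d e → d ≢ e
    base    : Pos
    base-root  : spec base ≡ root
    root-base  : ∀ {p} → spec p ≡ root → p ≡ base
    val-stone  : ∀ b b' p → Stone (spec p) → value b p ≡ value b' p
    val-wire   : ∀ b b' {p d} → spec p ≡ wire d → value b (p ⊕ d) ≡ value b' (p ⊕ d) → value b p ≡ value b' p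
    val-sel    : ∀ b b' {p d e} → spec p ≡ gate sel d e → value b (p ⊕ d) ≡ value b' (p ⊕ d) →
                 (needs sel (value b (p ⊕ d)) ≡ true → value b (p ⊕ e) ≡ value b' (p ⊕ e)) → value b p ≡ value b' p
    val-both   : ∀ b b' {p d e} → spec p ≡ gate both d e → value b (p ⊕ d) ≡ value b' (p ⊕ d) →
                 value b (p ⊕ e) ≡ value b' (p ⊕ e) → value b p ≡ value b' p
    val-read   : ∀ b b' {p d e} → spec p ≡ gate read d e → value b (p ⊕ d) ≡ value b' (p ⊕ d) →
                 digit b (p ⊕ e) ≡ digit b' (p ⊕ e) → value b p ≡ value b' p
    digit-outp : ∀ b {p} → spec p ≡ outp → digit b p ≡ proj₂ (value b (p ⊕ yp))

module CircuitGrowth (𝒞 : Circuit) where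
  open Circuit 𝒞

  edgeOf : Spec → Input → Pos → Dir → Glue
  edgeOf none      b p d  = null
  edgeOf root      b p d  = null
  edgeOf (stone e) b p d  = if d ==D e then chan true p d (value b (p ⊕ d)) else null
  edgeOf (wire e)  b p d  = if d ==D e then chan true p d (value b (p ⊕ d)) else null
  edgeOf (gate m e₁ e₂) b p d =
    if d ==D e₁ then chan (not (needs m (value b (p ⊕ d)))) p d (value b (p ⊕ d))
    else if d ==D e₂ then second m else null
    where
    second : Mode → Glue
    second read = bit (digit b (p ⊕ d))
    second both = chan false p d (value b (p ⊕ d))
    second sel  = chan false p d (value b (p ⊕ d))
  edgeOf inp       b p zm = side false
  edgeOf inp       b p zp = side true
  edgeOf inp       b p _  = null
  edgeOf outp      b p yp = obit (proj₂ (value b (p ⊕ yp)))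
  edgeOf outp      b p zm = side false
  edgeOf outp      b p _  = null

  -- The glue by which the tile at p is bonded to its source in direction d.
  edge : Input → Pos → Dir → Glue
  edge b p = edgeOf (spec p) b p

  reqOf : Spec → Input → Pos → Dir → Bool
  reqOf (gate m e₁ e₂) b p d = (d ==D e₁) ∨ ((d ==D e₂) ∧ needs m (value b (p ⊕ e₁)))
  reqOf s              b p d = isIn s d

  required : Input → Pos → Dir → Bool
  required b p = reqOf (spec p) b p

  gateFace : Input → Pos → Dir → Glue
  gateFace b p d =
    if isIn (spec p) d then (if required b p d then edge b p d else null) else edge b (p ⊕ d) (opp d)

  bitFace : Bool → Dir → Glue
  bitFace β xp = null
  bitFace β xm = null
  bitFace β yp = obit β
  bitFace β ym = bit β
  bitFace β zp = side true
  bitFace β zm = side false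

  faceOf : Spec → Input → Pos → Dir → Glue
  faceOf inp  b p = bitFace (digit b p)
  faceOf outp b p = bitFace (digit b p)
  faceOf _    b p = gateFace b p

  face : Input → Pos → Dir → Glue
  face b p = faceOf (spec p) b p

  gateTile : Input → Pos → Tile
  gateTile b p = tileOf (gateFace b p) (other 0)

  digitTile : Bool → Tile
  digitTile β = tileOf (bitFace β) (bitLabel β)

  finalOf : Spec → Input → Pos → Maybe Tile
  finalOf none b p = nothing
  finalOf inp  b p = just (digitTile (digit b p))
  finalOf outp b p = just (digitTile (digit b p))
  finalOf _    b p = just (gateTile b p)

  final⁺ : Input → Pos → Maybe Tile
  final⁺ b p = finalOf (spec p) b p

  data EdgeView (b : Input) (p : Pos) (d : Dir) : Glue → Set where
    null  : EdgeView b p d null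
    chan  : ∀ {s v} → isIn (spec p) d ≡ true → EdgeView b p d (chan s p d v)
    bit   : ∀ {e} → spec p ≡ gate read e d → EdgeView b p d (bit (digit b (p ⊕ d)))
    obit  : spec p ≡ outp → d ≡ yp → EdgeView b p d (obit (proj₂ (value b (p ⊕ yp))))
    side₀ : d ≡ zm → spec p ≡ inp ⊎ spec p ≡ outp → EdgeView b p d (side false)
    side₁ : d ≡ zp → spec p ≡ inp → EdgeView b p d (side true)

  edge-view : ∀ b p d → EdgeView b p d (edge b p d)
  edge-view b p d = view d (spec p) refl
    where
    view : ∀ d s → spec p ≡ s → EdgeView b p d (edgeOf s b p d)
    view d none      e = null
    view d root      e = null
    view d (stone c) e with d ==D c in h
    ... | true  = chan (subst (λ s → isIn s d ≡ true) (sym e) h)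
    ... | false = null
    view d (wire c) e with d ==D c in h
    ... | true  = chan (subst (λ s → isIn s d ≡ true) (sym e) h)
    ... | false = null
    view d (gate m c₁ c₂) e with d ==D c₁ in h₁
    ... | true = chan (subst (λ s → isIn s d ≡ true) (sym e) (cong (_∨ (d ==D c₂)) h₁))
    ... | false with d ==D c₂ in h₂
    ...   | false = null
    view d (gate sel  c₁ c₂) e | false | true = chan (subst (λ s → isIn s d ≡ true) (sym e) (cong₂ _∨_ h₁ h₂))
    view d (gate both c₁ c₂) e | false | true = chan (subst (λ s → isIn s d ≡ true) (sym e) (cong₂ _∨_ h₁ h₂))
    view d (gate read c₁ c₂) e | false | true with ==D-sound {d} {c₂} h₂
    ... | refl = bit e
    view xp inp e = null
    view xm inp e = null
    view yp inp e = null
    view ym inp e = null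
    view zp inp e = side₁ refl e
    view zm inp e = side₀ refl (inj₁ e)
    view xp outp e = null
    view xm outp e = null
    view yp outp e = obit e refl
    view ym outp e = null
    view zp outp e = null
    view zm outp e = side₀ refl (inj₂ e)

  sourceOf : ∀ {p s} → spec p ≡ s → ∀ d → isIn s d ≡ true → SourceOK s d (spec (p ⊕ d))
  sourceOf {p} refl d h = proj₁ (source p d h)

  private
    ∨-rightT : ∀ a → (a ∨ true) ≡ true
    ∨-rightT false = refl
    ∨-rightT true  = refl

  in₁ : ∀ m d e → isIn (gate m d e) d ≡ true
  in₁ m d e rewrite ==D-refl d = refl

  in₂ : ∀ m d e → isIn (gate m d e) e ≡ true
  in₂ m d e rewrite ==D-refl e = ∨-rightT (e ==D d)

  read-source : ∀ {p e d} → spec p ≡ gate read e d → d ≡ yp × spec (p ⊕ d) ≡ inp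
  read-source {p} {e} {d} h with spec (p ⊕ d) | sourceOf h d (in₂ read e d)
  ... | _ | first _ = contradiction refl (gate-≢ h)
  ... | _ | read₂   = refl , refl

  private
    class : ∀ s → s ≡ none ⊎ (s ≡ inp ⊎ s ≡ outp) ⊎ Chan s
    class none         = inj₁ refl
    class root         = inj₂ (inj₂ (stone root))
    class inp          = inj₂ (inj₁ (inj₁ refl))
    class outp         = inj₂ (inj₁ (inj₂ refl))
    class (stone _)    = inj₂ (inj₂ (stone stone))
    class (wire _)     = inj₂ (inj₂ wire)
    class (gate _ _ _) = inj₂ (inj₂ gate)

  face-Chan : ∀ b {p} → Chan (spec p) → face b p ≡ gateFace b p
  face-Chan b {p} = help
    where
    help : ∀ {s} → Chan s → faceOf s b p ≡ gateFace b p
    help (stone root)  = refl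
    help (stone stone) = refl
    help wire          = refl
    help gate          = refl

  face-digit : ∀ b {p} → spec p ≡ inp ⊎ spec p ≡ outp → face b p ≡ bitFace (digit b p)
  face-digit b {p} (inj₁ e) = cong (λ s → faceOf s b p) e
  face-digit b {p} (inj₂ e) = cong (λ s → faceOf s b p) e

  final-Chan : ∀ b {p} → Chan (spec p) → final⁺ b p ≡ just (gateTile b p)
  final-Chan b {p} = help
    where
    help : ∀ {s} → Chan s → finalOf s b p ≡ just (gateTile b p)
    help (stone root)  = refl
    help (stone stone) = refl
    help wire          = refl
    help gate          = refl

  final-digit : ∀ b {p} → spec p ≡ inp ⊎ spec p ≡ outp → final⁺ b p ≡ just (digitTile (digit b p))
  final-digit b {p} (inj₁ e) = cong (λ s → finalOf s b p) e
  final-digit b {p} (inj₂ e) = cong (λ s → finalOf s b p) e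

  final-none : ∀ b {p} → spec p ≡ none → final⁺ b p ≡ nothing
  final-none b {p} e = cong (λ s → finalOf s b p) e

  final-tile : ∀ b {p t} → final⁺ b p ≡ just t → spec p ≢ none × ∃ λ l → t ≡ tileOf (face b p) l
  final-tile b {p} {t} h with class (spec p)
  ... | inj₁ e = contradiction (final-none b e) (just≢nothing h)
  ... | inj₂ (inj₁ e) = (λ n → just≢nothing h (final-none b n)) , _ ,
        trans (just-injective (trans (sym h) (final-digit b e)))
              (cong (λ f → tileOf f (bitLabel (digit b p))) (sym (face-digit b e)))
  ... | inj₂ (inj₂ c) = (λ n → just≢nothing h (final-none b n)) , _ ,
        trans (just-injective (trans (sym h) (final-Chan b c)))
              (cong (λ f → tileOf f (other 0)) (sym (face-Chan b c)))

  edge-back : ∀ b p d → edge b ((p ⊕ d) ⊕ opp d) (opp (opp d)) ≡ edge b p d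
  edge-back b p d rewrite ⊕-opp p d | opp-involutive d = refl

  -- A nonzero bond with a neighbour that does not depend on p.
  data Match (b : Input) (p : Pos) (d : Dir) (f : Dir → Glue) : Set where
    along : Chan (spec (p ⊕ d)) → f d ≡ edge b p d → Match b p d f
    facing : spec (p ⊕ d) ≡ inp ⊎ spec (p ⊕ d) ≡ outp →
            f d ≡ bitFace (digit b (p ⊕ d)) (opp d) → Match b p d f

  bond-match : ∀ b {g p f l d} → g ⊑ final⁺ b →
    (∀ {t'} → g (p ⊕ d) ≡ just t' → required b (p ⊕ d) (opp d) ≡ false) →
    bondAt codeStrength g p (tileOf f l) d ≢ 0 →
    (∃ λ t' → g (p ⊕ d) ≡ just t') × f d ≢ null × Match b p d f
  bond-match b {g} {p} {f} {l} {d} g⊑ free nz with g (p ⊕ d) in e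
  ... | nothing = contradiction refl nz
  ... | just t' with final-tile b (g⊑ e)
  ...   | ¬none , l' , refl with bond-inv {f} {l} {face b (p ⊕ d)} {l'} d nz | class (spec (p ⊕ d))
  ...     | _ | inj₁ n = contradiction n ¬none
  ...     | eq , ≢null | inj₂ (inj₁ dig) = (t' , refl) , ≢null ,
            facing dig (trans eq (cong (λ h → h (opp d)) (face-digit b dig)))
  ...     | eq , ≢null | inj₂ (inj₂ c) with isIn (spec (p ⊕ d)) (opp d) in i
  ...       | true = contradiction (trans eq (trans (cong (λ h → h (opp d)) (face-Chan b c))
                       (trans (if-then i) (if-else (free refl))))) ≢null
  ...       | false = (t' , refl) , ≢null ,
            along c (trans eq (trans (cong (λ h → h (opp d)) (face-Chan b c)) (trans (if-else i) (edge-back b p d))))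

  bondAt-≤ : ∀ {g p f l} d → bondAt codeStrength g p (tileOf f l) d ≤ strength (f d)
  bondAt-≤ {g} {p} {f} {l} d with g (p ⊕ d)
  ... | nothing = z≤n
  ... | just t' = bond-≤ {f} {l} d t'

module Determinism (𝒞 : Circuit) where
  open Circuit 𝒞
  open CircuitGrowth 𝒞

  seed-absurd : ∀ {s} {A : Set} → isSeed s ≡ false → Stone s → A
  seed-absurd () root
  seed-absurd () stone

  inp-absurd : ∀ {s} {A : Set} → isSeed s ≡ false → s ≡ inp → A
  inp-absurd () refl

  Chan-digit : ∀ {s} {A : Set} → Chan s → s ≡ inp ⊎ s ≡ outp → A
  Chan-digit (stone root)  (inj₁ ())
  Chan-digit (stone root)  (inj₂ ())
  Chan-digit (stone stone) (inj₁ ())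
  Chan-digit (stone stone) (inj₂ ())
  Chan-digit wire (inj₁ ())
  Chan-digit wire (inj₂ ())
  Chan-digit gate (inj₁ ())
  Chan-digit gate (inj₂ ())

  data Meet (p : Pos) (d : Dir) (p' : Pos) (d' : Dir) : Set where
    same  : p ≡ p' → d ≡ d' → isIn (spec p) d ≡ true → Meet p d p' d'
    atInput : d ≡ d' → spec (p ⊕ d) ≡ inp → Meet p d p' d'
    atDigit : d ≡ d' → spec p' ≡ inp ⊎ spec p' ≡ outp → Meet p d p' d'

  private
    meet : ∀ {b p d b' p' d' g g'} → EdgeView b p d g → EdgeView b' p' d' g' → g ≡ g' → g ≢ null → Meet p d p' d'
    meet null           _               _    ≢null = contradiction refl ≢null
    meet (chan i)       (chan _)        refl _ = same refl refl i
    meet (bit s)        (bit s')        _    _ =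
      atInput (trans (proj₁ (read-source s)) (sym (proj₁ (read-source s')))) (proj₂ (read-source s))
    meet (obit _ d≡)    (obit s' d'≡)   _    _ = atDigit (trans d≡ (sym d'≡)) (inj₂ s')
    meet (side₀ d≡ _)   (side₀ d'≡ s')  _    _ = atDigit (trans d≡ (sym d'≡)) s'
    meet (side₁ d≡ _)   (side₁ d'≡ s')  _    _ = atDigit (trans d≡ (sym d'≡)) (inj₁ s')
    meet (chan _)       null            () _
    meet (chan _)       (bit _)         () _
    meet (chan _)       (obit _ _)      () _
    meet (chan _)       (side₀ _ _)     () _
    meet (chan _)       (side₁ _ _)     () _
    meet (bit _)        null            () _
    meet (bit _)        (chan _)        () _
    meet (bit _)        (obit _ _)      () _
    meet (bit _)        (side₀ _ _)     () _
    meet (bit _)        (side₁ _ _)     () _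
    meet (obit _ _)     null            () _
    meet (obit _ _)     (chan _)        () _
    meet (obit _ _)     (bit _)         () _
    meet (obit _ _)     (side₀ _ _)     () _
    meet (obit _ _)     (side₁ _ _)     () _
    meet (side₀ _ _)    null            () _
    meet (side₀ _ _)    (chan _)        () _
    meet (side₀ _ _)    (bit _)         () _
    meet (side₀ _ _)    (obit _ _)      () _
    meet (side₀ _ _)    (side₁ _ _)     () _
    meet (side₁ _ _)    null            () _
    meet (side₁ _ _)    (chan _)        () _
    meet (side₁ _ _)    (bit _)         () _
    meet (side₁ _ _)    (obit _ _)      () _
    meet (side₁ _ _)    (side₀ _ _)     () _

  edge-meet : ∀ b p d b' p' d' → edge b p d ≡ edge b' p' d' → edge b p d ≢ null → Meet p d p' d'
  edge-meet b p d b' p' d' = meet (edge-view b p d) (edge-view b' p' d')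

  digit-match : ∀ {b p} d {β} → isSeed (spec p) ≡ false → Match b p d (bitFace β) → bitFace β d ≢ null →
    spec p ≡ outp × ((d ≡ yp × β ≡ proj₂ (value b (p ⊕ yp))) ⊎ d ≡ zm)
  digit-match xp _ _ ≢null = contradiction refl ≢null
  digit-match xm _ _ ≢null = contradiction refl ≢null
  digit-match {b} {p} yp _ (along _ e) _ with edge b p yp | edge-view b p yp
  digit-match yp _ (along _ refl) _ | _ | obit s _ = s , inj₁ (refl , refl)
  digit-match {b} {p} ym _ (along _ e) _ with edge b p ym | edge-view b p ym
  ... | _ | bit s = contradiction (proj₁ (read-source s)) λ ()
  digit-match {b} {p} zp ¬seed (along _ e) _ with edge b p zp | edge-view b p zp
  ... | _ | side₀ () _
  ... | _ | side₁ _ s = inp-absurd ¬seed s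
  digit-match {b} {p} zm ¬seed (along _ e) _ with edge b p zm | edge-view b p zm
  ... | _ | side₀ _ (inj₁ s) = inp-absurd ¬seed s
  ... | _ | side₀ _ (inj₂ s) = s , inj₂ refl
  ... | _ | side₁ () _

  data GateMatch (b : Input) (p : Pos) (d : Dir) (f : Dir → Glue) (p' : Pos) : Set where
    own   : p' ≡ p → isIn (spec p) d ≡ true → f d ≡ edge b p d → GateMatch b p d f p'
    read  : ∀ {e} → d ≡ yp → spec p' ≡ gate read e yp → f d ≡ bit (digit b (p ⊕ yp)) → GateMatch b p d f p'
    write : ∀ {e e' β} → d ≡ ym → spec p' ≡ gate both e e' → spec (p' ⊕ ym) ≡ outp → f d ≡ obit β → GateMatch b p d f p'
    wall  : d ≡ zm → Stone (spec p') → f d ≡ side true → GateMatch b p d f p'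

  gateFace-cases : ∀ b p d → gateFace b p d ≢ null →
    (isIn (spec p) d ≡ true × gateFace b p d ≡ edge b p d) ⊎
    gateFace b p d ≡ edge b (p ⊕ d) (opp d)
  gateFace-cases b p d ≢null with isIn (spec p) d | required b p d
  ... | true  | true  = inj₁ (refl , refl)
  ... | true  | false = contradiction refl ≢null
  ... | false | _     = inj₂ refl

  gate-match : ∀ {b p b' p'} d → isSeed (spec p) ≡ false → Chan (spec p') →
    Match b p d (gateFace b' p') → gateFace b' p' d ≢ null → GateMatch b p d (gateFace b' p') p'
  gate-match {b} {p} {b'} {p'} d ¬seed c' (along c e) ≢null with gateFace-cases b' p' d ≢null
  ... | inj₁ (_ , e') with edge-meet b p d b' p' d (trans (sym e) e') (λ n → ≢null (trans e n))
  ...   | same p≡p' _ i = own (sym p≡p') i e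
  ...   | atInput _ s   = Chan-digit c (inj₁ s)
  ...   | atDigit _ s   = Chan-digit c' s
  gate-match {b} {p} {b'} {p'} d ¬seed c' (along c e) ≢null | inj₂ e'
    with edge-meet b p d b' (p' ⊕ d) (opp d) (trans (sym e) e') (λ n → ≢null (trans e n))
  ...   | same _ d≡ _ = contradiction d≡ (opp-≢ d)
  ...   | atInput d≡ _ = contradiction d≡ (opp-≢ d)
  ...   | atDigit d≡ _ = contradiction d≡ (opp-≢ d)
  gate-match xp ¬seed c' (facing q e) ≢null = contradiction e ≢null
  gate-match xm ¬seed c' (facing q e) ≢null = contradiction e ≢null
  gate-match {b} {p} {b'} {p'} yp ¬seed c' (facing q e) ≢null with gateFace-cases b' p' yp ≢null
  ... | inj₁ (_ , e') with edge b' p' yp | edge-view b' p' yp | trans (sym e') e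
  ...   | _ | bit s | _ = read refl s e
  gate-match {b} {p} {b'} {p'} yp ¬seed c' (facing q e) ≢null | inj₂ e'
    with edge b' (p' ⊕ yp) ym | edge-view b' (p' ⊕ yp) ym | trans (sym e') e
  ...   | _ | bit s | _ = contradiction (proj₁ (read-source s)) λ ()
  gate-match {b} {p} {b'} {p'} ym ¬seed c' (facing q e) ≢null with gateFace-cases b' p' ym ≢null
  ... | inj₁ (_ , e') with edge b' p' ym | edge-view b' p' ym | trans (sym e') e
  ...   | _ | obit _ () | _
  gate-match {b} {p} {b'} {p'} ym ¬seed c' (facing q e) ≢null | inj₂ e'
    with edge b' (p' ⊕ ym) yp | edge-view b' (p' ⊕ ym) yp | trans (sym e') e
  ...   | _ | obit s _ | _ with spec p' in sp' | subst (λ r → SourceOK outp yp (spec r)) (⊕-opp p' ym) (sourceOf s yp refl)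
  ...     | _ | outp-yp = write refl sp' s e
  gate-match {b} {p} {b'} {p'} zp ¬seed c' (facing (inj₁ q) e) ≢null
    with spec p | ¬seed | subst (λ r → SourceOK inp zm (spec r)) (⊕-opp p zp) (sourceOf q zm refl)
  ... | _ | ns | inp-zm st = seed-absurd ns st
  gate-match {b} {p} {b'} {p'} zp ¬seed c' (facing (inj₂ q) e) ≢null
    with spec p | ¬seed | subst (λ r → SourceOK outp zm (spec r)) (⊕-opp p zp) (sourceOf q zm refl)
  ... | _ | ns | outp-zm st = seed-absurd ns st
  gate-match {b} {p} {b'} {p'} zm ¬seed c' (facing q e) ≢null with gateFace-cases b' p' zm ≢null
  ... | inj₁ (_ , e') with edge b' p' zm | edge-view b' p' zm | trans (sym e') e
  ...   | _ | side₁ () _ | _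
  gate-match {b} {p} {b'} {p'} zm ¬seed c' (facing q e) ≢null | inj₂ e'
    with edge b' (p' ⊕ zm) zp | edge-view b' (p' ⊕ zm) zp | trans (sym e') e
  ...   | _ | side₁ _ s | _ with subst (λ r → SourceOK inp zp (spec r)) (⊕-opp p' zm) (sourceOf s zp refl)
  ...     | inp-zp st = wall refl st e

module CircuitTiles (𝒞 : Circuit) where
  open Circuit 𝒞
  open CircuitGrowth 𝒞
  open Determinism 𝒞

  gateTilesOf : Spec → Input → Pos → List Tile
  gateTilesOf none b p = []
  gateTilesOf inp  b p = []
  gateTilesOf outp b p = []
  gateTilesOf _    b p = gateTile b p ∷ []

  gateTiles : Input → Pos → List Tile
  gateTiles b p = gateTilesOf (spec p) b p

  circuitTiles : List Tile
  circuitTiles = digitTile false ∷ digitTile true ∷ concatMap (λ b → concatMap (gateTiles b) support) inputs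

  gateTiles-Chan : ∀ b {p} → Chan (spec p) → gateTile b p ∈ gateTiles b p
  gateTiles-Chan b {p} = help
    where
    help : ∀ {s} → Chan s → gateTile b p ∈ gateTilesOf s b p
    help (stone root)  = here refl
    help (stone stone) = here refl
    help wire          = here refl
    help gate          = here refl

  gateTiles⁻ : ∀ b p {t} → t ∈ gateTiles b p → Chan (spec p) × t ≡ gateTile b p
  gateTiles⁻ b p {t} = help (spec p)
    where
    help : ∀ s → t ∈ gateTilesOf s b p → Chan s × t ≡ gateTile b p
    help root         (here e) = stone root , e
    help (stone _)    (here e) = stone stone , e
    help (wire _)     (here e) = wire , e
    help (gate _ _ _) (here e) = gate , e

  circuitTiles⁻ : ∀ {t} → t ∈ circuitTiles →
    (∃ λ β → t ≡ digitTile β) ⊎ ∃ λ b → ∃ λ p → Chan (spec p) × t ≡ gateTile b p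
  circuitTiles⁻ (here refl)         = inj₁ (false , refl)
  circuitTiles⁻ (there (here refl)) = inj₁ (true , refl)
  circuitTiles⁻ (there (there t∈)) with Any.satisfied (∈-concatMap⁻ (λ b → concatMap (gateTiles b) support) {xs = inputs} t∈)
  ... | b , t∈b with Any.satisfied (∈-concatMap⁻ (gateTiles b) {xs = support} t∈b)
  ...   | p , t∈p = inj₂ (b , p , gateTiles⁻ b p t∈p)

  digitTile∈ : ∀ β → digitTile β ∈ circuitTiles
  digitTile∈ false = here refl
  digitTile∈ true  = there (here refl)

  final-∈ : ∀ b p t → final⁺ b p ≡ just t → t ∈ circuitTiles
  final-∈ b p t = help (spec p) refl
    where
    gate∈ : Chan (spec p) → just (gateTile b p) ≡ just t → t ∈ circuitTiles
    gate∈ c refl = there (there (∈-concatMap⁺ (λ b → concatMap (gateTiles b) support)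
      (Any.map (λ { refl → ∈-concatMap⁺ (gateTiles b) {xs = support}
        (Any.map (λ { refl → gateTiles-Chan b c }) (covers p λ n → Chan-none c n)) }) (input∈ b))))
      where
      Chan-none : ∀ {s} → Chan s → s ≢ none
      Chan-none (stone root) ()
      Chan-none (stone stone) ()
      Chan-none wire ()
      Chan-none gate ()
    help : ∀ s → spec p ≡ s → finalOf s b p ≡ just t → t ∈ circuitTiles
    help inp          e refl = digitTile∈ (digit b p)
    help outp         e refl = digitTile∈ (digit b p)
    help root         e h = gate∈ (subst Chan (sym e) (stone root)) h
    help (stone _)    e h = gate∈ (subst Chan (sym e) (stone stone)) h
    help (wire _)     e h = gate∈ (subst Chan (sym e) wire) h
    help (gate _ _ _) e h = gate∈ (subst Chan (sym e) gate) h

  system : TileSystem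
  system = record { tiles = circuitTiles ; str = codeStrength ; τ = 2 }

  private
    module _ {b : Input} {p : Pos} {m : Mode} {d e : Dir} (s : spec p ≡ gate m d e) where
      req₁ : required b p d ≡ true
      req₁ rewrite s | ==D-refl d = refl

      req₂ : required b p e ≡ needs m (value b (p ⊕ d))
      req₂ rewrite s | ==D-refl e | ==D-≢ (gate-≢ s ∘ sym) = refl

      isIn₁ : isIn (spec p) d ≡ true
      isIn₁ = subst (λ r → isIn r d ≡ true) (sym s) (in₁ m d e)

      isIn₂ : isIn (spec p) e ≡ true
      isIn₂ = subst (λ r → isIn r e ≡ true) (sym s) (in₂ m d e)

      edge₁ : edge b p d ≡ chan (not (needs m (value b (p ⊕ d)))) p d (value b (p ⊕ d))
      edge₁ rewrite s | ==D-refl d = refl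

    edge₂-sel : ∀ {b p d e} → spec p ≡ gate sel d e → edge b p e ≡ chan false p e (value b (p ⊕ e))
    edge₂-sel {e = e} s rewrite s | ==D-refl e | ==D-≢ (gate-≢ s ∘ sym) = refl

    edge₂-both : ∀ {b p d e} → spec p ≡ gate both d e → edge b p e ≡ chan false p e (value b (p ⊕ e))
    edge₂-both {e = e} s rewrite s | ==D-refl e | ==D-≢ (gate-≢ s ∘ sym) = refl

    edge₂-read : ∀ {b p d e} → spec p ≡ gate read d e → edge b p e ≡ bit (digit b (p ⊕ e))
    edge₂-read {e = e} s rewrite s | ==D-refl e | ==D-≢ (gate-≢ s ∘ sym) = refl

    edge₂-strength : ∀ {b p m d e} → spec p ≡ gate m d e → strength (edge b p e) ≡ 1
    edge₂-strength {m = sel}  s = cong strength (edge₂-sel s)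
    edge₂-strength {m = both} s = cong strength (edge₂-both s)
    edge₂-strength {m = read} s = cong strength (edge₂-read s)

    edge-wire : ∀ {b p d} → spec p ≡ wire d → edge b p d ≡ chan true p d (value b (p ⊕ d))
    edge-wire {d = d} s rewrite s | ==D-refl d = refl

    edge-stone : ∀ {b p d} → spec p ≡ stone d → edge b p d ≡ chan true p d (value b (p ⊕ d))
    edge-stone {d = d} s rewrite s | ==D-refl d = refl

    isIn-wire : ∀ {p d e} → spec p ≡ wire d → isIn (spec p) e ≡ true → e ≡ d
    isIn-wire {d = d} {e} s i rewrite s = ==D-sound i

    isIn-gate : ∀ {p m d e f} → spec p ≡ gate m d e → isIn (spec p) f ≡ true → f ≡ d ⊎ f ≡ e
    isIn-gate {d = d} {e} {f} s i rewrite s with f ≟D d | f ≟D e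
    ... | yes f≡d | _       = inj₁ f≡d
    ... | no  _   | yes f≡e = inj₂ f≡e

    chan-value : ∀ {s p d v s' p' d' v'} → _≡_ {A = Glue} (chan s p d v) (chan s' p' d' v') → v ≡ v'
    chan-value refl = refl

    bit-value : ∀ {β γ} → _≡_ {A = Glue} (bit β) (bit γ) → β ≡ γ
    bit-value refl = refl

  gateFace-in : ∀ b p d → isIn (spec p) d ≡ true → required b p d ≡ true → gateFace b p d ≡ edge b p d
  gateFace-in b p d i r rewrite i | r = refl

  gateFace-idle : ∀ b p d → isIn (spec p) d ≡ true → required b p d ≡ false → gateFace b p d ≡ null
  gateFace-idle b p d i r rewrite i | r = refl

  gateFace-out : ∀ b p d → isIn (spec p) d ≡ false → gateFace b p d ≡ edge b (p ⊕ d) (opp d)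
  gateFace-out b p d i rewrite i = refl

  edge-cong : ∀ b b' p d → Chan (spec (p ⊕ d)) → value b (p ⊕ d) ≡ value b' (p ⊕ d) → edge b p d ≡ edge b' p d
  edge-cong b b' p d c v≡ = help d c v≡ (spec p) refl
    where
    help : ∀ d → Chan (spec (p ⊕ d)) → value b (p ⊕ d) ≡ value b' (p ⊕ d) → ∀ s → spec p ≡ s →
      edgeOf s b p d ≡ edgeOf s b' p d
    help d c v≡ none      e = refl
    help d c v≡ root      e = refl
    help d c v≡ (stone _) e rewrite v≡ = refl
    help d c v≡ (wire _)  e rewrite v≡ = refl
    help d c v≡ (gate m d₁ d₂) e rewrite v≡ with d ≟D d₁ | d ≟D d₂
    ... | yes _ | _     = refl
    ... | no  _ | no  _ = refl
    help d c v≡ (gate sel  d₁ d₂) e | no _ | yes _ = cong (chan false p d) v≡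
    help d c v≡ (gate both d₁ d₂) e | no _ | yes _ = cong (chan false p d) v≡
    help d c v≡ (gate read d₁ d₂) e | no _ | yes refl = Chan-digit c (inj₁ (proj₂ (read-source e)))
    help xp c v≡ inp e = refl
    help xm c v≡ inp e = refl
    help yp c v≡ inp e = refl
    help ym c v≡ inp e = refl
    help zp c v≡ inp e = refl
    help zm c v≡ inp e = refl
    help xp c v≡ outp e = refl
    help xm c v≡ outp e = refl
    help yp c v≡ outp e = cong (obit ∘ proj₂) v≡
    help ym c v≡ outp e = refl
    help zp c v≡ outp e = refl
    help zm c v≡ outp e = refl

  gateTile-cong : ∀ b b' {p} → Chan (spec p) → value b p ≡ value b' p →
    (∀ d → isIn (spec p) d ≡ true → gateFace b p d ≡ gateFace b' p d) → gateTile b p ≡ gateTile b' p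
  gateTile-cong b b' {p} c v≡ in≡ = tileOf-cong face≡
    where
    face≡ : ∀ d → gateFace b p d ≡ gateFace b' p d
    face≡ d with isIn (spec p) d in i
    ... | true  = trans (sym (if-then i)) (trans (in≡ d i) (if-then i))
    ... | false = edge-cong b b' (p ⊕ d) (opp d) (subst (Chan ∘ spec) (sym (⊕-opp p d)) c)
          (subst (λ q → value b q ≡ value b' q) (sym (⊕-opp p d)) v≡)

  required⇒in : ∀ b p d → required b p d ≡ true → isIn (spec p) d ≡ true
  required⇒in b p d = help (spec p)
    where
    help : ∀ s → reqOf s b p d ≡ true → isIn s d ≡ true
    help none      h = h
    help root      h = h
    help inp       h = h
    help outp      h = h
    help (stone _) h = h
    help (wire _)  h = h
    help (gate m d₁ d₂) h with d ≟D d₁ | d ≟D d₂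
    ... | yes _ | _     = refl
    ... | no  _ | yes _ = refl

  module _ (b : Input) {g : Pos → Maybe Tile} {p : Pos} (g⊑ : g ⊑ final⁺ b)
    (¬seed : isSeed (spec p) ≡ false)
    (free : ∀ {d t'} → g (p ⊕ d) ≡ just t' → required b (p ⊕ d) (opp d) ≡ false) where

    private
      present : Dir → Set
      present d = ∃ λ t' → g (p ⊕ d) ≡ just t'

      pull : Tile → Dir → ℕ
      pull = bondAt codeStrength g p

      pos≢0 : ∀ {n} → 0 < n → n ≢ 0
      pos≢0 (s≤s _) ()

      zero? : ∀ n → n ≡ 0 ⊎ n ≢ 0
      zero? zero    = inj₁ refl
      zero? (suc n) = inj₂ λ ()

      only : ∀ {t} ds → (∀ d → pull t d ≢ 0 → d ∈ ds) → 2 ≤ bondSum codeStrength g p t → 2 ≤ sum (map (pull t) ds)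
      only {t} ds ∈ds big = ≤-trans big (sum-map-⊆ (pull t) allDirs-unique
        λ {d} _ → case zero? (pull t d) of λ { (inj₁ z) → inj₁ z ; (inj₂ nz) → inj₂ (∈ds d nz) })

      only₁ : ∀ {t} d → (∀ d' → pull t d' ≢ 0 → d' ≡ d) → 2 ≤ bondSum codeStrength g p t → 2 ≤ pull t d
      only₁ {t} d ≡d big = subst (2 ≤_) (+-identityʳ (pull t d)) (only (d ∷ []) (λ d' nz → here (≡d d' nz)) big)

      only₂ : ∀ {t} d e → (∀ d' → pull t d' ≢ 0 → d' ≡ d ⊎ d' ≡ e) → 2 ≤ bondSum codeStrength g p t → 2 ≤ pull t d + pull t e
      only₂ {t} d e ≡de big = subst (λ n → 2 ≤ pull t d + n) (+-identityʳ (pull t e))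
        (only (d ∷ e ∷ []) (λ d' nz → case ≡de d' nz of λ { (inj₁ h) → here h ; (inj₂ h) → there (here h) }) big)

      split : ∀ {m n} → m ≤ 1 → n ≤ 1 → 2 ≤ m + n → m ≢ 0 × n ≢ 0
      split {suc m} {suc n} _ _ _ = (λ ()) , λ ()
      split {zero}  {n} _ n≤ big = contradiction (≤-trans big n≤) λ { (s≤s ()) }
      split {suc m} {zero} m≤ _ big = contradiction (≤-trans (subst (2 ≤_) (+-identityʳ (suc m)) big) m≤) λ { (s≤s ()) }

    Determined : Tile → Set
    Determined t = final⁺ b p ≡ just t × (∀ d → required b p d ≡ true → present d)

    determined-digit : ∀ β → 2 ≤ bondSum codeStrength g p (digitTile β) → Determined (digitTile β)
    determined-digit β big = final-eq , ready
      where
      analyse : ∀ d → pull (digitTile β) d ≢ 0 →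
        present d × spec p ≡ outp × ((d ≡ yp × β ≡ proj₂ (value b (p ⊕ yp))) ⊎ d ≡ zm)
      analyse d nz with bond-match b {g} {p} {bitFace β} {bitLabel β} {d} g⊑ free nz
      ... | pr , ≢null , m = pr , digit-match d ¬seed m ≢null
      both≢0 : pull (digitTile β) yp ≢ 0 × pull (digitTile β) zm ≢ 0
      both≢0 = split (bondAt-≤ {g} {p} {bitFace β} yp) (bondAt-≤ {g} {p} {bitFace β} zm)
        (only₂ yp zm (λ d nz → case proj₂ (proj₂ (analyse d nz)) of λ { (inj₁ (h , _)) → inj₁ h ; (inj₂ h) → inj₂ h }) big)
      spec≡ : spec p ≡ outp
      spec≡ = proj₁ (proj₂ (analyse yp (proj₁ both≢0)))
      β≡ : β ≡ digit b p
      β≡ with proj₂ (proj₂ (analyse yp (proj₁ both≢0)))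
      ... | inj₁ (_ , h) = trans h (sym (digit-outp b spec≡))
      final-eq : final⁺ b p ≡ just (digitTile β)
      final-eq = trans (final-digit b (inj₂ spec≡)) (cong (just ∘ digitTile) (sym β≡))
      ready : ∀ d → required b p d ≡ true → present d
      ready d r = help d (subst (λ s → reqOf s b p d ≡ true) spec≡ r)
        where
        help : ∀ d → isIn outp d ≡ true → present d
        help yp _ = proj₁ (analyse yp (proj₁ both≢0))
        help zm _ = proj₁ (analyse zm (proj₂ both≢0))

    private
      analyse : ∀ {b' p'} → Chan (spec p') → ∀ d → pull (gateTile b' p') d ≢ 0 →
        present d × GateMatch b p d (gateFace b' p') p'
      analyse {b'} {p'} c d nz with bond-match b {g} {p} {gateFace b' p'} {other 0} {d} g⊑ free nz
      ... | pr , ≢null , m = pr , gate-match d ¬seed c m ≢null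

      foreign : ∀ {b' p'} → Chan (spec p') → p' ≢ p → 2 ≤ bondSum codeStrength g p (gateTile b' p') → ⊥
      foreign {b'} {p'} c p'≢p big = help (spec p') refl
        where
        solo : ∀ d → (∀ d' → pull (gateTile b' p') d' ≢ 0 → d' ≡ d × strength (gateFace b' p' d) ≤ 1) → ⊥
        solo d h with zero? (pull (gateTile b' p') d) | only₁ d (λ d' nz → proj₁ (h d' nz)) big
        ... | inj₁ z  | big' = contradiction (subst (2 ≤_) z big') λ ()
        ... | inj₂ nz | big' = contradiction
          (≤-trans big' (≤-trans (bondAt-≤ {g} {p} {gateFace b' p'} d) (proj₂ (h d nz)))) λ { (s≤s ()) }
        light : ∀ {G G'} → G ≡ G' → strength G' ≤ 1 → strength G ≤ 1
        light refl h = h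
        by : ∀ {d s} → spec p' ≡ s → (∀ d' → GateMatch b p d' (gateFace b' p') p' → s ≡ spec p' →
          d' ≡ d × strength (gateFace b' p' d') ≤ 1) → ⊥
        by {d} e h = solo d λ d' nz → case h d' (proj₂ (analyse c d' nz)) (sym e) of λ { (refl , st) → refl , st }
        help : ∀ s → spec p' ≡ s → ⊥
        help (gate read x y) e = by {yp} e λ
          { d' (own p≡ _ _) _ → contradiction p≡ p'≢p
          ; d' (read refl _ f≡) _ → refl , light f≡ ≤-refl
          ; d' (write _ s _ _) s' → contradiction (trans s' s) λ ()
          ; d' (wall _ st _) s' → contradiction (subst Stone (sym s') st) λ () }
        help (gate both x y) e = by {ym} e λ
          { d' (own p≡ _ _) _ → contradiction p≡ p'≢p
          ; d' (read _ s _) s' → contradiction (trans s' s) λ ()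
          ; d' (write refl _ _ f≡) _ → refl , light f≡ ≤-refl
          ; d' (wall _ st _) s' → contradiction (subst Stone (sym s') st) λ () }
        help (gate sel x y) e = by {zm} e λ
          { d' (own p≡ _ _) _ → contradiction p≡ p'≢p
          ; d' (read _ s _) s' → contradiction (trans s' s) λ ()
          ; d' (write _ s _ _) s' → contradiction (trans s' s) λ ()
          ; d' (wall _ st _) s' → contradiction (subst Stone (sym s') st) λ () }
        help (wire x) e = by {zm} e λ
          { d' (own p≡ _ _) _ → contradiction p≡ p'≢p
          ; d' (read _ s _) s' → contradiction (trans s' s) λ ()
          ; d' (write _ s _ _) s' → contradiction (trans s' s) λ ()
          ; d' (wall refl _ f≡) _ → refl , light f≡ ≤-refl }
        help (stone x) e = by {zm} e λ
          { d' (own p≡ _ _) _ → contradiction p≡ p'≢p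
          ; d' (read _ s _) s' → contradiction (trans s' s) λ ()
          ; d' (write _ s _ _) s' → contradiction (trans s' s) λ ()
          ; d' (wall refl _ f≡) _ → refl , light f≡ ≤-refl }
        help root e = by {zm} e λ
          { d' (own p≡ _ _) _ → contradiction p≡ p'≢p
          ; d' (read _ s _) s' → contradiction (trans s' s) λ ()
          ; d' (write _ s _ _) s' → contradiction (trans s' s) λ ()
          ; d' (wall refl _ f≡) _ → refl , light f≡ ≤-refl }
        help none e = Chan-digit c (case subst Chan e c of λ { (stone ()) })
        help inp  e = Chan-digit c (inj₁ e)
        help outp e = Chan-digit c (inj₂ e)

      own-match : ∀ {b'} → Chan (spec p) → ∀ d → pull (gateTile b' p) d ≢ 0 →
        present d × isIn (spec p) d ≡ true × gateFace b' p d ≡ edge b p d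
      own-match {b'} c d nz with analyse {b'} {p} c d nz
      ... | pr , own _ i e = pr , i , e
      ... | pr , read refl s e = pr , isIn₂ {b} s , trans e (sym (edge₂-read s))
      ... | (_ , pr) , write refl _ s _ = contradiction
              (trans (sym (free pr)) (cong (λ r → reqOf r b (p ⊕ ym) yp) s)) λ ()
      ... | pr , wall _ st _ = seed-absurd ¬seed st

    private
      native : ∀ {b'} → Chan (spec p) → 2 ≤ bondSum codeStrength g p (gateTile b' p) → Determined (gateTile b' p)
      native {b'} c big = help (spec p) refl
        where
        t = gateTile b' p

        facing-in : ∀ d → isIn (spec p) d ≡ true → required b' p d ≡ true → pull t d ≢ 0 → edge b' p d ≡ edge b p d
        facing-in d i r nz = trans (sym (gateFace-in b' p d i r)) (proj₂ (proj₂ (own-match c d nz)))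

        equal : value b' p ≡ value b p → (∀ d → isIn (spec p) d ≡ true → gateFace b' p d ≡ gateFace b p d) →
          final⁺ b p ≡ just t
        equal v≡ in≡ = trans (final-Chan b c) (cong just (sym (gateTile-cong b' b c v≡ in≡)))

        help : ∀ s → spec p ≡ s → Determined t
        help none e = Chan-digit c (case subst Chan e c of λ { (stone ()) })
        help inp  e = Chan-digit c (inj₁ e)
        help outp e = Chan-digit c (inj₂ e)
        help root e = seed-absurd ¬seed (subst Stone (sym e) root)
        help (stone _) e = seed-absurd ¬seed (subst Stone (sym e) stone)
        help (wire d) e = equal v≡ in≡ , ready
          where
          nz : pull t d ≢ 0
          nz = pos≢0 (≤-trans (s≤s z≤n) (only₁ d (λ d' n → isIn-wire e (proj₁ (proj₂ (own-match c d' n)))) big))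
          i : isIn (spec p) d ≡ true
          i = trans (cong (λ s → isIn s d) e) (==D-refl d)
          r : ∀ b → required b p d ≡ true
          r b = trans (cong (λ s → reqOf s b p d) e) (==D-refl d)
          edge≡ : edge b' p d ≡ edge b p d
          edge≡ = facing-in d i (r b') nz
          v≡ : value b' p ≡ value b p
          v≡ = val-wire b' b e (chan-value (trans (sym (edge-wire e)) (trans edge≡ (edge-wire e))))
          in≡ : ∀ d' → isIn (spec p) d' ≡ true → gateFace b' p d' ≡ gateFace b p d'
          in≡ d' i' with isIn-wire e i'
          ... | refl = trans (gateFace-in b' p d i (r b')) (trans edge≡ (sym (gateFace-in b p d i (r b))))
          ready : ∀ d' → required b p d' ≡ true → present d'
          ready d' r' with isIn-wire e (required⇒in b p d' r')
          ... | refl = proj₁ (own-match c d nz)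
        help (gate m d f) e = by (needs m (value b' (p ⊕ d))) refl
          where
          pulls : 2 ≤ pull t d + pull t f
          pulls = only₂ d f (λ d' n → isIn-gate e (proj₁ (proj₂ (own-match c d' n)))) big
          edge≡₁ : pull t d ≢ 0 → edge b' p d ≡ edge b p d
          edge≡₁ = facing-in d (isIn₁ {b} e) (req₁ {b'} e)
          v≡₁ : pull t d ≢ 0 → value b' (p ⊕ d) ≡ value b (p ⊕ d)
          v≡₁ nz = chan-value (trans (sym (edge₁ {b'} e)) (trans (edge≡₁ nz) (edge₁ {b} e)))
          face≡₁ : pull t d ≢ 0 → gateFace b' p d ≡ gateFace b p d
          face≡₁ nz = trans (gateFace-in b' p d (isIn₁ {b} e) (req₁ {b'} e))
            (trans (edge≡₁ nz) (sym (gateFace-in b p d (isIn₁ {b} e) (req₁ {b} e))))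
          strength₁ : strength (gateFace b' p d) ≡ strength (chan (not (needs m (value b' (p ⊕ d)))) p d (value b' (p ⊕ d)))
          strength₁ = cong strength (trans (gateFace-in b' p d (isIn₁ {b} e) (req₁ {b'} e)) (edge₁ {b'} e))
          in≡ : gateFace b' p d ≡ gateFace b p d → gateFace b' p f ≡ gateFace b p f →
            ∀ d' → isIn (spec p) d' ≡ true → gateFace b' p d' ≡ gateFace b p d'
          in≡ e₁ e₂ d' i with isIn-gate e i
          ... | inj₁ refl = e₁
          ... | inj₂ refl = e₂
          by : ∀ n → needs m (value b' (p ⊕ d)) ≡ n → Determined t
          by false n = equal (v≡ m refl) (in≡ (face≡₁ nz) face≡₂) , ready
            where
            idle : ∀ b → needs m (value b (p ⊕ d)) ≡ false → gateFace b p f ≡ null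
            idle b n = gateFace-idle b p f (isIn₂ {b} e) (trans (req₂ {b} e) n)
            pull₂ : pull t f ≡ 0
            pull₂ = n≤0⇒n≡0 (≤-trans (bondAt-≤ {g} {p} {gateFace b' p} f) (≤-reflexive (cong strength (idle b' n))))
            nz : pull t d ≢ 0
            nz = pos≢0 (≤-trans (s≤s z≤n) (subst (2 ≤_) (+-identityʳ (pull t d)) (subst (λ k → 2 ≤ pull t d + k) pull₂ pulls)))
            n' : needs m (value b (p ⊕ d)) ≡ false
            n' = trans (cong (needs m) (sym (v≡₁ nz))) n
            face≡₂ : gateFace b' p f ≡ gateFace b p f
            face≡₂ = trans (idle b' n) (sym (idle b n'))
            v≡ : ∀ m' → m ≡ m' → value b' p ≡ value b p
            v≡ sel refl = val-sel b' b e (v≡₁ nz) λ h → contradiction (trans (sym h) n) λ ()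
            v≡ both refl = contradiction n λ ()
            v≡ read refl = contradiction n λ ()
            ready : ∀ d' → required b p d' ≡ true → present d'
            ready d' r with isIn-gate e (required⇒in b p d' r)
            ... | inj₁ refl = proj₁ (own-match c d nz)
            ... | inj₂ refl = contradiction (trans (sym r) (trans (req₂ {b} e) n')) λ ()
          by true n = equal (v≡ m refl) (in≡ (face≡₁ (proj₁ nz)) face≡₂) , ready
            where
            r' : required b' p f ≡ true
            r' = trans (req₂ {b'} e) n
            nz : pull t d ≢ 0 × pull t f ≢ 0
            nz = split
              (≤-trans (bondAt-≤ {g} {p} {gateFace b' p} d)
                (≤-reflexive (trans strength₁ (cong (λ k → strength (chan (not k) p d (value b' (p ⊕ d)))) n))))
              (≤-trans (bondAt-≤ {g} {p} {gateFace b' p} f)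
                (≤-reflexive (trans (cong strength (gateFace-in b' p f (isIn₂ {b} e) r')) (edge₂-strength e))))
              pulls
            edge≡₂ : edge b' p f ≡ edge b p f
            edge≡₂ = facing-in f (isIn₂ {b} e) r' (proj₂ nz)
            r″ : required b p f ≡ true
            r″ = trans (req₂ {b} e) (trans (cong (needs m) (sym (v≡₁ (proj₁ nz)))) n)
            face≡₂ : gateFace b' p f ≡ gateFace b p f
            face≡₂ = trans (gateFace-in b' p f (isIn₂ {b} e) r') (trans edge≡₂ (sym (gateFace-in b p f (isIn₂ {b} e) r″)))
            v≡ : ∀ m' → m ≡ m' → value b' p ≡ value b p
            v≡ sel refl = val-sel b' b e (v≡₁ (proj₁ nz))
              λ _ → chan-value (trans (sym (edge₂-sel e)) (trans edge≡₂ (edge₂-sel e)))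
            v≡ both refl = val-both b' b e (v≡₁ (proj₁ nz))
              (chan-value (trans (sym (edge₂-both e)) (trans edge≡₂ (edge₂-both e))))
            v≡ read refl = val-read b' b e (v≡₁ (proj₁ nz))
              (bit-value (trans (sym (edge₂-read e)) (trans edge≡₂ (edge₂-read e))))
            ready : ∀ d' → required b p d' ≡ true → present d'
            ready d' r with isIn-gate e (required⇒in b p d' r)
            ... | inj₁ refl = proj₁ (own-match c d (proj₁ nz))
            ... | inj₂ refl = proj₁ (own-match c f (proj₂ nz))

    determined-gate : ∀ {b' p'} → Chan (spec p') → 2 ≤ bondSum codeStrength g p (gateTile b' p') →
      Determined (gateTile b' p')
    determined-gate {b'} {p'} c big with p' ≟P p
    ... | yes refl = native c big
    ... | no  p'≢p = ⊥-elim (foreign c p'≢p big)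

    determined-tile : ∀ {t} → t ∈ circuitTiles → 2 ≤ bondSum codeStrength g p t → Determined t
    determined-tile t∈ big with circuitTiles⁻ t∈
    ... | inj₁ (β , refl)          = determined-digit β big
    ... | inj₂ (b' , p' , c , refl) = determined-gate c big

  private
    source-Chan : ∀ {s d s'} → SourceOK s d s' → Chan s' ⊎ (∃ λ e → s ≡ gate read e yp × d ≡ yp × s' ≡ inp)
    source-Chan (stone st)   = inj₁ (stone st)
    source-Chan (wire c)     = inj₁ c
    source-Chan (first c)    = inj₁ c
    source-Chan (sel₂ c)     = inj₁ c
    source-Chan (both₂ c)    = inj₁ c
    source-Chan (read₂ {e})  = inj₂ (e , refl , refl , refl)
    source-Chan (inp-zm st)  = inj₁ (stone st)
    source-Chan (inp-zp st)  = inj₁ (stone st)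
    source-Chan outp-yp      = inj₁ gate
    source-Chan (outp-zm st) = inj₁ (stone st)

  source-final : ∀ b p d → isIn (spec p) d ≡ true → ∃ λ l → final⁺ b (p ⊕ d) ≡ just (tileOf (face b (p ⊕ d)) l)
  source-final b p d i with source-Chan (proj₁ (source p d i))
  ... | inj₁ c = other 0 , trans (final-Chan b c) (cong (λ f → just (tileOf f (other 0))) (sym (face-Chan b c)))
  ... | inj₂ (_ , _ , _ , e) = bitLabel (digit b (p ⊕ d)) , trans (final-digit b (inj₁ e))
          (cong (λ f → just (tileOf f (bitLabel (digit b (p ⊕ d))))) (sym (face-digit b (inj₁ e))))

  face-source : ∀ b p d → isIn (spec p) d ≡ true → face b (p ⊕ d) (opp d) ≡ edge b p d
  face-source b p d i with source p d i
  ... | ok , lt with source-Chan ok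
  ...   | inj₂ (_ , e , refl , e') = trans (cong (λ f → f ym) (face-digit b (inj₁ e'))) (sym (edge₂-read e))
  ...   | inj₁ c = trans (cong (λ f → f (opp d)) (face-Chan b c)) (trans (gateFace-out b (p ⊕ d) (opp d) not-in) (edge-back b p d))
    where
    not-in : isIn (spec (p ⊕ d)) (opp d) ≡ false
    not-in with isIn (spec (p ⊕ d)) (opp d) in i'
    ... | false = refl
    ... | true  = contradiction (<-trans (subst (λ q → rank q < rank (p ⊕ d)) (⊕-opp p d) (proj₂ (source (p ⊕ d) (opp d) i'))) lt) (<-irrefl refl)

  face-required : ∀ b p d → required b p d ≡ true → face b p d ≡ edge b p d
  face-required b p d r = help (spec p) refl
    where
    gate-like : Chan (spec p) → face b p d ≡ edge b p d
    gate-like c = trans (cong (λ f → f d) (face-Chan b c)) (gateFace-in b p d (required⇒in b p d r) r)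
    digit-like : ∀ d s → spec p ≡ s → s ≡ inp ⊎ s ≡ outp → isIn s d ≡ true → bitFace (digit b p) d ≡ edgeOf s b p d
    digit-like zm .inp  e (inj₁ refl) i = refl
    digit-like zp .inp  e (inj₁ refl) i = refl
    digit-like yp .outp e (inj₂ refl) i = cong obit (digit-outp b e)
    digit-like zm .outp e (inj₂ refl) i = refl
    help : ∀ s → spec p ≡ s → face b p d ≡ edge b p d
    help none e = contradiction (trans (sym r) (cong (λ s → reqOf s b p d) e)) λ ()
    help root e = gate-like (subst Chan (sym e) (stone root))
    help (stone _) e = gate-like (subst Chan (sym e) (stone stone))
    help (wire _) e = gate-like (subst Chan (sym e) wire)
    help (gate _ _ _) e = gate-like (subst Chan (sym e) gate)
    help inp e = trans (cong (λ f → f d) (face-digit b (inj₁ e)))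
      (trans (digit-like d inp e (inj₁ refl) (subst (λ s → isIn s d ≡ true) e (required⇒in b p d r))) (cong (λ s → edgeOf s b p d) (sym e)))
    help outp e = trans (cong (λ f → f d) (face-digit b (inj₂ e)))
      (trans (digit-like d outp e (inj₂ refl) (subst (λ s → isIn s d ≡ true) e (required⇒in b p d r))) (cong (λ s → edgeOf s b p d) (sym e)))

  bond-required : ∀ b {p t} d → final⁺ b p ≡ just t → required b p d ≡ true →
    bondAt codeStrength (final⁺ b) p t d ≡ strength (edge b p d)
  bond-required b {p} {t} d Fp r with final-tile b Fp | source-final b p d (required⇒in b p d r)
  ... | _ , l , refl | l' , e = trans (bondAt-just codeStrength (final⁺ b) p t d e)
    (trans (bond-≡ {face b p} {l} {face b (p ⊕ d)} {l'} d
              (trans (face-required b p d r) (sym (face-source b p d (required⇒in b p d r)))))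
           (cong strength (face-required b p d r)))

  bonds≥2 : ∀ b {p t} → final⁺ b p ≡ just t → p ≢ base →
    2 ≤ sum (map (λ d → if required b p d then bondAt codeStrength (final⁺ b) p t d else 0) allDirs)
  bonds≥2 b {p} {t} Fp p≢ = help (spec p) refl
    where
    f : Dir → ℕ
    f d = if required b p d then bondAt codeStrength (final⁺ b) p t d else 0
    f≡ : ∀ d → required b p d ≡ true → f d ≡ strength (edge b p d)
    f≡ d r = trans (if-then r) (bond-required b d Fp r)
    one-edge : ∀ d → required b p d ≡ true → strength (edge b p d) ≡ 2 → 2 ≤ sum (map f allDirs)
    one-edge d r s = ≤-trans (≤-reflexive (sym (trans (f≡ d r) s))) (∈⇒≤sum f (∈allDirs d))
    two-edges : ∀ d e → d ≢ e → required b p d ≡ true → required b p e ≡ true →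
      strength (edge b p d) ≡ 1 → strength (edge b p e) ≡ 1 → 2 ≤ sum (map f allDirs)
    two-edges d e d≢e r r' s s' = ≤-trans (≤-reflexive (sym (cong₂ _+_ (trans (f≡ d r) s) (cong (_+ 0) (trans (f≡ e r') s')))))
      (sum-map-⊆ f {d ∷ e ∷ []} {allDirs} ((d≢e ∷ []) ∷ [] ∷ []) λ {x} _ → inj₂ (∈allDirs x))
    spec-req : ∀ {s} → spec p ≡ s → ∀ d → reqOf s b p d ≡ true → required b p d ≡ true
    spec-req e d = trans (cong (λ s → reqOf s b p d) e)
    spec-edge : ∀ {s n} → spec p ≡ s → ∀ d → strength (edgeOf s b p d) ≡ n → strength (edge b p d) ≡ n
    spec-edge e d = trans (cong (λ s → strength (edgeOf s b p d)) e)
    help : ∀ s → spec p ≡ s → 2 ≤ sum (map f allDirs)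
    help none e = contradiction (final-none b e) (just≢nothing Fp)
    help root e = contradiction (root-base e) p≢
    help (stone d) e = one-edge d (spec-req e d (==D-refl d)) (cong strength (edge-stone {b} e))
    help (wire d) e = one-edge d (spec-req e d (==D-refl d)) (cong strength (edge-wire {b} e))
    help inp  e = two-edges zm zp (λ ()) (spec-req e zm refl) (spec-req e zp refl) (spec-edge e zm refl) (spec-edge e zp refl)
    help outp e = two-edges yp zm (λ ()) (spec-req e yp refl) (spec-req e zm refl) (spec-edge e yp refl) (spec-edge e zm refl)
    help (gate m d d') e with needs m (value b (p ⊕ d)) in n
    ... | false = one-edge d (req₁ {b} e) (cong strength (trans (edge₁ {b} e) (cong (λ k → chan (not k) p d (value b (p ⊕ d))) n)))
    ... | true  = two-edges d d' (gate-≢ e) (req₁ {b} e) (trans (req₂ {b} e) n)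
      (cong strength (trans (edge₁ {b} e) (cong (λ k → chan (not k) p d (value b (p ⊕ d))) n))) (edge₂-strength {b} e)

  seed-source : ∀ {p d} → isSeed (spec p) ≡ true → isIn (spec p) d ≡ true → isSeed (spec (p ⊕ d)) ≡ true
  seed-source {p} {d} s i = help (spec p) s (proj₁ (source p d i))
    where
    help : ∀ s {d s'} → isSeed s ≡ true → SourceOK s d s' → isSeed s' ≡ true
    help (stone _) _ (stone st) = Stone-seed st
    help inp _ (inp-zm st) = Stone-seed st
    help inp _ (inp-zp st) = Stone-seed st

  seed-final : ∀ b {p} → isSeed (spec p) ≡ true → ∃ λ t → final⁺ b p ≡ just t
  seed-final b {p} s = help (spec p) s
    where
    help : ∀ s → isSeed s ≡ true → ∃ λ t → finalOf s b p ≡ just t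
    help root      _ = _ , refl
    help (stone _) _ = _ , refl
    help inp       _ = _ , refl

  record Timing (b : Input) : Set where
    field
      delay   : Pos → ℕ
      delay-< : ∀ p d → isSeed (spec p) ≡ false → required b p d ≡ true →
                isSeed (spec (p ⊕ d)) ≡ true ⊎ delay (p ⊕ d) < delay p

  growth : ∀ b → Timing b → Growth system
  growth b timing = record
    { F          = final⁺ b
    ; support    = support
    ; F-supp     = λ p t h → covers p (proj₁ (final-tile b h))
    ; F-tiles    = final-∈ b
    ; seed       = λ p → isSeed (spec p)
    ; root       = base
    ; root-seed  = cong isSeed base-root
    ; seed-F     = seed-final b
    ; req        = required b
    ; rank       = rank
    ; req-F      = λ {p} {t} {d} _ r → (_ , proj₂ (source-final b p d (required⇒in b p d r))) ,
                                       proj₂ (source p d (required⇒in b p d r))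
    ; req-τ      = bonds≥2 b
    ; seed-req   = λ {p} {d} s r → seed-source s (required⇒in b p d r)
    ; determined = λ g⊑ _ ¬seed free t∈ big → determined-tile b g⊑ ¬seed free t∈ big
    ; time       = delay
    ; time-req   = λ {p} {t} {d} _ ¬seed r → delay-< p d ¬seed r
    }
    where open Timing timing

module CircuitComputer (𝒞 : Circuit) {nin nout : ℕ} (Ins : Vec Pos nin) (Outs : Vec Pos nout)
  (ins-inp : ∀ i → Circuit.spec 𝒞 (V.lookup Ins i) ≡ inp)
  (inp-ins : ∀ p → Circuit.spec 𝒞 p ≡ inp → ∃ λ i → p ≡ V.lookup Ins i)
  (outs-outp : ∀ i → Circuit.spec 𝒞 (V.lookup Outs i) ≡ outp)
  (input₀ : Circuit.Input 𝒞) where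

  open Circuit 𝒞
  open CircuitGrowth 𝒞
  open Determinism 𝒞
  open CircuitTiles 𝒞

  stone-tile : ∀ b b' {p} → Stone (spec p) → gateTile b p ≡ gateTile b' p
  stone-tile b b' {p} st = gateTile-cong b b' (stone st) (val-stone b b' p st) faces
    where
    Stone-source : ∀ {s d s'} → Stone s → SourceOK s d s' → Stone s'
    Stone-source stone (stone st) = st
    req≡ : ∀ {s} d → Stone s → reqOf s b p d ≡ reqOf s b' p d
    req≡ d root  = refl
    req≡ d stone = refl
    faces : ∀ d → isIn (spec p) d ≡ true → gateFace b p d ≡ gateFace b' p d
    faces d i with Stone-source st (proj₁ (source p d i))
    ... | st' rewrite i | req≡ d st | edge-cong b b' p d (stone st') (val-stone b b' (p ⊕ d) st') = refl

  private
    scaffoldOf : Spec → Pos → Maybe Tile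
    scaffoldOf root      p = just (gateTile input₀ p)
    scaffoldOf (stone _) p = just (gateTile input₀ p)
    scaffoldOf _         p = nothing

    seedOf : Spec → Input → Pos → Maybe Tile
    seedOf s b p = if isSeed s then final⁺ b p else nothing

  scaffold : Assembly
  scaffold = fromPartial (λ p → scaffoldOf (spec p) p) support
    λ p t e → covers p λ n → just≢nothing e (cong (λ s → scaffoldOf s p) n)

  seed : Input → Assembly
  seed b = fromPartial (λ p → seedOf (spec p) b p) support
    λ p t e → covers p λ n → just≢nothing e (cong (λ s → seedOf s b p) n)

  private
    scaffold-inv : ∀ {p t} → at scaffold p ≡ just t → Stone (spec p) × t ≡ gateTile input₀ p
    scaffold-inv {p} {t} = help (spec p)
      where
      help : ∀ s → scaffoldOf s p ≡ just t → Stone s × t ≡ gateTile input₀ p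
      help root      refl = root , refl
      help (stone _) refl = stone , refl

    gate≢digit : ∀ {b p β} → gateTile b p ≢ digitTile β
    gate≢digit {β = false} e with cong label e
    ... | ()
    gate≢digit {β = true}  e with cong label e
    ... | ()

    label₀ : ∀ t → t ∈ circuitTiles → label t ≡ lab0 → t ≡ digitTile false
    label₀ t t∈ l with circuitTiles⁻ t∈
    ... | inj₁ (false , e) = e
    label₀ t t∈ () | inj₁ (true , refl)
    label₀ t t∈ () | inj₂ (_ , _ , _ , refl)

    label₁ : ∀ t → t ∈ circuitTiles → label t ≡ lab1 → t ≡ digitTile true
    label₁ t t∈ l with circuitTiles⁻ t∈
    ... | inj₁ (true , e) = e
    label₁ t t∈ () | inj₁ (false , refl)
    label₁ t t∈ () | inj₂ (_ , _ , _ , refl)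

  computer : TAC nin nout
  computer = record
    { sys = system
    ; t0 = digitTile false ; t1 = digitTile true
    ; t0∈ = digitTile∈ false ; t0-label = refl ; t0-unique = label₀
    ; t1∈ = digitTile∈ true  ; t1-label = refl ; t1-unique = label₁
    ; R = scaffold
    ; R-tiles = λ p t e → case scaffold-inv {p} e of λ
        { (st , refl) → final-∈ input₀ p t (final-Chan input₀ (stone st)) , gate≢digit , gate≢digit }
    ; B = Ins
    ; B-free = λ i → cong (λ s → scaffoldOf s (V.lookup Ins i)) (ins-inp i)
    ; C = Outs
    }

  bitTile-computer : ∀ β → digitTile β ≡ bitTile computer β
  bitTile-computer false = refl
  bitTile-computer true  = refl

  seed-isInput : ∀ b (v : Vec Bool nin) → (∀ i → digit b (V.lookup Ins i) ≡ V.lookup v i) →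
    IsInput computer v (seed b)
  seed-isInput b v digits = places , rest
    where
    places : ∀ i → at (seed b) (V.lookup Ins i) ≡ just (bitTile computer (V.lookup v i))
    places i = trans (cong (λ s → seedOf s b (V.lookup Ins i)) (ins-inp i)) (trans (final-digit b (inj₁ (ins-inp i)))
      (cong just (trans (cong digitTile (digits i)) (bitTile-computer (V.lookup v i)))))
    rest : ∀ p → (∀ i → ¬ p ≡ V.lookup Ins i) → at (seed b) p ≡ at scaffold p
    rest p ¬in = help (spec p) refl
      where
      stones : Stone (spec p) → final⁺ b p ≡ just (gateTile input₀ p)
      stones st = trans (final-Chan b (stone st)) (cong just (stone-tile b input₀ st))
      help : ∀ s → spec p ≡ s → seedOf s b p ≡ scaffoldOf s p
      help none         e = refl
      help outp         e = refl
      help (wire _)     e = refl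
      help (gate _ _ _) e = refl
      help inp          e = contradiction (proj₂ (inp-ins p e)) (¬in _)
      help root         e = stones (subst Stone (sym e) root)
      help (stone _)    e = stones (subst Stone (sym e) stone)

  module _ (b : Input) (timing : Timing b) where
    open GrowthProperties system (growth b timing)

    seed-valid : Valid (seed b)
    seed-valid = record
      { below  = λ {p} h → trans (sym (if-then (inv p h))) h
      ; seeded = λ p s → if-then s
      ; closed = λ {p} {t} {d} h r →
          let s = seed-source {p} {d} (inv p h) (required⇒in b p d r) in
          _ , trans (if-then s) (proj₂ (seed-final b s))
      }
      where
      inv : ∀ p {t} → at (seed b) p ≡ just t → isSeed (spec p) ≡ true
      inv p h with isSeed (spec p)
      ... | true = refl

    computes : ∃ λ A → UniquelyAssembles system (seed b) A ×
      ∀ i → at A (V.lookup Outs i) ≡ just (digitTile (digit b (V.lookup Outs i)))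
    computes with assembles seed-valid
    ... | A , unique , _ , full = A , unique , λ i → full _ _ (final-digit b (inj₂ (outs-outp i)))

    run-time : ∀ T → (∀ p → spec p ≢ none → Timing.delay timing p < T) →
      ∃ λ r → ParRun system (seed b) r × r ≤ suc T
    run-time T bound = runs seed-valid λ p t h → bound p (proj₁ (final-tile b h))

dbl : ℕ → ℕ
dbl zero    = zero
dbl (suc n) = suc (suc (dbl n))

bcons : Bool → ℕ → ℕ
bcons false n = dbl n
bcons true  n = suc (dbl n)

dbl-injective : ∀ {m n} → dbl m ≡ dbl n → m ≡ n
dbl-injective {zero}  {zero}  _ = refl
dbl-injective {suc m} {suc n} e = cong suc (dbl-injective (suc-injective (suc-injective e)))

dbl-odd : ∀ m n → dbl m ≢ suc (dbl n)
dbl-odd (suc m) (suc n) e = dbl-odd m n (suc-injective (suc-injective e))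
dbl-odd zero    n       ()
dbl-odd (suc m) zero    e = contradiction (suc-injective e) λ ()

bcons-injective : ∀ {b b' m n} → bcons b m ≡ bcons b' n → b ≡ b' × m ≡ n
bcons-injective {false} {false}         e = refl , dbl-injective e
bcons-injective {true}  {true}          e = refl , dbl-injective (suc-injective e)
bcons-injective {false} {true}  {m} {n} e = contradiction e (dbl-odd m n)
bcons-injective {true}  {false} {m} {n} e = contradiction (sym e) (dbl-odd n m)

dbl-mono : ∀ {m n} → m ≤ n → dbl m ≤ dbl n
dbl-mono z≤n     = z≤n
dbl-mono (s≤s h) = s≤s (s≤s (dbl-mono h))

bcons-< : ∀ b {m n} → m < n → bcons b m < dbl n
bcons-< false h = ≤-trans (n≤1+n _) (dbl-mono h)
bcons-< true  h = dbl-mono h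

quint : ℕ → ℕ
quint zero    = zero
quint (suc n) = 5 + quint n

data Side : Set where
  right left : Side

data Four : Set where
  q0 q1 q2 q3 : Four

data Lane : Set where
  l0 l1 l2 l3 l4 : Lane

-- Columns of the layout.  Group k of a side consists of two rows of cells, leading away from the
-- spine (false) and back (true); bit i of a row takes two cells.
data Col : Set where
  cell : Side → ℕ → Bool → ℕ → Bool → Col
  turn : Side → ℕ → Four → Col
  rib  : Side → ℕ → Four → Col
  fin  : Col
  shaft : Col
  wall : Side → ℕ → ℕ → Col

data Node : Set where
  floor : Side → ℕ → ℕ → Node
  node  : Col → ℕ → Lane → Node

offset : Four → ℕ → ℕ
offset q0 n = n
offset q1 n = suc n
offset q2 n = suc (suc n)
offset q3 n = suc (suc (suc n))

offset-injective : ∀ q q' {m n} → offset q (dbl (dbl m)) ≡ offset q' (dbl (dbl n)) → q ≡ q' × m ≡ n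
offset-injective q q' {m} {n} e =
  q≡ q q' (proj₁ l) (proj₁ h) , proj₂ h
  where
  lo hi : Four → Bool
  lo q0 = false
  lo q1 = true
  lo q2 = false
  lo q3 = true
  hi q0 = false
  hi q1 = false
  hi q2 = true
  hi q3 = true
  split : ∀ q n → offset q (dbl (dbl n)) ≡ bcons (lo q) (bcons (hi q) n)
  split q0 n = refl
  split q1 n = refl
  split q2 n = refl
  split q3 n = refl
  l = bcons-injective {lo q} {lo q'} (trans (sym (split q m)) (trans e (split q' n)))
  h = bcons-injective {hi q} {hi q'} (proj₂ l)
  q≡ : ∀ q q' → lo q ≡ lo q' → hi q ≡ hi q' → q ≡ q'
  q≡ q0 q0 _ _ = refl
  q≡ q1 q1 _ _ = refl
  q≡ q2 q2 _ _ = refl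
  q≡ q3 q3 _ _ = refl
  q≡ q0 q1 () _
  q≡ q0 q2 _ ()
  q≡ q0 q3 () _
  q≡ q1 q0 () _
  q≡ q1 q2 () _
  q≡ q1 q3 _ ()
  q≡ q2 q0 _ ()
  q≡ q2 q1 () _
  q≡ q2 q3 () _
  q≡ q3 q0 () _
  q≡ q3 q1 _ ()
  q≡ q3 q2 () _

lane : Lane → ℕ
lane l0 = 0
lane l1 = 1
lane l2 = 2
lane l3 = 3
lane l4 = 4

private
  unlane : ℕ → Lane
  unlane 0 = l0
  unlane 1 = l1
  unlane 2 = l2
  unlane 3 = l3
  unlane _ = l4

  unlane-lane : ∀ l → unlane (lane l) ≡ l
  unlane-lane l0 = refl
  unlane-lane l1 = refl
  unlane-lane l2 = refl
  unlane-lane l3 = refl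
  unlane-lane l4 = refl

lane<5 : ∀ l → lane l < 5
lane<5 l0 = s≤s z≤n
lane<5 l1 = s≤s (s≤s z≤n)
lane<5 l2 = s≤s (s≤s (s≤s z≤n))
lane<5 l3 = s≤s (s≤s (s≤s (s≤s z≤n)))
lane<5 l4 = ≤-refl

quint-mono : ∀ {m n} → m ≤ n → quint m ≤ quint n
quint-mono z≤n     = z≤n
quint-mono (s≤s h) = +-monoʳ-≤ 5 (quint-mono h)

lane-block : ∀ {Y Y'} l l' → Y < Y' → lane l + quint Y < lane l' + quint Y'
lane-block {Y} l l' lt = <-≤-trans (+-monoˡ-< (quint Y) (lane<5 l)) (≤-trans (quint-mono lt) (m≤n+m _ (lane l')))

lane-injective : ∀ {Y Y'} l l' → lane l + quint Y ≡ lane l' + quint Y' → Y ≡ Y' × l ≡ l'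
lane-injective {Y} {Y'} l l' e with <-cmp Y Y'
... | tri< lt _ _ = contradiction e (<⇒≢ (lane-block l l' lt))
... | tri> _ _ gt = contradiction (sym e) (<⇒≢ (lane-block l' l gt))
... | tri≈ _ refl _ = refl , trans (sym (unlane-lane l)) (trans (cong unlane (+-cancelʳ-≡ (quint Y) _ _ e)) (unlane-lane l'))

-- Positions.  The left side is the right side turned by a half turn about the y axis.
module Layout (w' g' ℓ : ℕ) where

  w g : ℕ
  w = suc w'
  g = suc g'

  zmax : ℕ
  zmax = suc (dbl (dbl g))

  colSide : Col → Side
  colSide (cell s _ _ _ _) = s
  colSide (turn s _ _)     = s
  colSide (rib s _ _)      = s
  colSide fin              = left
  colSide shaft            = right
  colSide (wall s _ _)     = s

  xh : Col → ℕ
  xh (cell _ _ false i c) = suc (bcons c i)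
  xh (cell _ _ true  i c) = dbl w ∸ bcons c i
  xh (turn _ _ _)     = suc (dbl w)
  xh (rib _ _ _)      = 0
  xh fin              = 0
  xh shaft            = 0
  xh (wall _ x _)     = suc x

  zh : Col → ℕ
  zh (cell _ k r _ _) = suc (dbl (bcons r k))
  zh (turn _ k q)     = suc (offset q (dbl (dbl k)))
  zh (rib _ k q)      = suc (offset q (dbl (dbl k)))
  zh fin              = zmax
  zh shaft            = 0
  zh (wall _ _ m)     = dbl m

  xpos : Side → ℕ → ℤ
  xpos right x = +ℤ x
  xpos left  x = -[1+ x ]

  zpos : Side → ℕ → ℤ
  zpos right z = +ℤ z
  zpos left  z = zmax ℤ.⊖ z

  place : Side → ℕ → ℕ → ℕ → Pos
  place s x y z = xpos s x , +ℤ y , zpos s z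

  height : ℕ → Lane → ℕ
  height Y l = suc (lane l + quint Y)

  pos : Node → Pos
  pos (floor s x z)  = place s x 0 z
  pos (node c Y l)   = place (colSide c) (xh c) (height Y l) (zh c)

  inward outward backward forward : Side → Dir
  inward right   = xm
  inward left    = xp
  outward right  = xp
  outward left   = xm
  backward right = zm
  backward left  = zp
  forward right  = zp
  forward left   = zm

  place-inward : ∀ s x y z → place s x y z ≡ place s (suc x) y z ⊕ inward s
  place-inward right x y z = refl
  place-inward left  x y z = refl

  place-outward : ∀ s x y z → place s (suc x) y z ≡ place s x y z ⊕ outward s
  place-outward right x y z = cong (λ n → +ℤ n , +ℤ y , +ℤ z) (+-comm 1 x)
  place-outward left  x y z = cong (λ n → -[1+ n ] , +ℤ y , zpos left z) (cong suc (sym (+-identityʳ x)))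

  private
    ⊖-suc : ∀ m n → m ℤ.⊖ n ≡ (m ℤ.⊖ suc n) ℤ.+ one
    ⊖-suc m n = trans (trans (sym (ℤₚ.[1+m]⊖[1+n]≡m⊖n m n)) (cong (ℤ._⊖ suc n) (+-comm 1 m)))
      (sym (ℤₚ.distribˡ-⊖-+-pos 1 m (suc n)))

    ⊖-suc⁻ : ∀ m n → m ℤ.⊖ suc n ≡ (m ℤ.⊖ n) ℤ.+ mone
    ⊖-suc⁻ m n = trans (cong (λ k → m ℤ.⊖ suc k) (sym (+-identityʳ n))) (sym (trans (ℤₚ.distribˡ-⊖-+-neg 0 m n) refl))

    ⊖-injectiveʳ : ∀ m {n o} → m ℤ.⊖ n ≡ m ℤ.⊖ o → n ≡ o
    ⊖-injectiveʳ m {n} {o} e with <-cmp n o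
    ... | tri≈ _ n≡o _ = n≡o
    ... | tri< lt _ _  = contradiction (sym e) (ℤₚ.<⇒≢ (ℤₚ.⊖-monoʳ->-< m lt))
    ... | tri> _ _ gt  = contradiction e (ℤₚ.<⇒≢ (ℤₚ.⊖-monoʳ->-< m gt))

  place-backward : ∀ s x y z → place s x y z ≡ place s x y (suc z) ⊕ backward s
  place-backward right x y z = refl
  place-backward left  x y z = cong (λ v → -[1+ x ] , +ℤ y , v) (⊖-suc zmax z)

  place-forward : ∀ s x y z → place s x y (suc z) ≡ place s x y z ⊕ forward s
  place-forward right x y z = cong (λ n → +ℤ x , +ℤ y , +ℤ n) (+-comm 1 z)
  place-forward left  x y z = cong (λ v → -[1+ x ] , +ℤ y , v) (⊖-suc⁻ zmax z)

  place-down : ∀ s x y z → place s x y z ≡ place s x (suc y) z ⊕ ym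
  place-down s x y z = refl

  place-up : ∀ s x y z → place s x (suc y) z ≡ place s x y z ⊕ yp
  place-up s x y z = cong (λ n → xpos s x , +ℤ n , zpos s z) (+-comm 1 y)

  place-injective : ∀ {s s' x x' y y' z z'} → place s x y z ≡ place s' x' y' z' →
    s ≡ s' × x ≡ x' × y ≡ y' × z ≡ z'
  place-injective {s} {s'} {x} {x'} {y} {y'} {z} {z'} e
    with x-injective s s' (,-injectiveˡ e)
    where
    x-injective : ∀ s s' → xpos s x ≡ xpos s' x' → s ≡ s' × x ≡ x'
    x-injective right right refl = refl , refl
    x-injective left  left  refl = refl , refl
  ... | refl , x≡ = refl , x≡ , ℤₚ.+-injective (,-injectiveˡ (,-injectiveʳ e)) , z-injective s (,-injectiveʳ (,-injectiveʳ e))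
    where
    z-injective : ∀ s → zpos s z ≡ zpos s z' → z ≡ z'
    z-injective right h = ℤₚ.+-injective h
    z-injective left  h = ⊖-injectiveʳ zmax h

  ValidCol : Col → Set
  ValidCol (cell _ k _ i _) = k < g × i < w
  ValidCol (turn _ k _)     = k < g
  ValidCol (rib _ k _)      = k < g
  ValidCol fin              = ⊤
  ValidCol shaft            = ⊤
  ValidCol (wall _ x m)     = x < dbl w × m ≤ dbl g

  Valid : Node → Set
  Valid (floor _ x z) = x ≤ dbl w × z ≤ zmax
  Valid (node c Y _)  = ValidCol c × Y < ℓ

  offset-< : ∀ q {k} → k < g → offset q (dbl (dbl k)) < dbl (dbl g)
  offset-< q {k} k< = <-≤-trans (bound q) (dbl-mono (dbl-mono k<))
    where
    bound : ∀ q → offset q (dbl (dbl k)) < 4 + dbl (dbl k)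
    bound q0 = s≤s (m≤n+m _ 3)
    bound q1 = s≤s (s≤s (m≤n+m _ 2))
    bound q2 = s≤s (s≤s (s≤s (m≤n+m _ 1)))
    bound q3 = ≤-refl

  private
    parity : ℕ → ℕ
    parity zero          = 2
    parity (suc zero)    = 3
    parity (suc (suc n)) = parity n

    -- Distinguishes the spine, the turns, the walls and the cells by their coordinates.
    class : ℕ → ℕ → ℕ
    class zero    z = 0
    class (suc x) z with x ≟ dbl w
    ... | yes _ = 1
    ... | no  _ = parity z

    colClass : Col → ℕ
    colClass (cell _ _ _ _ _) = 3
    colClass (turn _ _ _)     = 1
    colClass (rib _ _ _)      = 0
    colClass fin              = 0
    colClass shaft            = 0
    colClass (wall _ _ _)     = 2

    class-wall : ∀ x m → x < dbl w → class (suc x) (dbl m) ≡ 2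
    class-wall x m x< with x ≟ dbl w
    ... | yes refl = contradiction x< (<-irrefl refl)
    ... | no  _    = even m
      where
      even : ∀ m → parity (dbl m) ≡ 2
      even zero    = refl
      even (suc m) = even m

    class-cell : ∀ x m → x < dbl w → class (suc x) (suc (dbl m)) ≡ 3
    class-cell x m x< with x ≟ dbl w
    ... | yes refl = contradiction x< (<-irrefl refl)
    ... | no  _    = odd m
      where
      odd : ∀ m → parity (suc (dbl m)) ≡ 3
      odd zero    = refl
      odd (suc m) = odd m

    class-turn : ∀ z → class (suc (dbl w)) z ≡ 1
    class-turn z with dbl w ≟ dbl w
    ... | yes _ = refl
    ... | no  n = contradiction refl n

  back-xh : ∀ {j} → j < dbl w → dbl w ∸ j ≡ suc (dbl w ∸ suc j)
  back-xh {j} j< = trans (cong (_∸ j) (sym (m+[n∸m]≡n j<))) (trans (cong (_∸ j) (sym (+-suc j _))) (m+n∸m≡n j _))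

  private
    col-class : ∀ c → ValidCol c → class (xh c) (zh c) ≡ colClass c
    col-class (cell s k false i c) (_ , i<) = class-cell (bcons c i) (bcons false k) (bcons-< c i<)
    col-class (cell s k true  i c) (_ , i<) rewrite back-xh (bcons-< c i<) =
      class-cell (dbl w ∸ suc (bcons c i)) (bcons true k) (s≤s (m∸n≤m (suc (dbl w')) (bcons c i)))
    col-class (turn _ _ _) _ = class-turn _
    col-class (rib _ _ _)  _ = refl
    col-class fin          _ = refl
    col-class shaft        _ = refl
    col-class (wall s x m) (x< , _) = class-wall x m x<

    col-injective : ∀ c c' → ValidCol c → ValidCol c' → colSide c ≡ colSide c' → xh c ≡ xh c' → zh c ≡ zh c' →
      colClass c ≡ colClass c' → c ≡ c'
    col-injective (cell s k r i c) (cell .s k' r' i' c') (_ , i<) (_ , i'<) refl ex ez refl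
      with bcons-injective {r} {r'} (dbl-injective (suc-injective ez))
    col-injective (cell s k false i c) (cell .s k' r' i' c') (_ , i<) (_ , i'<) refl ex ez refl | refl , refl
      with bcons-injective {c} {c'} (suc-injective ex)
    ... | refl , refl = refl
    col-injective (cell s k true i c) (cell .s k' r' i' c') (_ , i<) (_ , i'<) refl ex ez refl | refl , refl
      with bcons-injective {c} {c'} (∸-cancelˡ-≡ (<⇒≤ (bcons-< c i<)) (<⇒≤ (bcons-< c' i'<)) ex)
    ... | refl , refl = refl
    col-injective (turn s k q) (turn .s k' q') v v' refl ex ez refl with offset-injective q q' (suc-injective ez)
    ... | refl , refl = refl
    col-injective (rib s k q) (rib .s k' q') v v' refl ex ez refl with offset-injective q q' (suc-injective ez)
    ... | refl , refl = refl
    col-injective (rib s k q) fin v v' refl ex ez refl =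
      contradiction (suc-injective ez) (<⇒≢ (offset-< q v))
    col-injective fin (rib s k q) v v' refl ex ez refl =
      contradiction (sym (suc-injective ez)) (<⇒≢ (offset-< q v'))
    col-injective (rib s k q) shaft v v' es ex () refl
    col-injective shaft (rib s k q) v v' es ex () refl
    col-injective fin fin v v' es ex ez refl = refl
    col-injective shaft shaft v v' es ex ez refl = refl
    col-injective fin shaft v v' () ex ez refl
    col-injective shaft fin v v' () ex ez refl
    col-injective (wall s x m) (wall .s x' m') v v' refl ex ez refl with suc-injective ex | dbl-injective ez
    ... | refl | refl = refl

  pos-injective : ∀ u v → Valid u → Valid v → pos u ≡ pos v → u ≡ v
  pos-injective (floor s x z) (floor s' x' z') _ _ e with place-injective {s} {s'} e
  ... | refl , refl , _ , refl = refl
  pos-injective (floor s x z) (node c Y l) _ _ e with place-injective {s} {colSide c} e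
  ... | _ , _ , () , _
  pos-injective (node c Y l) (floor s x z) _ _ e with place-injective {colSide c} {s} e
  ... | _ , _ , () , _
  pos-injective (node c Y l) (node c' Y' l') (vc , _) (vc' , _) e with place-injective {colSide c} {colSide c'} e
  ... | es , ex , ey , ez with lane-injective {Y} {Y'} l l' (suc-injective ey)
    | col-injective c c' vc vc' es ex ez
        (trans (sym (col-class c vc)) (trans (cong₂ class ex ez) (col-class c' vc')))
  ...   | refl , refl | refl = refl

data Wiring : Set where
  none root : Wiring
  stone wire : Dir → Node → Wiring
  sel both   : Dir → Node → Dir → Node → Wiring
  read       : Dir → Node → Node → Wiring
  inp outp   : Node → Node → Wiring

specOf : Wiring → Spec
specOf none            = none
specOf root            = root
specOf (stone d _)     = stone d
specOf (wire d _)      = wire d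
specOf (sel d _ e _)   = gate sel d e
specOf (both d _ e _)  = gate both d e
specOf (read d _ _)    = gate read d yp
specOf (inp _ _)       = inp
specOf (outp _ _)      = outp

blocks : ℕ → ℕ → ℕ
blocks size zero    = 0
blocks size (suc t) = blocks size t + size

blocks-≡ : ∀ size t → blocks size t ≡ t * size
blocks-≡ size zero    = refl
blocks-≡ size (suc t) = trans (+-comm (blocks size t) size) (cong (size +_) (blocks-≡ size t))

blocks-mono : ∀ size {t t'} → t ≤ t' → blocks size t ≤ blocks size t'
blocks-mono size z≤n     = z≤n
blocks-mono size (s≤s h) = +-monoˡ-≤ size (blocks-mono size h)

blocks-< : ∀ size {t t' x} y → t < t' → x < size → blocks size t + x < blocks size t' + y
blocks-< size {t} {t'} y t< x< =
  <-≤-trans (+-monoʳ-< (blocks size t) x<) (≤-trans (blocks-mono size t<) (m≤m+n _ y))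

blocks-injective : ∀ size t t' {x x'} → x < size → x' < size →
  blocks size t + x ≡ blocks size t' + x' → t ≡ t' × x ≡ x'
blocks-injective size t t' {x} {x'} x< x'< e with <-cmp t t'
... | tri< lt _ _   = contradiction e (<⇒≢ (blocks-< size x' lt x<))
... | tri> _ _ gt   = contradiction (sym e) (<⇒≢ (blocks-< size x gt x'<))
... | tri≈ _ refl _ = refl , +-cancelˡ-≡ (blocks size t) _ _ e

blocks-find : ∀ size n i → i < blocks size n → ∃ λ t → ∃ λ x → t < n × x < size × blocks size t + x ≡ i
blocks-find size (suc n) i i< with i <? blocks size n
... | yes i<n with blocks-find size n i i<n
...   | t , x , t< , x< , e = t , x , m≤n⇒m≤1+n t< , x< , e
blocks-find size (suc n) i i< | no i≮n = n , i ∸ blocks size n , ≤-refl ,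
  +-cancelˡ-< (blocks size n) _ _ (subst (_< blocks size n + size) (sym (m+[n∸m]≡n (≮⇒≥ i≮n))) i<) ,
  m+[n∸m]≡n (≮⇒≥ i≮n)

-- Lane 4 holds the input bits, lane 3 reads them, lane 2 composes the carry functions of the digits
-- from the start of the group (in cells) or of the layer (in ribs), lane 1 holds the carries and
-- lane 0 the sum.  The shaft passes the carry from each layer to the next.
module Circuitry (w' g' ℓ n : ℕ) where
  open Layout w' g' ℓ public

  grp : ℕ → ℕ
  grp = blocks (w + w)

  order : Side → ℕ → ℕ
  order right k = k
  order left  k = k + g

  lay : ℕ → ℕ
  lay = blocks (grp (g + g))

  start : ℕ → Side → ℕ → ℕ
  start Y s k = lay Y + grp (order s k)

  along : Bool → ℕ → ℕ
  along false i = i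
  along true  i = i + w

  index⁺ : ℕ → Side → ℕ → Bool → ℕ → ℕ
  index⁺ Y s k r i = start Y s k + along r i

  below : Col → ℕ → Lane → Node
  below c Y l4 = node c Y l3
  below c Y l3 = node c Y l2
  below c Y l2 = node c Y l1
  below c Y l1 = node c Y l0
  below c (suc Y) l0 = node c Y l4
  below c zero    l0 = floor (colSide c) (xh c) (zh c)

  rowBack : Side → Bool → Dir
  rowBack s false = inward s
  rowBack s true  = outward s

  wallX : Bool → ℕ → ℕ
  wallX false j = j
  wallX true  j = dbl w ∸ suc j

  wall-zm wall-zp : Side → ℕ → Bool → ℕ → Bool → Col
  wall-zm right k r i c = wall right (wallX r (bcons c i)) (bcons r k)
  wall-zm left  k r i c = wall left  (wallX r (bcons c i)) (suc (bcons r k))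
  wall-zp right k r i c = wall right (wallX r (bcons c i)) (suc (bcons r k))
  wall-zp left  k r i c = wall left  (wallX r (bcons c i)) (bcons r k)

  ribWiring₂ ribWiring₁ : Four → ℕ → Side → ℕ → Wiring
  ribWiring₂ q0 zero    right Y = none
  ribWiring₂ q0 zero    left  Y = wire xp (node (rib right g' q3) Y l2)
  ribWiring₂ q0 (suc k) s     Y = wire (backward s) (node (rib s k q3) Y l2)
  ribWiring₂ q1 zero    right Y = none
  ribWiring₂ q1 zero    left  Y = wire zp (node (rib left zero q0) Y l2)
  ribWiring₂ q1 (suc k) s     Y = wire (backward s) (node (rib s (suc k) q0) Y l2)
  ribWiring₂ q2 zero    right Y = wire xp (node (cell right zero true w' true) Y l2)
  ribWiring₂ q2 zero    left  Y =
    sel xm (node (cell left zero true w' true) Y l2) zp (node (rib left zero q1) Y l2)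
  ribWiring₂ q2 (suc k) s     Y =
    sel (outward s) (node (cell s (suc k) true w' true) Y l2) (backward s) (node (rib s (suc k) q1) Y l2)
  ribWiring₂ q3 k       s     Y = wire (backward s) (node (rib s k q2) Y l2)

  ribWiring₁ q0 zero    right Y = wire zm (node shaft Y l1)
  ribWiring₁ q0 zero    left  Y = sel yp (node (rib left zero q0) Y l2) xp (node (rib right g' q3) Y l1)
  ribWiring₁ q0 (suc k) s     Y = sel yp (node (rib s (suc k) q0) Y l2) (backward s) (node (rib s k q3) Y l1)
  ribWiring₁ q1 k       s     Y = wire (backward s) (node (rib s k q0) Y l1)
  ribWiring₁ q2 k       s     Y = wire (backward s) (node (rib s k q1) Y l1)
  ribWiring₁ q3 k       s     Y = wire (backward s) (node (rib s k q2) Y l1)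

  turnWiring : Four → Side → ℕ → ℕ → Lane → Wiring
  turnWiring q0 s k Y l = wire (inward s) (node (cell s k false w' true) Y l)
  turnWiring q1 s k Y l = wire (backward s) (node (turn s k q0) Y l)
  turnWiring q2 s k Y l = wire (backward s) (node (turn s k q1) Y l)
  turnWiring q3 s k Y l = none

  cellWiring₂ cellWiring₁ : Bool → ℕ → Bool → Side → ℕ → ℕ → Wiring
  cellWiring₂ false zero    false s k Y = none
  cellWiring₂ false zero    true  s k Y = wire (outward s) (node (turn s k q2) Y l2)
  cellWiring₂ false (suc i) r     s k Y = wire (rowBack s r) (node (cell s k r i true) Y l2)
  cellWiring₂ true  zero    false s k Y = wire yp (node (cell s k false zero true) Y l3)
  cellWiring₂ true  zero    true  s k Y =
    sel yp (node (cell s k true zero true) Y l3) (outward s) (node (cell s k true zero false) Y l2)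
  cellWiring₂ true  (suc i) r     s k Y =
    sel yp (node (cell s k r (suc i) true) Y l3) (rowBack s r) (node (cell s k r (suc i) false) Y l2)

  cellWiring₁ false zero    false s k Y = wire (inward s) (node (rib s k q0) Y l1)
  cellWiring₁ false zero    true  s k Y =
    sel yp (node (cell s k true zero false) Y l2) (outward s) (node (turn s k q2) Y l1)
  cellWiring₁ false (suc i) r     s k Y =
    sel yp (node (cell s k r (suc i) false) Y l2) (rowBack s r) (node (cell s k r i true) Y l1)
  cellWiring₁ true  i       r     s k Y =
    both yp (node (cell s k r i true) Y l2) (rowBack s r) (node (cell s k r i false) Y l1)

  wiring : Node → Wiring
  wiring (floor s x (suc z))        = stone (backward s) (floor s x z)
  wiring (floor s (suc x) zero)     = stone (inward s) (floor s x zero)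
  wiring (floor right zero zero)    = root
  wiring (floor left zero zero)     = stone xp (floor right zero zmax)
  wiring (node (wall s x m) Y l)    = stone ym (below (wall s x m) Y l)
  wiring (node shaft Y l2)          = sel xm (node fin Y l2) ym (node shaft Y l1)
  wiring (node shaft Y l)           = wire ym (below shaft Y l)
  wiring (node fin Y l2)            = wire zp (node (rib left g' q3) Y l2)
  wiring (node fin Y l)             = none
  wiring (node (rib s k q) Y l2)    = ribWiring₂ q k s Y
  wiring (node (rib s k q) Y l1)    = ribWiring₁ q k s Y
  wiring (node (rib s k q) Y l)     = none
  wiring (node (turn s k q) Y l2)   = turnWiring q s k Y l2
  wiring (node (turn s k q) Y l1)   = turnWiring q s k Y l1
  wiring (node (turn s k q) Y l)    = none
  wiring (node (cell s k r i c) Y l4) with index⁺ Y s k r i <? n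
  ... | yes _ = inp (node (wall-zm s k r i c) Y l4) (node (wall-zp s k r i c) Y l4)
  ... | no  _ = none
  wiring (node (cell s k r i false) Y l3) with index⁺ Y s k r i <? n
  ... | yes _ = read zm (node (wall-zm s k r i false) Y l3) (node (cell s k r i false) Y l4)
  ... | no  _ = none
  wiring (node (cell s k r i true) Y l3) with index⁺ Y s k r i <? n
  ... | yes _ = read (rowBack s r) (node (cell s k r i false) Y l3) (node (cell s k r i true) Y l4)
  ... | no  _ = wire zm (node (wall-zm s k r i true) Y l3)
  wiring (node (cell s k r i c) Y l2)     = cellWiring₂ c i r s k Y
  wiring (node (cell s k r i c) Y l1)     = cellWiring₁ c i r s k Y
  wiring (node (cell s k r i false) Y l0) = none
  wiring (node (cell s k r i true) Y l0)  =
    outp (node (cell s k r i true) Y l1) (node (wall-zm s k r i true) Y l0)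

  specN : Node → Spec
  specN = specOf ∘ wiring

  Link : Node → Dir → Node → Set
  Link v d u = pos u ≡ pos v ⊕ d × Valid u

  Linked : Node → Wiring → Set
  Linked v none           = ⊤
  Linked v root           = v ≡ floor right 0 0
  Linked v (stone d u)    = Link v d u × Stone (specN u)
  Linked v (wire d u)     = Link v d u × Chan (specN u)
  Linked v (sel d u e t)  = d ≢ e × (Link v d u × Chan (specN u)) × (Link v e t × Chan (specN t))
  Linked v (both d u e t) = d ≢ e × (Link v d u × Chan (specN u)) × (Link v e t × Chan (specN t))
  Linked v (read d u t)   = d ≢ yp × (Link v d u × Chan (specN u)) × (Link v yp t × specN t ≡ inp)
  Linked v (inp u t)      = (Link v zm u × Stone (specN u)) × (Link v zp t × Stone (specN t))
  Linked v (outp u t)     = (Link v yp u × ∃ λ d → ∃ λ e → specN u ≡ gate both d e) × (Link v zm t × Stone (specN t))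

  wall-zm-stone : ∀ s k r i c Y l → Stone (specN (node (wall-zm s k r i c) Y l))
  wall-zm-stone right k r i c Y l = stone
  wall-zm-stone left  k r i c Y l = stone

  private
    wallX-< : ∀ r {j} → j < dbl w → wallX r j < dbl w
    wallX-< false     j< = j<
    wallX-< true  {j} j< = s≤s (m∸n≤m (suc (dbl w')) j)

    xh-wall : ∀ s k r i c → i < w → suc (wallX r (bcons c i)) ≡ xh (cell s k r i c)
    xh-wall s k false i c i< = refl
    xh-wall s k true  i c i< = sym (back-xh (bcons-< c i<))

    inward-link : ∀ s c c' Y l → colSide c ≡ s → colSide c' ≡ s → xh c ≡ suc (xh c') → zh c ≡ zh c' →
      ValidCol c' → Y < ℓ → Link (node c Y l) (inward s) (node c' Y l)
    inward-link s c c' Y l refl sc' ex ez v Y< = at-place , v , Y<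
      where
      at-place : pos (node c' Y l) ≡ pos (node c Y l) ⊕ inward (colSide c)
      at-place rewrite sc' | ex | ez = place-inward (colSide c) (xh c') (height Y l) (zh c')

    outward-link : ∀ s c c' Y l → colSide c ≡ s → colSide c' ≡ s → xh c' ≡ suc (xh c) → zh c ≡ zh c' →
      ValidCol c' → Y < ℓ → Link (node c Y l) (outward s) (node c' Y l)
    outward-link s c c' Y l refl sc' ex ez v Y< = at-place , v , Y<
      where
      at-place : pos (node c' Y l) ≡ pos (node c Y l) ⊕ outward (colSide c)
      at-place rewrite sc' | ex | ez = place-outward (colSide c) (xh c) (height Y l) (zh c')

    backward-link : ∀ s c c' Y l → colSide c ≡ s → colSide c' ≡ s → xh c' ≡ xh c → zh c ≡ suc (zh c') →
      ValidCol c' → Y < ℓ → Link (node c Y l) (backward s) (node c' Y l)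
    backward-link s c c' Y l refl sc' ex ez v Y< = at-place , v , Y<
      where
      at-place : pos (node c' Y l) ≡ pos (node c Y l) ⊕ backward (colSide c)
      at-place rewrite sc' | ex | ez = place-backward (colSide c) (xh c) (height Y l) (zh c')

    forward-link : ∀ s c c' Y l → colSide c ≡ s → colSide c' ≡ s → xh c' ≡ xh c → zh c' ≡ suc (zh c) →
      ValidCol c' → Y < ℓ → Link (node c Y l) (forward s) (node c' Y l)
    forward-link s c c' Y l refl sc' ex ez v Y< = at-place , v , Y<
      where
      at-place : pos (node c' Y l) ≡ pos (node c Y l) ⊕ forward (colSide c)
      at-place rewrite sc' | ex | ez = place-forward (colSide c) (xh c) (height Y l) (zh c)

    zm-link : ∀ s k r i c Y l → k < g → i < w → Y < ℓ → Link (node (cell s k r i c) Y l) zm (node (wall-zm s k r i c) Y l)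
    zm-link right k r i c Y l k< i< Y< = backward-link right (cell right k r i c) (wall-zm right k r i c) Y l refl refl
      (xh-wall right k r i c i<) refl (wallX-< r (bcons-< c i<) , <⇒≤ (bcons-< r k<)) Y<
    zm-link left k r i c Y l k< i< Y< = forward-link left (cell left k r i c) (wall-zm left k r i c) Y l refl refl
      (xh-wall left k r i c i<) refl (wallX-< r (bcons-< c i<) , bcons-< r k<) Y<

    zp-link : ∀ s k r i c Y l → k < g → i < w → Y < ℓ → Link (node (cell s k r i c) Y l) zp (node (wall-zp s k r i c) Y l)
    zp-link right k r i c Y l k< i< Y< = forward-link right (cell right k r i c) (wall-zp right k r i c) Y l refl refl
      (xh-wall right k r i c i<) refl (wallX-< r (bcons-< c i<) , bcons-< r k<) Y<
    zp-link left k r i c Y l k< i< Y< = backward-link left (cell left k r i c) (wall-zp left k r i c) Y l refl refl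
      (xh-wall left k r i c i<) refl (wallX-< r (bcons-< c i<) , <⇒≤ (bcons-< r k<)) Y<

    wall-zp-stone : ∀ s k r i c Y l → Stone (specN (node (wall-zp s k r i c) Y l))
    wall-zp-stone right k r i c Y l = stone
    wall-zp-stone left  k r i c Y l = stone

    floor-stone : ∀ s x z → Stone (specN (floor s x z))
    floor-stone s x (suc z)        = stone
    floor-stone s (suc x) zero     = stone
    floor-stone right zero zero    = root
    floor-stone left zero zero     = stone

    zh≤zmax : ∀ c → ValidCol c → zh c ≤ zmax
    zh≤zmax (cell s k r i c) (k< , _) = s≤s (dbl-mono (<⇒≤ (bcons-< r k<)))
    zh≤zmax (turn s k q) k< = s≤s (<⇒≤ (offset-< q k<))
    zh≤zmax (rib s k q) k< = s≤s (<⇒≤ (offset-< q k<))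
    zh≤zmax fin _ = ≤-refl
    zh≤zmax shaft _ = z≤n
    zh≤zmax (wall s x m) (_ , m≤) = m≤n⇒m≤1+n (dbl-mono m≤)

    down-link : ∀ c Y l → xh c ≤ dbl w → ValidCol c → Y < ℓ → Link (node c Y l) ym (below c Y l)
    down-link c Y       l4 x≤ v Y< = place-down (colSide c) (xh c) _ (zh c) , v , Y<
    down-link c Y       l3 x≤ v Y< = place-down (colSide c) (xh c) _ (zh c) , v , Y<
    down-link c Y       l2 x≤ v Y< = place-down (colSide c) (xh c) _ (zh c) , v , Y<
    down-link c Y       l1 x≤ v Y< = place-down (colSide c) (xh c) _ (zh c) , v , Y<
    down-link c (suc Y) l0 x≤ v Y< = place-down (colSide c) (xh c) _ (zh c) , v , <⇒≤ Y<
    down-link c zero    l0 x≤ v Y< = place-down (colSide c) (xh c) _ (zh c) , x≤ , zh≤zmax c v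

    up-link : ∀ c Y {l l⁺} → lane l⁺ ≡ suc (lane l) → ValidCol c → Y < ℓ → Link (node c Y l) yp (node c Y l⁺)
    up-link c Y {l} {l⁺} e v Y< = trans (cong (λ n → place (colSide c) (xh c) (suc (n + quint Y)) (zh c)) e)
      (place-up (colSide c) (xh c) (height Y l) (zh c)) , v , Y<

    below-stone : ∀ s x m Y l → Stone (specN (below (wall s x m) Y l))
    below-stone s x m Y       l4 = stone
    below-stone s x m Y       l3 = stone
    below-stone s x m Y       l2 = stone
    below-stone s x m Y       l1 = stone
    below-stone s x m (suc Y) l0 = stone
    below-stone s x m zero    l0 = floor-stone s (suc x) (dbl m)

    shaft-chan : ∀ Y l → Chan (specN (node shaft Y l))
    shaft-chan Y l0 = wire
    shaft-chan Y l1 = wire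
    shaft-chan Y l2 = gate
    shaft-chan Y l3 = wire
    shaft-chan Y l4 = wire

    below-chan : ∀ Y l → Chan (specN (below shaft Y l))
    below-chan Y       l4 = shaft-chan Y l3
    below-chan Y       l3 = shaft-chan Y l2
    below-chan Y       l2 = shaft-chan Y l1
    below-chan Y       l1 = shaft-chan Y l0
    below-chan (suc Y) l0 = shaft-chan Y l4
    below-chan zero    l0 = stone (floor-stone right 0 0)

    rib₂-chan : ∀ s k Y → Chan (specN (node (rib s k q2) Y l2))
    rib₂-chan right zero    Y = wire
    rib₂-chan left  zero    Y = gate
    rib₂-chan s     (suc k) Y = gate

    rib₁-chan : ∀ s k Y → Chan (specN (node (rib s k q0) Y l1))
    rib₁-chan right zero    Y = wire
    rib₁-chan left  zero    Y = gate
    rib₁-chan s     (suc k) Y = gate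

    cell₂-chan : ∀ s k r i Y → Chan (specN (node (cell s k r i true) Y l2))
    cell₂-chan s k false zero    Y = wire
    cell₂-chan s k true  zero    Y = gate
    cell₂-chan s k r     (suc i) Y = gate

    cell₁-chan : ∀ s k r i Y → Chan (specN (node (cell s k r i false) Y l1))
    cell₁-chan s k false zero    Y = wire
    cell₁-chan s k true  zero    Y = gate
    cell₁-chan s k r     (suc i) Y = gate

    cell₃-chan : ∀ s k r i Y → Chan (specN (node (cell s k r i true) Y l3))
    cell₃-chan s k r i Y with index⁺ Y s k r i <? n
    ... | yes _ = gate
    ... | no  _ = wire

    row-link : ∀ s k r i Y l → k < g → i < w → Y < ℓ →
      Link (node (cell s k r i true) Y l) (rowBack s r) (node (cell s k r i false) Y l)
    row-link s k false i Y l k< i< Y< = inward-link s (cell s k false i true) (cell s k false i false) Y l refl refl refl refl (k< , i<) Y<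
    row-link s k true  i Y l k< i< Y< = outward-link s (cell s k true i true) (cell s k true i false) Y l refl refl
      (back-xh (bcons-< false i<)) refl (k< , i<) Y<

    row-suc-link : ∀ s k r i Y l → k < g → suc i < w → Y < ℓ →
      Link (node (cell s k r (suc i) false) Y l) (rowBack s r) (node (cell s k r i true) Y l)
    row-suc-link s k false i Y l k< i< Y< = inward-link s (cell s k false (suc i) false) (cell s k false i true) Y l refl refl refl refl (k< , <⇒≤ i<) Y<
    row-suc-link s k true  i Y l k< i< Y< = outward-link s (cell s k true (suc i) false) (cell s k true i true) Y l refl refl
      (back-xh (bcons-< true (<⇒≤ i<))) refl (k< , <⇒≤ i<) Y<

    turn-link : ∀ s k Y l → k < g → Y < ℓ →
      Link (node (cell s k true zero false) Y l) (rowBack s true) (node (turn s k q2) Y l)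
    turn-link s k Y l k< Y< = outward-link s (cell s k true zero false) (turn s k q2) Y l refl refl refl refl k< Y<

    end-link : ∀ s k Y l → k < g → Y < ℓ → Link (node (rib s k q2) Y l) (outward s) (node (cell s k true w' true) Y l)
    end-link s k Y l k< Y< = outward-link s (rib s k q2) (cell s k true w' true) Y l refl refl
      (m+n∸n≡m 1 (dbl w')) refl (k< , ≤-refl) Y<

    yp≢rowBack : ∀ s r → yp ≢ rowBack s r
    yp≢rowBack right false ()
    yp≢rowBack right true  ()
    yp≢rowBack left  false ()
    yp≢rowBack left  true  ()

    outward≢backward : ∀ s → outward s ≢ backward s
    outward≢backward right ()
    outward≢backward left  ()

    yp≢backward : ∀ s → yp ≢ backward s
    yp≢backward right ()
    yp≢backward left  ()

    cell₄-inp : ∀ s k r i c Y → index⁺ Y s k r i < n → specN (node (cell s k r i c) Y l4) ≡ inp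
    cell₄-inp s k r i c Y lt with index⁺ Y s k r i <? n
    ... | yes _ = refl
    ... | no ¬lt = contradiction lt ¬lt

    cell₃-read : ∀ s k r i Y → index⁺ Y s k r i < n → Chan (specN (node (cell s k r i false) Y l3))
    cell₃-read s k r i Y lt with index⁺ Y s k r i <? n
    ... | yes _ = gate
    ... | no ¬lt = contradiction lt ¬lt

  linked : ∀ v → Valid v → Linked v (wiring v)
  linked (floor s x (suc z)) (x≤ , z≤) = (place-backward s x 0 z , x≤ , <⇒≤ z≤) , floor-stone s x z
  linked (floor s (suc x) zero) (x≤ , z≤) = (place-inward s x 0 0 , <⇒≤ x≤ , z≤) , floor-stone s x 0
  linked (floor right zero zero) _ = refl
  linked (floor left zero zero) _ = (refl , z≤n , ≤-refl) , floor-stone right 0 zmax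
  linked (node (wall s x m) Y l) (v@(x< , _) , Y<) = down-link (wall s x m) Y l x< v Y< , below-stone s x m Y l
  linked (node shaft Y l0) (v , Y<) = down-link shaft Y l0 z≤n v Y< , below-chan Y l0
  linked (node shaft Y l1) (v , Y<) = down-link shaft Y l1 z≤n v Y< , below-chan Y l1
  linked (node shaft Y l3) (v , Y<) = down-link shaft Y l3 z≤n v Y< , below-chan Y l3
  linked (node shaft Y l4) (v , Y<) = down-link shaft Y l4 z≤n v Y< , below-chan Y l4
  linked (node shaft Y l2) (v , Y<) = (λ ()) ,
    ((cong (λ z → -[1+ 0 ] , +ℤ height Y l2 , z) (ℤₚ.n⊖n≡0 zmax) , tt , Y<) , wire) , down-link shaft Y l2 z≤n v Y< , wire
  linked (node fin Y l2) (v , Y<) = backward-link left fin (rib left g' q3) Y l2 refl refl refl refl ≤-refl Y< , wire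
  linked (node fin Y l0) _ = tt
  linked (node fin Y l1) _ = tt
  linked (node fin Y l3) _ = tt
  linked (node fin Y l4) _ = tt
  linked (node (rib right zero q0) Y l2) _ = tt
  linked (node (rib left zero q0) Y l2) (k< , Y<) = (refl , ≤-refl , Y<) , wire
  linked (node (rib s (suc k) q0) Y l2) (k< , Y<) =
    backward-link s (rib s (suc k) q0) (rib s k q3) Y l2 refl refl refl refl (<⇒≤ k<) Y< , wire
  linked (node (rib right zero q1) Y l2) _ = tt
  linked (node (rib left zero q1) Y l2) (k< , Y<) =
    backward-link left (rib left zero q1) (rib left zero q0) Y l2 refl refl refl refl k< Y< , wire
  linked (node (rib s (suc k) q1) Y l2) (k< , Y<) =
    backward-link s (rib s (suc k) q1) (rib s (suc k) q0) Y l2 refl refl refl refl k< Y< , wire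
  linked (node (rib right zero q2) Y l2) (k< , Y<) = end-link right zero Y l2 k< Y< , cell₂-chan right zero true w' Y
  linked (node (rib left zero q2) Y l2) (k< , Y<) = outward≢backward left ,
    (end-link left zero Y l2 k< Y< , cell₂-chan left zero true w' Y) ,
    backward-link left (rib left zero q2) (rib left zero q1) Y l2 refl refl refl refl k< Y< , wire
  linked (node (rib s (suc k) q2) Y l2) (k< , Y<) = outward≢backward s ,
    (end-link s (suc k) Y l2 k< Y< , cell₂-chan s (suc k) true w' Y) ,
    backward-link s (rib s (suc k) q2) (rib s (suc k) q1) Y l2 refl refl refl refl k< Y< , wire
  linked (node (rib s k q3) Y l2) (k< , Y<) =
    backward-link s (rib s k q3) (rib s k q2) Y l2 refl refl refl refl k< Y< , rib₂-chan s k Y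
  linked (node (rib right zero q0) Y l1) (k< , Y<) =
    backward-link right (rib right zero q0) shaft Y l1 refl refl refl refl tt Y< , wire
  linked (node (rib left zero q0) Y l1) (k< , Y<) = (λ ()) ,
    (up-link (rib left zero q0) Y {l1} {l2} refl k< Y< , wire) , (refl , ≤-refl , Y<) , wire
  linked (node (rib s (suc k) q0) Y l1) (k< , Y<) = yp≢backward s ,
    (up-link (rib s (suc k) q0) Y {l1} {l2} refl k< Y< , wire) ,
    backward-link s (rib s (suc k) q0) (rib s k q3) Y l1 refl refl refl refl (<⇒≤ k<) Y< , wire
  linked (node (rib s k q1) Y l1) (k< , Y<) = backward-link s (rib s k q1) (rib s k q0) Y l1 refl refl refl refl k< Y< , rib₁-chan s k Y
  linked (node (rib s k q2) Y l1) (k< , Y<) = backward-link s (rib s k q2) (rib s k q1) Y l1 refl refl refl refl k< Y< , wire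
  linked (node (rib s k q3) Y l1) (k< , Y<) = backward-link s (rib s k q3) (rib s k q2) Y l1 refl refl refl refl k< Y< , wire
  linked (node (rib s k q) Y l0) _ = tt
  linked (node (rib s k q) Y l3) _ = tt
  linked (node (rib s k q) Y l4) _ = tt
  linked (node (turn s k q0) Y l2) (k< , Y<) =
    inward-link s (turn s k q0) (cell s k false w' true) Y l2 refl refl refl refl (k< , ≤-refl) Y< , cell₂-chan s k false w' Y
  linked (node (turn s k q1) Y l2) (k< , Y<) = backward-link s (turn s k q1) (turn s k q0) Y l2 refl refl refl refl k< Y< , wire
  linked (node (turn s k q2) Y l2) (k< , Y<) = backward-link s (turn s k q2) (turn s k q1) Y l2 refl refl refl refl k< Y< , wire
  linked (node (turn s k q3) Y l2) _ = tt
  linked (node (turn s k q0) Y l1) (k< , Y<) =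
    inward-link s (turn s k q0) (cell s k false w' true) Y l1 refl refl refl refl (k< , ≤-refl) Y< , gate
  linked (node (turn s k q1) Y l1) (k< , Y<) = backward-link s (turn s k q1) (turn s k q0) Y l1 refl refl refl refl k< Y< , wire
  linked (node (turn s k q2) Y l1) (k< , Y<) = backward-link s (turn s k q2) (turn s k q1) Y l1 refl refl refl refl k< Y< , wire
  linked (node (turn s k q3) Y l1) _ = tt
  linked (node (turn s k q) Y l0) _ = tt
  linked (node (turn s k q) Y l3) _ = tt
  linked (node (turn s k q) Y l4) _ = tt
  linked (node (cell s k r i c) Y l4) ((k< , i<) , Y<) with index⁺ Y s k r i <? n
  ... | yes _ = (zm-link s k r i c Y l4 k< i< Y< , wall-zm-stone s k r i c Y l4) ,
                (zp-link s k r i c Y l4 k< i< Y< , wall-zp-stone s k r i c Y l4)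
  ... | no  _ = tt
  linked (node (cell s k r i false) Y l3) ((k< , i<) , Y<) with index⁺ Y s k r i <? n
  ... | yes lt = (λ ()) , (zm-link s k r i false Y l3 k< i< Y< , stone (wall-zm-stone s k r i false Y l3)) ,
                 up-link (cell s k r i false) Y {l3} {l4} refl (k< , i<) Y< , cell₄-inp s k r i false Y lt
  ... | no  _ = tt
  linked (node (cell s k r i true) Y l3) ((k< , i<) , Y<) with index⁺ Y s k r i <? n
  ... | yes lt = yp≢rowBack s r ∘ sym , (row-link s k r i Y l3 k< i< Y< , cell₃-read s k r i Y lt) ,
                 up-link (cell s k r i true) Y {l3} {l4} refl (k< , i<) Y< , cell₄-inp s k r i true Y lt
  ... | no  _ = zm-link s k r i true Y l3 k< i< Y< , stone (wall-zm-stone s k r i true Y l3)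
  linked (node (cell s k false zero false) Y l2) _ = tt
  linked (node (cell s k true zero false) Y l2) ((k< , i<) , Y<) = turn-link s k Y l2 k< Y< , wire
  linked (node (cell s k r (suc i) false) Y l2) ((k< , i<) , Y<) = row-suc-link s k r i Y l2 k< i< Y< , cell₂-chan s k r i Y
  linked (node (cell s k false zero true) Y l2) (v , Y<) =
    up-link (cell s k false zero true) Y {l2} {l3} refl v Y< , cell₃-chan s k false zero Y
  linked (node (cell s k true zero true) Y l2) (v@(k< , i<) , Y<) = yp≢rowBack s true ,
    (up-link (cell s k true zero true) Y {l2} {l3} refl v Y< , cell₃-chan s k true zero Y) , row-link s k true zero Y l2 k< i< Y< , wire
  linked (node (cell s k r (suc i) true) Y l2) (v@(k< , i<) , Y<) = yp≢rowBack s r ,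
    (up-link (cell s k r (suc i) true) Y {l2} {l3} refl v Y< , cell₃-chan s k r (suc i) Y) ,
    row-link s k r (suc i) Y l2 k< i< Y< , wire
  linked (node (cell s k false zero false) Y l1) ((k< , i<) , Y<) =
    inward-link s (cell s k false zero false) (rib s k q0) Y l1 refl refl refl refl k< Y< , rib₁-chan s k Y
  linked (node (cell s k true zero false) Y l1) (v@(k< , i<) , Y<) = yp≢rowBack s true ,
    (up-link (cell s k true zero false) Y {l1} {l2} refl v Y< , wire) , turn-link s k Y l1 k< Y< , wire
  linked (node (cell s k r (suc i) false) Y l1) (v@(k< , i<) , Y<) = yp≢rowBack s r ,
    (up-link (cell s k r (suc i) false) Y {l1} {l2} refl v Y< , wire) , row-suc-link s k r i Y l1 k< i< Y< , gate
  linked (node (cell s k r i true) Y l1) (v@(k< , i<) , Y<) = yp≢rowBack s r ,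
    (up-link (cell s k r i true) Y {l1} {l2} refl v Y< , cell₂-chan s k r i Y) ,
    row-link s k r i Y l1 k< i< Y< , cell₁-chan s k r i Y
  linked (node (cell s k r i false) Y l0) _ = tt
  linked (node (cell s k r i true) Y l0) (v@(k< , i<) , Y<) =
    (up-link (cell s k r i true) Y {l0} {l1} refl v Y< , _ , _ , refl) ,
    zm-link s k r i true Y l0 k< i< Y< , wall-zm-stone s k r i true Y l0

-- Carry functions

_▹_ : Maybe Bool → Maybe Bool → Maybe Bool
just c  ▹ _ = just c
nothing ▹ m = m

▹-identityʳ : ∀ m → m ▹ nothing ≡ m
▹-identityʳ (just _) = refl
▹-identityʳ nothing  = refl

▹-assoc : ∀ k m n → (k ▹ m) ▹ n ≡ k ▹ (m ▹ n)
▹-assoc (just _) m n = refl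
▹-assoc nothing  m n = refl

▹-nothing : ∀ {m n} → m ▹ n ≡ nothing → m ≡ nothing × n ≡ nothing
▹-nothing {nothing} e = refl , e

carryOf : Bool → Bool → Maybe Bool
carryOf a b = if a xor b then nothing else just a

module Carries (A B : ℕ → Bool) where

  prefix : ℕ → ℕ → Maybe Bool
  prefix s zero    = nothing
  prefix s (suc t) = carryOf (A (s + t)) (B (s + t)) ▹ prefix s t

  carry : ℕ → Bool
  carry zero    = false
  carry (suc i) = fromMaybe (carry i) (carryOf (A i) (B i))

  sumBit : ℕ → Bool
  sumBit i = (A i xor B i) xor carry i

  run : ℕ → ℕ
  run zero    = 0
  run (suc i) = if A i xor B i then suc (run i) else 0

  prefix-+ : ∀ s t u → prefix s (t + u) ≡ prefix (s + t) u ▹ prefix s t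
  prefix-+ s t zero    rewrite +-identityʳ t = refl
  prefix-+ s t (suc u) rewrite +-suc t u | +-assoc s t u =
    trans (cong (carryOf (A (s + (t + u))) (B (s + (t + u))) ▹_) (prefix-+ s t u))
          (sym (▹-assoc (carryOf (A (s + (t + u))) (B (s + (t + u)))) (prefix (s + t) u) (prefix s t)))

  carry-prefix : ∀ s t → carry (s + t) ≡ fromMaybe (carry s) (prefix s t)
  carry-prefix s zero rewrite +-identityʳ s = refl
  carry-prefix s (suc t) rewrite +-suc s t with carryOf (A (s + t)) (B (s + t))
  ... | just _  = refl
  ... | nothing = carry-prefix s t

  carry-split : ∀ s t u → just (carry (s + (t + u))) ≡ prefix s (t + u) ▹ just (carry (s + t))
  carry-split s t u with prefix s (t + u) in e
  ... | just c  = cong just (trans (carry-prefix s (t + u)) (cong (fromMaybe (carry s)) e))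
  ... | nothing = cong just (trans (cong carry (sym (+-assoc s t u))) (trans (carry-prefix (s + t) u)
    (cong (fromMaybe (carry (s + t))) (proj₁ (▹-nothing {prefix (s + t) u} (trans (sym (prefix-+ s t u)) e))))))

  carry-next : ∀ s t → just (carry (s + suc t)) ≡ prefix s (suc t) ▹ just (carry (s + t))
  carry-next s t = subst (λ k → just (carry (s + k)) ≡ prefix s k ▹ just (carry (s + t))) (+-comm t 1) (carry-split s t 1)

  prefix-nothing : ∀ s t u → prefix s (t + u) ≡ nothing → prefix (s + t) u ≡ nothing
  prefix-nothing s t u e = proj₁ (▹-nothing {prefix (s + t) u} (trans (sym (prefix-+ s t u)) e))

  run-prefix : ∀ s t → prefix s t ≡ nothing → run (s + t) ≡ t + run s
  run-prefix s zero    e rewrite +-identityʳ s = refl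
  run-prefix s (suc t) e rewrite +-suc s t with A (s + t) xor B (s + t)
  ... | true  = cong suc (run-prefix s t e)

module Values (w' g' ℓ n : ℕ) where
  open Circuitry w' g' ℓ n public

  module _ (A B : ℕ → Bool) where
    open Carries A B

    valueN : Node → Val
    valueN (node (cell s k r i false) Y l3) = just (A (start Y s k + along r i)) , false
    valueN (node (cell s k r i true)  Y l3) =
      let j = start Y s k + along r i in carryOf (A j) (B j) , A j xor B j
    valueN (node (cell s k r i false) Y l2) = prefix (start Y s k) (along r i) , false
    valueN (node (cell s k r i true)  Y l2) =
      let j = start Y s k + along r i in prefix (start Y s k) (suc (along r i)) , A j xor B j
    valueN (node (cell s k r i false) Y l1) = just (carry (start Y s k + along r i)) , false
    valueN (node (cell s k r i true)  Y l1) = let j = start Y s k + along r i in just (carry j) , sumBit j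
    valueN (node (turn s k q) Y l2)         = prefix (start Y s k) w , false
    valueN (node (turn s k q) Y l1)         = just (carry (start Y s k + w')) , false
    valueN (node (rib s k q0) Y l2)         = prefix (lay Y) (grp (order s k)) , false
    valueN (node (rib s k q1) Y l2)         = prefix (lay Y) (grp (order s k)) , false
    valueN (node (rib s k q2) Y l2)         = prefix (lay Y) (grp (suc (order s k))) , false
    valueN (node (rib s k q3) Y l2)         = prefix (lay Y) (grp (suc (order s k))) , false
    valueN (node (rib s k q) Y l1)          = just (carry (start Y s k)) , false
    valueN (node fin Y l2)                  = prefix (lay Y) (grp (g + g)) , false
    valueN (node shaft Y l0)                = just (carry (lay Y)) , false
    valueN (node shaft Y l1)                = just (carry (lay Y)) , false
    valueN (node shaft Y l)                 = just (carry (lay (suc Y))) , false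
    valueN _                                = just false , false

    digitN : Node → Bool
    digitN (node (cell s k r i false) Y l4) = A (start Y s k + along r i)
    digitN (node (cell s k r i true)  Y l4) = B (start Y s k + along r i)
    digitN (node (cell s k r i true)  Y l0) = sumBit (start Y s k + along r i)
    digitN _                                = false

  Padded : (ℕ → Bool) → Set
  Padded A = ∀ i → n ≤ i → A i ≡ false

  Valued : Node → Wiring → Set
  Valued v none           = ⊤
  Valued v root           = ∀ A B → valueN A B v ≡ (just false , false)
  Valued v (stone d u)    = ∀ A B → valueN A B v ≡ (just false , false)
  Valued v (wire d u)     = Σ (Val → Val) λ f → ∀ A B → Padded A → Padded B → valueN A B v ≡ f (valueN A B u)
  Valued v (sel d u e t)  = Σ (Bool → Bool) λ f → ∀ A B →
    valueN A B v ≡ (proj₁ (valueN A B u) ▹ proj₁ (valueN A B t) , f (proj₂ (valueN A B u)))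
  Valued v (both d u e t) = Σ (Val → Val → Val) λ f → ∀ A B → valueN A B v ≡ f (valueN A B u) (valueN A B t)
  Valued v (read d u t)   = Σ (Val → Bool → Val) λ f → ∀ A B → valueN A B v ≡ f (valueN A B u) (digitN A B t)
  Valued v (inp u t)      = ⊤
  Valued v (outp u t)     = ∀ A B → digitN A B v ≡ proj₂ (valueN A B u)

  private
    drop₂ : Val → Val
    drop₂ v = proj₁ v , false

    K : Bool → Bool
    K _ = false

    add : Val → Val → Val
    add u v = proj₁ v , proj₂ u xor fromMaybe false (proj₁ v)

    readB : Val → Bool → Val
    readB v b = let a = fromMaybe false (proj₁ v) in carryOf a b , a xor b

    first-group : ∀ A B Y → Carries.prefix A B (lay Y) (w + w) ≡ Carries.prefix A B (lay Y + 0) (w + w)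
    first-group A B Y = cong (λ s → Carries.prefix A B s (w + w)) (sym (+-identityʳ (lay Y)))

    group : ∀ A B Y t → Carries.prefix A B (lay Y) (grp (suc t)) ≡
      Carries.prefix A B (lay Y + grp t) (w + w) ▹ Carries.prefix A B (lay Y) (grp t)
    group A B Y t = Carries.prefix-+ A B (lay Y) (grp t) (w + w)

    group-carry : ∀ A B Y t → just (Carries.carry A B (lay Y + grp (suc t))) ≡
      Carries.prefix A B (lay Y) (grp (suc t)) ▹ just (Carries.carry A B (lay Y + grp t))
    group-carry A B Y t = Carries.carry-split A B (lay Y) (grp t) (w + w)

    below-shaft : ∀ l → l ≢ l2 → ∀ Y → Valued (node shaft Y l) (wire ym (below shaft Y l))
    below-shaft l0 _ zero    = (λ v → v) , λ A B _ _ → refl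
    below-shaft l0 _ (suc Y) = drop₂ , λ A B _ _ → refl
    below-shaft l1 _ Y       = drop₂ , λ A B _ _ → refl
    below-shaft l2 ne Y      = contradiction refl ne
    below-shaft l3 _ Y       = drop₂ , λ A B _ _ → refl
    below-shaft l4 _ Y       = drop₂ , λ A B _ _ → refl

  valued : ∀ v → Valued v (wiring v)
  valued (floor s x (suc z)) A B = refl
  valued (floor s (suc x) zero) A B = refl
  valued (floor right zero zero) A B = refl
  valued (floor left zero zero) A B = refl
  valued (node (wall s x m) Y l) A B = refl
  valued (node shaft Y l0) = below-shaft l0 (λ ()) Y
  valued (node shaft Y l1) = below-shaft l1 (λ ()) Y
  valued (node shaft Y l3) = below-shaft l3 (λ ()) Y
  valued (node shaft Y l4) = below-shaft l4 (λ ()) Y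
  valued (node shaft Y l2) = K , λ A B → cong (_, false) (trans (Carries.carry-split A B (lay Y) 0 (grp (g + g)))
    (cong (λ s → Carries.prefix A B (lay Y) (grp (g + g)) ▹ just (Carries.carry A B s)) (+-identityʳ (lay Y))))
  valued (node fin Y l2) = drop₂ , λ A B _ _ → refl
  valued (node fin Y l0) = tt
  valued (node fin Y l1) = tt
  valued (node fin Y l3) = tt
  valued (node fin Y l4) = tt
  valued (node (rib right zero q0) Y l2) = tt
  valued (node (rib left zero q0) Y l2) = drop₂ , λ A B _ _ → refl
  valued (node (rib right (suc k) q0) Y l2) = drop₂ , λ A B _ _ → refl
  valued (node (rib left (suc k) q0) Y l2) = drop₂ , λ A B _ _ → refl
  valued (node (rib right zero q1) Y l2) = tt
  valued (node (rib left zero q1) Y l2) = drop₂ , λ A B _ _ → refl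
  valued (node (rib s (suc k) q1) Y l2) = drop₂ , λ A B _ _ → refl
  valued (node (rib right zero q2) Y l2) = drop₂ , λ A B _ _ → cong (_, false) (first-group A B Y)
  valued (node (rib left zero q2) Y l2) = K , λ A B → cong (_, false) (group A B Y g)
  valued (node (rib s (suc k) q2) Y l2) = K , λ A B → cong (_, false) (group A B Y (order s (suc k)))
  valued (node (rib s k q3) Y l2) = drop₂ , λ A B _ _ → refl
  valued (node (rib right zero q0) Y l1) =
    drop₂ , λ A B _ _ → cong (λ s → just (Carries.carry A B s) , false) (+-identityʳ (lay Y))
  valued (node (rib left zero q0) Y l1) = K , λ A B → cong (_, false) (group-carry A B Y g')
  valued (node (rib right (suc k) q0) Y l1) = K , λ A B → cong (_, false) (group-carry A B Y k)
  valued (node (rib left (suc k) q0) Y l1) = K , λ A B → cong (_, false) (group-carry A B Y (k + g))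
  valued (node (rib s k q1) Y l1) = drop₂ , λ A B _ _ → refl
  valued (node (rib s k q2) Y l1) = drop₂ , λ A B _ _ → refl
  valued (node (rib s k q3) Y l1) = drop₂ , λ A B _ _ → refl
  valued (node (rib s k q) Y l0) = tt
  valued (node (rib s k q) Y l3) = tt
  valued (node (rib s k q) Y l4) = tt
  valued (node (turn s k q0) Y l2) = drop₂ , λ A B _ _ → refl
  valued (node (turn s k q1) Y l2) = drop₂ , λ A B _ _ → refl
  valued (node (turn s k q2) Y l2) = drop₂ , λ A B _ _ → refl
  valued (node (turn s k q3) Y l2) = tt
  valued (node (turn s k q0) Y l1) = drop₂ , λ A B _ _ → refl
  valued (node (turn s k q1) Y l1) = drop₂ , λ A B _ _ → refl
  valued (node (turn s k q2) Y l1) = drop₂ , λ A B _ _ → refl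
  valued (node (turn s k q3) Y l1) = tt
  valued (node (turn s k q) Y l0) = tt
  valued (node (turn s k q) Y l3) = tt
  valued (node (turn s k q) Y l4) = tt
  valued (node (cell s k r i c) Y l4) with index⁺ Y s k r i <? n
  ... | yes _ = tt
  ... | no  _ = tt
  valued (node (cell s k r i false) Y l3) with index⁺ Y s k r i <? n
  ... | yes _ = (λ _ b → just b , false) , λ A B → refl
  ... | no  _ = tt
  valued (node (cell s k r i true) Y l3) with index⁺ Y s k r i <? n
  ... | yes _ = readB , λ A B → refl
  ... | no ¬lt = (λ _ → just false , false) , λ A B padA padB →
    cong₂ (λ a b → carryOf a b , a xor b) (padA _ (≮⇒≥ ¬lt)) (padB _ (≮⇒≥ ¬lt))
  valued (node (cell s k false zero false) Y l2) = tt
  valued (node (cell s k true zero false) Y l2) = drop₂ , λ A B _ _ → refl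
  valued (node (cell s k false (suc i) false) Y l2) = drop₂ , λ A B _ _ → refl
  valued (node (cell s k true (suc i) false) Y l2) = drop₂ , λ A B _ _ → refl
  valued (node (cell s k false zero true) Y l2) = (λ v → v) , λ A B _ _ → cong₂ _,_ (▹-identityʳ _) refl
  valued (node (cell s k true zero true) Y l2) = (λ x → x) , λ A B → refl
  valued (node (cell s k r (suc i) true) Y l2) = (λ x → x) , λ A B → refl
  valued (node (cell s k false zero false) Y l1) =
    drop₂ , λ A B _ _ → cong (λ s → just (Carries.carry A B s) , false) (+-identityʳ (start Y s k))
  valued (node (cell s k true zero false) Y l1) =
    K , λ A B → cong (_, false) (Carries.carry-next A B (start Y s k) w')
  valued (node (cell s k false (suc i) false) Y l1) =
    K , λ A B → cong (_, false) (Carries.carry-next A B (start Y s k) i)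
  valued (node (cell s k true (suc i) false) Y l1) =
    K , λ A B → cong (_, false) (Carries.carry-next A B (start Y s k) (i + w))
  valued (node (cell s k r i true) Y l1) = add , λ A B → refl
  valued (node (cell s k r i false) Y l0) = tt
  valued (node (cell s k r i true) Y l0) A B = refl

oct : ℕ → ℕ
oct zero    = zero
oct (suc n) = 8 + oct n

oct-mono : ∀ {m n} → m ≤ n → oct m ≤ oct n
oct-mono z≤n     = z≤n
oct-mono (s≤s h) = +-monoʳ-≤ 8 (oct-mono h)

oct-≡ : ∀ n → oct n ≡ 8 * n
oct-≡ zero    = refl
oct-≡ (suc n) = trans (cong (8 +_) (oct-≡ n)) (sym (*-suc 8 n))

-- The waiting time at position p of a chain, c steps after its start.
record Measure : Set where
  field
    M     : ℕ → ℕ → ℕ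
    cap   : ℕ → ℕ
    M≤cap : ∀ p {c c'} → c ≤ c' → M p c ≤ cap c'

abstract
  at⁺ : ℕ → ℕ → ℕ → ℕ
  at⁺ i m b = i + (oct m + b)

  at-≡ : ∀ i m b → at⁺ i m b ≡ i + (oct m + b)
  at-≡ i m b = refl

  at-< : ∀ i j {m b} {_ : T (i <ᵇ j)} → at⁺ i m b < at⁺ j m b
  at-< i j {m} {b} {lt} = +-monoˡ-< (oct m + b) (<ᵇ⇒< i j lt)

  at-grow : ∀ i j {m m' b} {_ : T (i <ᵇ j + 8)} → m < m' → at⁺ i m b < at⁺ j m' b
  at-grow i j {m} {m'} {b} {lt} m<m' = <-≤-trans (+-monoˡ-< (oct m + b) (<ᵇ⇒< i (j + 8) lt))
    (≤-trans (≤-reflexive (+-assoc j 8 (oct m + b))) (+-monoʳ-≤ j (+-monoˡ-≤ b (oct-mono m<m'))))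

  at-cap : ∀ i j {m e b} {_ : T (i <ᵇ j)} → m ≤ e → at⁺ i m b < at⁺ j e b
  at-cap i j {m} {e} {b} {lt} m≤e = +-mono-<-≤ (<ᵇ⇒< i j lt) (+-monoˡ-≤ b (oct-mono m≤e))

  ≤at : ∀ i m b → b ≤ at⁺ i m b
  ≤at i m b = ≤-trans (m≤n+m b (oct m)) (m≤n+m _ i)

  offset≤at : ∀ i m b → i + b ≤ at⁺ i m b
  offset≤at i m b = +-monoʳ-≤ i (m≤n+m b (oct m))

module Clocks (w' g' ℓ n : ℕ) where
  open Values w' g' ℓ n public

  module Clock (𝓜 : Measure) where
    open Measure 𝓜

    e₁ e₂ e₃ b₁ b₂ b₃ b₄ b₅ : ℕ
    e₁ = cap (w + w)
    e₂ = cap (g + g)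
    e₃ = cap ℓ
    b₁ = at⁺ 8 e₁ 0
    b₂ = at⁺ 4 e₂ b₁
    b₃ = at⁺ 5 e₃ b₂
    b₄ = at⁺ 4 e₂ b₃
    b₅ = at⁺ 6 e₁ b₄

    clock : Node → ℕ
    clock (node (cell s k r i false) Y l3) = 1
    clock (node (cell s k r i true)  Y l3) = 2
    clock (node (cell s k r i false) Y l2) = at⁺ 7 (M (start Y s k + along r i) (along r i)) 0
    clock (node (cell s k r i true)  Y l2) = at⁺ 3 (M (start Y s k + suc (along r i)) (suc (along r i))) 0
    clock (node (cell s k r i false) Y l1) = at⁺ 0 (M (start Y s k + along r i) (along r i)) b₄
    clock (node (cell s k r i true)  Y l1) = at⁺ 1 (M (start Y s k + along r i) (along r i)) b₄
    clock (node (cell s k r i true)  Y l0) = at⁺ 2 (M (start Y s k + along r i) (along r i)) b₄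
    clock (node (turn s k q) Y l2)         = at⁺ (offset q 4) (M (start Y s k + w) w) 0
    clock (node (turn s k q) Y l1)         = at⁺ (offset q 2) (M (start Y s k + w') w') b₄
    clock (node (rib s k q0) Y l2)         = at⁺ 2 (M (lay Y + grp (order s k)) (order s k)) b₁
    clock (node (rib s k q1) Y l2)         = at⁺ 3 (M (lay Y + grp (order s k)) (order s k)) b₁
    clock (node (rib s k q2) Y l2)         = at⁺ 0 (M (lay Y + grp (suc (order s k))) (suc (order s k))) b₁
    clock (node (rib s k q3) Y l2)         = at⁺ 1 (M (lay Y + grp (suc (order s k))) (suc (order s k))) b₁
    clock (node (rib s k q) Y l1)          = at⁺ (offset q 0) (M (lay Y + grp (order s k)) (order s k)) b₃
    clock (node fin Y l2)                  = at⁺ 2 (M (lay Y + grp (g + g)) (g + g)) b₁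
    clock (node shaft Y l0)                = at⁺ 3 (M (lay Y) Y) b₂
    clock (node shaft Y l1)                = at⁺ 4 (M (lay Y) Y) b₂
    clock (node shaft Y l2)                = at⁺ 0 (M (lay (suc Y)) (suc Y)) b₂
    clock (node shaft Y l3)                = at⁺ 1 (M (lay (suc Y)) (suc Y)) b₂
    clock (node shaft Y l4)                = at⁺ 2 (M (lay (suc Y)) (suc Y)) b₂
    clock _                                = 0

    b₁≤b₂ : b₁ ≤ b₂
    b₁≤b₂ = ≤at 4 e₂ b₁
    b₂≤b₃ : b₂ ≤ b₃
    b₂≤b₃ = ≤at 5 e₃ b₂
    b₃≤b₄ : b₃ ≤ b₄
    b₃≤b₄ = ≤at 4 e₂ b₃
    b₁≤b₄ : b₁ ≤ b₄
    b₁≤b₄ = ≤-trans b₁≤b₂ (≤-trans b₂≤b₃ b₃≤b₄)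

    private
      along-≤ : ∀ r {i} → i < w → suc (along r i) ≤ w + w
      along-≤ false i< = ≤-trans i< (m≤m+n w w)
      along-≤ true  i< = +-monoˡ-≤ w i<

      order-< : ∀ s {k} → k < g → order s k < g + g
      order-< right k< = ≤-trans k< (m≤m+n g g)
      order-< left  k< = +-monoˡ-≤ g k<

    cell₂< : ∀ s k r i c Y → i < w → clock (node (cell s k r i c) Y l2) < b₁
    cell₂< s k r i false Y i< = at-cap 7 8 (M≤cap _ (<⇒≤ (along-≤ r i<)))
    cell₂< s k r i true  Y i< = at-cap 3 8 (M≤cap _ (along-≤ r i<))

    rib₂< : ∀ s k q Y → k < g → clock (node (rib s k q) Y l2) < b₂
    rib₂< s k q0 Y k< = at-cap 2 4 (M≤cap _ (<⇒≤ (order-< s k<)))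
    rib₂< s k q1 Y k< = at-cap 3 4 (M≤cap _ (<⇒≤ (order-< s k<)))
    rib₂< s k q2 Y k< = at-cap 0 4 (M≤cap _ (order-< s k<))
    rib₂< s k q3 Y k< = at-cap 1 4 (M≤cap _ (order-< s k<))

    fin< : ∀ Y → clock (node fin Y l2) < b₂
    fin< Y = at-cap 2 4 (M≤cap _ ≤-refl)

    shaft₁< : ∀ Y → Y < ℓ → clock (node shaft Y l1) < b₃
    shaft₁< Y Y< = at-cap 4 5 (M≤cap _ (<⇒≤ Y<))

    shaft< : ∀ Y l → Y < ℓ → clock (node shaft Y l) < b₃
    shaft< Y l0 Y< = at-cap 3 5 (M≤cap _ (<⇒≤ Y<))
    shaft< Y l1 Y< = shaft₁< Y Y<
    shaft< Y l2 Y< = at-cap 0 5 (M≤cap _ Y<)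
    shaft< Y l3 Y< = at-cap 1 5 (M≤cap _ Y<)
    shaft< Y l4 Y< = at-cap 2 5 (M≤cap _ Y<)

    rib₁< : ∀ s k q Y → k < g → clock (node (rib s k q) Y l1) < b₄
    rib₁< s k q Y k< = bound q
      where
      bound : ∀ q → clock (node (rib s k q) Y l1) < b₄
      bound q0 = at-cap 0 4 (M≤cap _ (<⇒≤ (order-< s k<)))
      bound q1 = at-cap 1 4 (M≤cap _ (<⇒≤ (order-< s k<)))
      bound q2 = at-cap 2 4 (M≤cap _ (<⇒≤ (order-< s k<)))
      bound q3 = at-cap 3 4 (M≤cap _ (<⇒≤ (order-< s k<)))

    b₄≤b₅ : 6 + b₄ ≤ b₅
    b₄≤b₅ = offset≤at 6 e₁ b₄

    clock< : ∀ v → Valid v → clock v < b₅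
    clock< = bound
      where
      up₄ : ∀ {x} → x ≤ 6 + b₄ → x ≤ b₅
      up₄ le = ≤-trans le b₄≤b₅
      up : ∀ {x} → x ≤ b₄ → x ≤ b₅
      up le = up₄ (≤-trans le (m≤n+m b₄ 6))
      few : ∀ k {_ : T (k <ᵇ 6)} → k < b₅
      few k {lt} = up₄ (≤-trans (<ᵇ⇒< k 6 lt) (m≤m+n 6 b₄))
      bound : ∀ v → Valid v → clock v < b₅
      bound (floor s x z) _ = few 0
      bound (node (cell s k r i false) Y l4) _ = few 0
      bound (node (cell s k r i true)  Y l4) _ = few 0
      bound (node (cell s k r i false) Y l3) _ = few 1
      bound (node (cell s k r i true)  Y l3) _ = few 2
      bound (node (cell s k r i false) Y l2) ((_ , i<) , _) = up (≤-trans (cell₂< s k r i false Y i<) b₁≤b₄)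
      bound (node (cell s k r i true)  Y l2) ((_ , i<) , _) = up (≤-trans (cell₂< s k r i true Y i<) b₁≤b₄)
      bound (node (cell s k r i false) Y l1) ((_ , i<) , _) = at-cap 0 6 (M≤cap _ (<⇒≤ (along-≤ r i<)))
      bound (node (cell s k r i true) Y l1)  ((_ , i<) , _) = at-cap 1 6 (M≤cap _ (<⇒≤ (along-≤ r i<)))
      bound (node (cell s k r i false) Y l0) _ = few 0
      bound (node (cell s k r i true) Y l0)  ((_ , i<) , _) = at-cap 2 6 (M≤cap _ (<⇒≤ (along-≤ r i<)))
      bound (node (turn s k q) Y l2) _ = up (≤-trans (turn₂ q) b₁≤b₄)
        where
        turn₂ : ∀ q → clock (node (turn s k q) Y l2) < b₁
        turn₂ q0 = at-cap 4 8 (M≤cap _ (m≤m+n w w))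
        turn₂ q1 = at-cap 5 8 (M≤cap _ (m≤m+n w w))
        turn₂ q2 = at-cap 6 8 (M≤cap _ (m≤m+n w w))
        turn₂ q3 = at-cap 7 8 (M≤cap _ (m≤m+n w w))
      bound (node (turn s k q) Y l1) _ = turn₁ q
        where
        w'≤ : w' ≤ w + w
        w'≤ = ≤-trans (n≤1+n w') (m≤m+n w w)
        turn₁ : ∀ q → clock (node (turn s k q) Y l1) < b₅
        turn₁ q0 = at-cap 2 6 (M≤cap _ w'≤)
        turn₁ q1 = at-cap 3 6 (M≤cap _ w'≤)
        turn₁ q2 = at-cap 4 6 (M≤cap _ w'≤)
        turn₁ q3 = at-cap 5 6 (M≤cap _ w'≤)
      bound (node (turn s k q) Y l0) _ = few 0
      bound (node (turn s k q) Y l3) _ = few 0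
      bound (node (turn s k q) Y l4) _ = few 0
      bound (node (rib s k q) Y l2) (k< , _) = up (≤-trans (rib₂< s k q Y k<) (≤-trans b₂≤b₃ b₃≤b₄))
      bound (node (rib s k q) Y l1) (k< , _) = up (rib₁< s k q Y k<)
      bound (node (rib s k q0) Y l0) _ = few 0
      bound (node (rib s k q1) Y l0) _ = few 0
      bound (node (rib s k q2) Y l0) _ = few 0
      bound (node (rib s k q3) Y l0) _ = few 0
      bound (node (rib s k q0) Y l3) _ = few 0
      bound (node (rib s k q1) Y l3) _ = few 0
      bound (node (rib s k q2) Y l3) _ = few 0
      bound (node (rib s k q3) Y l3) _ = few 0
      bound (node (rib s k q0) Y l4) _ = few 0
      bound (node (rib s k q1) Y l4) _ = few 0
      bound (node (rib s k q2) Y l4) _ = few 0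
      bound (node (rib s k q3) Y l4) _ = few 0
      bound (node fin Y l2) _ = up (≤-trans (fin< Y) (≤-trans b₂≤b₃ b₃≤b₄))
      bound (node fin Y l0) _ = few 0
      bound (node fin Y l1) _ = few 0
      bound (node fin Y l3) _ = few 0
      bound (node fin Y l4) _ = few 0
      bound (node shaft Y l) (_ , Y<) = up (≤-trans (shaft< Y l Y<) b₃≤b₄)
      bound (node (wall s x m) Y l) _ = few 0

  floorRanks seedRanks : ℕ
  floorRanks = suc (dbl w + zmax) + suc zmax
  seedRanks  = suc (floorRanks + suc (quint ℓ))

  seedRank : Node → ℕ
  seedRank (floor right x z)       = x + z
  seedRank (floor left x z)        = x + z + suc zmax
  seedRank (node (wall _ _ _) Y l) = floorRanks + height Y l
  seedRank (node _ Y l)            = floorRanks + suc (height Y l)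

  private
    floor-rank : ∀ s {x z} → x ≤ dbl w → z ≤ zmax → seedRank (floor s x z) < floorRanks
    floor-rank right x≤ z≤ = ≤-trans (s≤s (+-mono-≤ x≤ z≤)) (m≤m+n _ (suc zmax))
    floor-rank left  x≤ z≤ = s≤s (+-monoˡ-≤ (suc zmax) (+-mono-≤ x≤ z≤))

    height-≤ : ∀ {Y} l → Y < ℓ → height Y l ≤ quint ℓ
    height-≤ {Y} l Y< = ≤-trans (+-monoˡ-≤ (quint Y) (lane<5 l)) (quint-mono Y<)

    node-rank : ∀ {Y} l → Y < ℓ → floorRanks + suc (height Y l) < seedRanks
    node-rank l Y< = s≤s (+-monoʳ-≤ floorRanks (s≤s (height-≤ l Y<)))

  seedRank< : ∀ v → Valid v → seedRank v < seedRanks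
  seedRank< (floor s x z) (x≤ , z≤) = <-trans (floor-rank s x≤ z≤) (s≤s (m≤m+n floorRanks _))
  seedRank< (node (wall _ _ _) Y l) (_ , Y<) =
    <-trans (+-monoʳ-< floorRanks (n<1+n (height Y l))) (node-rank l Y<)
  seedRank< (node (cell _ _ _ _ _) Y l) (_ , Y<) = node-rank l Y<
  seedRank< (node (turn _ _ _) Y l) (_ , Y<)     = node-rank l Y<
  seedRank< (node (rib _ _ _) Y l) (_ , Y<)      = node-rank l Y<
  seedRank< (node fin Y l) (_ , Y<)              = node-rank l Y<
  seedRank< (node shaft Y l) (_ , Y<)            = node-rank l Y<

  InputCell : Node → Set
  InputCell v = ∃ λ s → ∃ λ k → ∃ λ r → ∃ λ i → ∃ λ c → ∃ λ Y →
    v ≡ node (cell s k r i c) Y l4 × index⁺ Y s k r i < n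

  Later : Node → Node → Set
  Later u v = ∀ 𝓜 → Clock.clock 𝓜 u < Clock.clock 𝓜 v

  -- When the first argument of a selector is `nothing`, all digits of the segment propagate, and
  -- the second argument is then available in time.
  record Segment (v u t : Node) : Set where
    field
      from len count : ℕ
      1≤len      : 1 ≤ len
      propagates : ∀ A B → proj₁ (valueN A B u) ≡ nothing → Carries.prefix A B from len ≡ nothing
      later      : ∀ 𝓜 → Measure.M 𝓜 from count < Measure.M 𝓜 (from + len) (suc count) →
                   Clock.clock 𝓜 t < Clock.clock 𝓜 v

  Clocked : Node → Wiring → Set
  Clocked v none           = ⊤
  Clocked v root           = ⊤
  Clocked v (stone d u)    = seedRank u < seedRank v
  Clocked v (wire d u)     = Stone (specN u) ⊎ Later u v
  Clocked v (sel d u e t)  = Later u v × Segment v u t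
  Clocked v (both d u e t) = Later u v × Later t v
  Clocked v (read d u t)   = Stone (specN u) ⊎ Later u v
  Clocked v (inp u t)      = seedRank u < seedRank v × seedRank t < seedRank v × InputCell v
  Clocked v (outp u t)     = Later u v

  private
    after : ∀ {x b} i m → x < b → x < at⁺ i m b
    after i m lt = <-≤-trans lt (≤at i m _)

    after₄ : ∀ 𝓜 {x} i m → x < Clock.b₁ 𝓜 → x < at⁺ i m (Clock.b₄ 𝓜)
    after₄ 𝓜 i m lt = after i m (<-≤-trans lt (Clock.b₁≤b₄ 𝓜))

    after₃ : ∀ 𝓜 {x} i m → x < Clock.b₂ 𝓜 → x < at⁺ i m (Clock.b₃ 𝓜)
    after₃ 𝓜 i m lt = after i m (<-≤-trans lt (Clock.b₂≤b₃ 𝓜))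

    digit-segment : ∀ {v u t} p c →
      (∀ A B → proj₁ (valueN A B u) ≡ nothing → carryOf (A (p + c)) (B (p + c)) ≡ nothing) →
      (∀ 𝓜 → Measure.M 𝓜 (p + c) c < Measure.M 𝓜 (p + suc c) (suc c) → Clock.clock 𝓜 t < Clock.clock 𝓜 v) →
      Segment v u t
    digit-segment p c prop late = record
      { from = p + c ; len = 1 ; count = c ; 1≤len = ≤-refl
      ; propagates = λ A B e → trans (cong (λ k → carryOf (A k) (B k) ▹ nothing) (+-identityʳ (p + c)))
                                 (cong (_▹ nothing) (prop A B e))
      ; later = λ 𝓜 lt → late 𝓜 (subst (λ k → Measure.M 𝓜 (p + c) c < Measure.M 𝓜 k (suc c))
                                   (trans (+-comm (p + c) 1) (sym (+-suc p c))) lt)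
      }

    group-segment : ∀ {v u t} Y T →
      (∀ A B → proj₁ (valueN A B u) ≡ nothing → Carries.prefix A B (lay Y + grp T) (w + w) ≡ nothing) →
      (∀ 𝓜 → Measure.M 𝓜 (lay Y + grp T) T < Measure.M 𝓜 (lay Y + grp (suc T)) (suc T) →
        Clock.clock 𝓜 t < Clock.clock 𝓜 v) →
      Segment v u t
    group-segment Y T prop late = record
      { from = lay Y + grp T ; len = w + w ; count = T ; 1≤len = s≤s z≤n
      ; propagates = prop
      ; later = λ 𝓜 lt → late 𝓜 (subst (λ k → Measure.M 𝓜 (lay Y + grp T) T < Measure.M 𝓜 k (suc T))
                                   (+-assoc (lay Y) (grp T) (w + w)) lt)
      }

    carry-segment : ∀ A B Y T → Carries.prefix A B (lay Y) (grp (suc T)) ≡ nothing →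
      Carries.prefix A B (lay Y + grp T) (w + w) ≡ nothing
    carry-segment A B Y T = Carries.prefix-nothing A B (lay Y) (grp T) (w + w)

    last-digit : ∀ A B p t → Carries.prefix A B p (suc t) ≡ nothing → carryOf (A (p + t)) (B (p + t)) ≡ nothing
    last-digit A B p t e = proj₁ (▹-nothing e)

  clocked : ∀ v → Valid v → Clocked v (wiring v)
  clocked (floor right x (suc z)) _ = +-monoʳ-< x ≤-refl
  clocked (floor left x (suc z)) _ = +-monoˡ-< (suc zmax) (+-monoʳ-< x ≤-refl)
  clocked (floor right (suc x) zero) _ = ≤-refl
  clocked (floor left (suc x) zero) _ = ≤-refl
  clocked (floor right zero zero) _ = tt
  clocked (floor left zero zero) _ = ≤-refl
  clocked (node (wall s x m) zero l0) ((x< , m≤) , _) =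
    <-≤-trans (floor-rank s x< (m≤n⇒m≤1+n (dbl-mono m≤))) (m≤m+n floorRanks _)
  clocked (node (wall s x m) (suc Y) l0) _ = +-monoʳ-< floorRanks ≤-refl
  clocked (node (wall s x m) Y l1) _ = +-monoʳ-< floorRanks ≤-refl
  clocked (node (wall s x m) Y l2) _ = +-monoʳ-< floorRanks ≤-refl
  clocked (node (wall s x m) Y l3) _ = +-monoʳ-< floorRanks ≤-refl
  clocked (node (wall s x m) Y l4) _ = +-monoʳ-< floorRanks ≤-refl
  clocked (node shaft zero l0) _ = inj₁ root
  clocked (node shaft (suc Y) l0) _ = inj₂ λ 𝓜 → at-< 2 3
  clocked (node shaft Y l1) _ = inj₂ λ 𝓜 → at-< 3 4
  clocked (node shaft Y l2) _ = (λ 𝓜 → after 0 _ (Clock.fin< 𝓜 Y)) , record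
    { from = lay Y ; len = grp (g + g) ; count = Y ; 1≤len = ≤-trans (s≤s z≤n) (m≤n+m (w + w) (grp (g' + g)))
    ; propagates = λ A B e → e ; later = λ 𝓜 lt → at-grow 4 0 lt }
  clocked (node shaft Y l3) _ = inj₂ λ 𝓜 → at-< 0 1
  clocked (node shaft Y l4) _ = inj₂ λ 𝓜 → at-< 1 2
  clocked (node fin Y l2) _ = inj₂ λ 𝓜 → at-< 1 2
  clocked (node fin Y l0) _ = tt
  clocked (node fin Y l1) _ = tt
  clocked (node fin Y l3) _ = tt
  clocked (node fin Y l4) _ = tt
  clocked (node (rib right zero q0) Y l2) _ = tt
  clocked (node (rib left zero q0) Y l2) _ = inj₂ λ 𝓜 → at-< 1 2
  clocked (node (rib right (suc k) q0) Y l2) _ = inj₂ λ 𝓜 → at-< 1 2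
  clocked (node (rib left (suc k) q0) Y l2) _ = inj₂ λ 𝓜 → at-< 1 2
  clocked (node (rib right zero q1) Y l2) _ = tt
  clocked (node (rib left zero q1) Y l2) _ = inj₂ λ 𝓜 → at-< 2 3
  clocked (node (rib s (suc k) q1) Y l2) _ = inj₂ λ 𝓜 → at-< 2 3
  clocked (node (rib right zero q2) Y l2) _ = inj₂ λ 𝓜 → after 0 _ (Clock.cell₂< 𝓜 right zero true w' true Y ≤-refl)
  clocked (node (rib left zero q2) Y l2) _ = (λ 𝓜 → after 0 _ (Clock.cell₂< 𝓜 left zero true w' true Y ≤-refl)) ,
    group-segment Y g (λ A B e → e) (λ 𝓜 lt → at-grow 3 0 lt)
  clocked (node (rib s (suc k) q2) Y l2) _ = (λ 𝓜 → after 0 _ (Clock.cell₂< 𝓜 s (suc k) true w' true Y ≤-refl)) ,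
    group-segment Y (order s (suc k)) (λ A B e → e) (λ 𝓜 lt → at-grow 3 0 lt)
  clocked (node (rib s k q3) Y l2) _ = inj₂ λ 𝓜 → at-< 0 1
  clocked (node (rib right zero q0) Y l1) (_ , Y<) = inj₂ λ 𝓜 → after 0 _ (Clock.shaft₁< 𝓜 Y Y<)
  clocked (node (rib left zero q0) Y l1) (k< , _) = (λ 𝓜 → after₃ 𝓜 0 _ (Clock.rib₂< 𝓜 left zero q0 Y k<)) ,
    group-segment Y g' (λ A B e → carry-segment A B Y g' e) (λ 𝓜 lt → at-grow 3 0 lt)
  clocked (node (rib right (suc k) q0) Y l1) (k< , _) = (λ 𝓜 → after₃ 𝓜 0 _ (Clock.rib₂< 𝓜 right (suc k) q0 Y k<)) ,
    group-segment Y k (λ A B e → carry-segment A B Y k e) (λ 𝓜 lt → at-grow 3 0 lt)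
  clocked (node (rib left (suc k) q0) Y l1) (k< , _) = (λ 𝓜 → after₃ 𝓜 0 _ (Clock.rib₂< 𝓜 left (suc k) q0 Y k<)) ,
    group-segment Y (k + g) (λ A B e → carry-segment A B Y (k + g) e) (λ 𝓜 lt → at-grow 3 0 lt)
  clocked (node (rib s k q1) Y l1) _ = inj₂ λ 𝓜 → at-< 0 1
  clocked (node (rib s k q2) Y l1) _ = inj₂ λ 𝓜 → at-< 1 2
  clocked (node (rib s k q3) Y l1) _ = inj₂ λ 𝓜 → at-< 2 3
  clocked (node (rib s k q) Y l0) _ = tt
  clocked (node (rib s k q) Y l3) _ = tt
  clocked (node (rib s k q) Y l4) _ = tt
  clocked (node (turn s k q0) Y l2) _ = inj₂ λ 𝓜 → at-< 3 4
  clocked (node (turn s k q1) Y l2) _ = inj₂ λ 𝓜 → at-< 4 5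
  clocked (node (turn s k q2) Y l2) _ = inj₂ λ 𝓜 → at-< 5 6
  clocked (node (turn s k q3) Y l2) _ = tt
  clocked (node (turn s k q0) Y l1) _ = inj₂ λ 𝓜 → at-< 1 2
  clocked (node (turn s k q1) Y l1) _ = inj₂ λ 𝓜 → at-< 2 3
  clocked (node (turn s k q2) Y l1) _ = inj₂ λ 𝓜 → at-< 3 4
  clocked (node (turn s k q3) Y l1) _ = tt
  clocked (node (turn s k q) Y l0) _ = tt
  clocked (node (turn s k q) Y l3) _ = tt
  clocked (node (turn s k q) Y l4) _ = tt
  clocked (node (cell s k r i c) Y l4) _ with index⁺ Y s k r i <? n
  ... | yes lt = zm-rank s , zp-rank s , s , k , r , i , c , Y , refl , lt
    where
    zm-rank : ∀ s → seedRank (node (wall-zm s k r i c) Y l4) < seedRank (node (cell s k r i c) Y l4)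
    zm-rank right = +-monoʳ-< floorRanks ≤-refl
    zm-rank left  = +-monoʳ-< floorRanks ≤-refl
    zp-rank : ∀ s → seedRank (node (wall-zp s k r i c) Y l4) < seedRank (node (cell s k r i c) Y l4)
    zp-rank right = +-monoʳ-< floorRanks ≤-refl
    zp-rank left  = +-monoʳ-< floorRanks ≤-refl
  ... | no  _ = tt
  clocked (node (cell s k r i false) Y l3) _ with index⁺ Y s k r i <? n
  ... | yes _ = inj₁ (wall-zm-stone s k r i false Y l3)
  ... | no  _ = tt
  clocked (node (cell s k r i true) Y l3) _ with index⁺ Y s k r i <? n
  ... | yes _ = inj₂ λ 𝓜 → ≤-refl
  ... | no  _ = inj₁ (wall-zm-stone s k r i true Y l3)
  clocked (node (cell s k false zero false) Y l2) _ = tt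
  clocked (node (cell s k true zero false) Y l2) _ = inj₂ λ 𝓜 → at-< 6 7
  clocked (node (cell s k false (suc i) false) Y l2) _ = inj₂ λ 𝓜 → at-< 3 7
  clocked (node (cell s k true (suc i) false) Y l2) _ = inj₂ λ 𝓜 → at-< 3 7
  clocked (node (cell s k false zero true) Y l2) _ = inj₂ λ 𝓜 → offset≤at 3 _ 0
  clocked (node (cell s k true zero true) Y l2) _ = (λ 𝓜 → offset≤at 3 _ 0) ,
    digit-segment (start Y s k) w (λ A B e → e) (λ 𝓜 lt → at-grow 7 3 lt)
  clocked (node (cell s k r (suc i) true) Y l2) _ = (λ 𝓜 → offset≤at 3 _ 0) ,
    digit-segment (start Y s k) (along r (suc i)) (λ A B e → e) (λ 𝓜 lt → at-grow 7 3 lt)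
  clocked (node (cell s k false zero false) Y l1) ((k< , _) , _) = inj₂ λ 𝓜 → after 0 _ (Clock.rib₁< 𝓜 s k q0 Y k<)
  clocked (node (cell s k true zero false) Y l1) ((_ , i<) , _) =
    (λ 𝓜 → after₄ 𝓜 0 _ (Clock.cell₂< 𝓜 s k true zero false Y i<)) ,
    digit-segment (start Y s k) w' (λ A B e → last-digit A B (start Y s k) w' e) (λ 𝓜 lt → at-grow 4 0 lt)
  clocked (node (cell s k false (suc i) false) Y l1) ((_ , i<) , _) =
    (λ 𝓜 → after₄ 𝓜 0 _ (Clock.cell₂< 𝓜 s k false (suc i) false Y i<)) ,
    digit-segment (start Y s k) i (λ A B e → last-digit A B (start Y s k) i e) (λ 𝓜 lt → at-grow 1 0 lt)
  clocked (node (cell s k true (suc i) false) Y l1) ((_ , i<) , _) =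
    (λ 𝓜 → after₄ 𝓜 0 _ (Clock.cell₂< 𝓜 s k true (suc i) false Y i<)) ,
    digit-segment (start Y s k) (i + w) (λ A B e → last-digit A B (start Y s k) (i + w) e) (λ 𝓜 lt → at-grow 1 0 lt)
  clocked (node (cell s k r i true) Y l1) ((_ , i<) , _) =
    (λ 𝓜 → after₄ 𝓜 1 _ (Clock.cell₂< 𝓜 s k r i true Y i<)) , λ 𝓜 → at-< 0 1
  clocked (node (cell s k r i false) Y l0) _ = tt
  clocked (node (cell s k r i true) Y l0) _ = λ 𝓜 → at-< 1 2

bits : ∀ {n} → Vec Bool n → ℕ → Bool
bits V.[]       i       = false
bits (x V.∷ xs) zero    = x
bits (x V.∷ xs) (suc i) = bits xs i

bits-padded : ∀ {n} (xs : Vec Bool n) i → n ≤ i → bits xs i ≡ false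
bits-padded V.[]       i       _       = refl
bits-padded (x V.∷ xs) (suc i) (s≤s h) = bits-padded xs i h

allBits-complete : ∀ {k} (v : Vec Bool k) → v ∈ allBits k
allBits-complete V.[] = here refl
allBits-complete (x V.∷ v) = ∈-concatMap⁺ (λ v → (false V.∷ v) ∷ (true V.∷ v) ∷ [])
  (Any.map (λ { refl → choose x }) (allBits-complete v))
  where
  choose : ∀ x → (x V.∷ v) ∈ (false V.∷ v) ∷ (true V.∷ v) ∷ []
  choose false = here refl
  choose true  = there (here refl)

module Adder (w' g' ℓ n : ℕ) where
  open Clocks w' g' ℓ n public

  private
    each : ∀ {A B : Set} → List A → (A → List B) → List B
    each xs f = concatMap f xs

    each⁺ : ∀ {A B : Set} {xs : List A} (f : A → List B) {x y} → x ∈ xs → y ∈ f x → y ∈ each xs f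
    each⁺ {xs = xs} f x∈ y∈ = ∈-concatMap⁺ f {xs = xs} (Any.map (λ { refl → y∈ }) x∈)

    sides : List Side
    sides = right ∷ left ∷ []

    side∈ : ∀ s → s ∈ sides
    side∈ right = here refl
    side∈ left  = there (here refl)

    bools : List Bool
    bools = false ∷ true ∷ []

    bool∈ : ∀ b → b ∈ bools
    bool∈ false = here refl
    bool∈ true  = there (here refl)

    fours : List Four
    fours = q0 ∷ q1 ∷ q2 ∷ q3 ∷ []

    four∈ : ∀ q → q ∈ fours
    four∈ q0 = here refl
    four∈ q1 = there (here refl)
    four∈ q2 = there (there (here refl))
    four∈ q3 = there (there (there (here refl)))

    lanes : List Lane
    lanes = l0 ∷ l1 ∷ l2 ∷ l3 ∷ l4 ∷ []

    lane∈ : ∀ l → l ∈ lanes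
    lane∈ l0 = here refl
    lane∈ l1 = there (here refl)
    lane∈ l2 = there (there (here refl))
    lane∈ l3 = there (there (there (here refl)))
    lane∈ l4 = there (there (there (there (here refl))))

    cells₃ : Side → ℕ → Bool → ℕ → List Col
    cells₃ s k r i = map (cell s k r i) bools
    cells₂ : Side → ℕ → Bool → List Col
    cells₂ s k r = each (upTo w) (cells₃ s k r)
    cells₁ spines₁ : Side → ℕ → List Col
    cells₁ s k = each bools (cells₂ s k)
    spines₁ s k = each fours (λ q → turn s k q ∷ rib s k q ∷ [])
    cells₀ spines₀ walls₀ : Side → List Col
    cells₀ s = each (upTo g) (cells₁ s)
    spines₀ s = each (upTo g) (spines₁ s)
    walls₀ s = each (upTo (dbl w)) (λ x → map (wall s x) (upTo (suc (dbl g))))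
    cells spines walls cols : List Col
    cells  = each sides cells₀
    spines = each sides spines₀
    walls  = each sides walls₀
    cols   = fin ∷ shaft ∷ cells ++ spines ++ walls

    col∈ : ∀ c → ValidCol c → c ∈ cols
    col∈ (cell s k r i c) (k< , i<) = there (there (∈-++⁺ˡ
      (each⁺ cells₀ (side∈ s) (each⁺ (cells₁ s) (∈-upTo⁺ k<) (each⁺ (cells₂ s k) (bool∈ r)
        (each⁺ (cells₃ s k r) (∈-upTo⁺ i<) (∈-map⁺ (cell s k r i) (bool∈ c))))))))
    col∈ (turn s k q) k< = there (there (∈-++⁺ʳ cells (∈-++⁺ˡ
      (each⁺ spines₀ (side∈ s) (each⁺ (spines₁ s) (∈-upTo⁺ k<)
        (each⁺ (λ q → turn s k q ∷ rib s k q ∷ []) (four∈ q) (here refl)))))))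
    col∈ (rib s k q) k< = there (there (∈-++⁺ʳ cells (∈-++⁺ˡ
      (each⁺ spines₀ (side∈ s) (each⁺ (spines₁ s) (∈-upTo⁺ k<)
        (each⁺ (λ q → turn s k q ∷ rib s k q ∷ []) (four∈ q) (there (here refl))))))))
    col∈ fin   _ = here refl
    col∈ shaft _ = there (here refl)
    col∈ (wall s x m) (x< , m≤) = there (there (∈-++⁺ʳ cells (∈-++⁺ʳ spines
      (each⁺ walls₀ (side∈ s) (each⁺ (λ x → map (wall s x) (upTo (suc (dbl g)))) (∈-upTo⁺ x<)
        (∈-map⁺ (wall s x) (∈-upTo⁺ (s≤s m≤))))))))

    floors₁ : Side → ℕ → List Node
    floors₁ s x = map (floor s x) (upTo (suc zmax))
    floors₀ : Side → List Node
    floors₀ s = each (upTo (suc (dbl w))) (floors₁ s)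
    stack₁ : Col → ℕ → List Node
    stack₁ c Y = map (node c Y) lanes
    stack₀ : Col → List Node
    stack₀ c = each (upTo ℓ) (stack₁ c)

  abstract
    nodes : List Node
    nodes = each sides floors₀ ++ each cols stack₀

    node∈ : ∀ v → Valid v → v ∈ nodes
    node∈ (floor s x z) (x≤ , z≤) = ∈-++⁺ˡ (each⁺ floors₀ (side∈ s) (each⁺ (floors₁ s) (∈-upTo⁺ (s≤s x≤))
      (∈-map⁺ (floor s x) (∈-upTo⁺ (s≤s z≤)))))
    node∈ (node c Y l) (vc , Y<) = ∈-++⁺ʳ (each sides floors₀) (each⁺ stack₀ (col∈ c vc) (each⁺ (stack₁ c) (∈-upTo⁺ Y<)
      (∈-map⁺ (node c Y) (lane∈ l))))

  private
    validCol? : ∀ c → Dec (ValidCol c)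
    validCol? (cell s k r i c) = (k <? g) ×-dec (i <? w)
    validCol? (turn s k q)     = k <? g
    validCol? (rib s k q)      = k <? g
    validCol? fin              = yes tt
    validCol? shaft            = yes tt
    validCol? (wall s x m)     = (x <? dbl w) ×-dec (m ≤? dbl g)

    valid? : ∀ v → Dec (Valid v)
    valid? (floor s x z) = (x ≤? dbl w) ×-dec (z ≤? zmax)
    valid? (node c Y l)  = validCol? c ×-dec (Y <? ℓ)

  Here : Pos → Set
  Here p = ∃ λ v → Valid v × pos v ≡ p

  abstract
    here? : ∀ p → Dec (Here p)
    here? p with any? (λ v → valid? v ×-dec (pos v ≟P p)) nodes
    ... | yes some = yes (Any.satisfied some)
    ... | no  ¬some = no λ { (v , valid , e) → ¬some (Any.map (λ { refl → valid , e }) (node∈ v valid)) }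

  lookupWith : {A : Set} → (Node → A) → A → Pos → A
  lookupWith f a p with here? p
  ... | yes (v , _) = f v
  ... | no  _       = a

  lookup-pos : ∀ {A : Set} (f : Node → A) a v → Valid v → lookupWith f a (pos v) ≡ f v
  lookup-pos f a v valid with here? (pos v)
  ... | yes (u , valid' , e) = cong f (pos-injective u v valid' valid e)
  ... | no  nowhere          = contradiction (v , valid , refl) nowhere

  spec⁺ : Pos → Spec
  spec⁺ = lookupWith specN none

  value⁺ : Vec Bool (n + n) → Pos → Val
  value⁺ b = lookupWith (valueN (bits (V.take n b)) (bits (V.drop n b))) (nothing , false)

  digit⁺ : Vec Bool (n + n) → Pos → Bool
  digit⁺ b = lookupWith (digitN (bits (V.take n b)) (bits (V.drop n b))) false

  counting : Measure
  counting = record { M = λ _ c → c ; cap = λ c → c ; M≤cap = λ _ h → h }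

  rankN : Node → ℕ
  rankN v = if isSeed (specN v) then seedRank v else seedRanks + Clock.clock counting v

  rank⁺ : Pos → ℕ
  rank⁺ = lookupWith rankN 0

  node-here : ∀ p → spec⁺ p ≢ none → Here p
  node-here p ne with here? p
  ... | yes h = h
  ... | no  _ = contradiction refl ne

  private
    seed-rank : ∀ v → isSeed (specN v) ≡ true → rankN v ≡ seedRank v
    seed-rank v e rewrite e = refl

    other-rank : ∀ v → isSeed (specN v) ≡ false → rankN v ≡ seedRanks + Clock.clock counting v
    other-rank v e rewrite e = refl

    rank-≤ : ∀ u → Valid u → rankN u ≤ seedRanks + Clock.clock counting u
    rank-≤ u valid with isSeed (specN u)
    ... | true  = ≤-trans (<⇒≤ (seedRank< u valid)) (m≤m+n seedRanks _)
    ... | false = ≤-refl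

    seed<other : ∀ u v → Valid u → isSeed (specN u) ≡ true → isSeed (specN v) ≡ false → rankN u < rankN v
    seed<other u v valid su sv rewrite seed-rank u su | other-rank v sv =
      <-≤-trans (seedRank< u valid) (m≤m+n seedRanks _)

    later<other : ∀ u v → Valid u → Clock.clock counting u < Clock.clock counting v → isSeed (specN v) ≡ false → rankN u < rankN v
    later<other u v valid lt sv = ≤-<-trans (rank-≤ u valid)
      (subst (seedRanks + Clock.clock counting u <_) (sym (other-rank v sv)) (+-monoʳ-< seedRanks lt))

  Source : Node → Dir → Set
  Source v d = ∃ λ u → Link v d u × SourceOK (specN v) d (specN u) × rankN u < rankN v

  source-node : ∀ v → Valid v → ∀ d → isIn (specN v) d ≡ true → Source v d
  source-node v valid d i = help (wiring v) refl (linked v valid) (clocked v valid) i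
    where
    ok : ∀ {W d s} → wiring v ≡ W → SourceOK (specOf W) d s → SourceOK (specN v) d s
    ok refl h = h
    nonseed : ∀ {W} → wiring v ≡ W → isSeed (specOf W) ≡ false → isSeed (specN v) ≡ false
    nonseed refl h = h
    seed : ∀ {W} → wiring v ≡ W → isSeed (specOf W) ≡ true → isSeed (specN v) ≡ true
    seed refl h = h
    both-seeds : ∀ u {W} → wiring v ≡ W → isSeed (specOf W) ≡ true → Stone (specN u) → seedRank u < seedRank v → rankN u < rankN v
    both-seeds u e s st lt = subst (λ k → k < rankN v) (sym (seed-rank u (Stone-seed st)))
      (subst (seedRank u <_) (sym (seed-rank v (seed e s))) lt)
    either : ∀ u {W} → wiring v ≡ W → isSeed (specOf W) ≡ false → Valid u → Stone (specN u) ⊎ Later u v → rankN u < rankN v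
    either u e s valid' (inj₁ st) = seed<other u v valid' (Stone-seed st) (nonseed e s)
    either u e s valid' (inj₂ lt) = later<other u v valid' (lt counting) (nonseed e s)
    help : ∀ W → wiring v ≡ W → Linked v W → Clocked v W → isIn (specOf W) d ≡ true → Source v d
    help none e _ _ ()
    help root e _ _ ()
    help (stone d' u) e (link , st) lt i with ==D-sound {d} i
    ... | refl = u , link , ok e (stone st) , both-seeds u e refl st lt
    help (wire d' u) e (link , ch) lt i with ==D-sound {d} i
    ... | refl = u , link , ok e (wire ch) , either u e refl (proj₂ link) lt
    help (sel d₁ u d₂ t) e (ne , (link , ch) , (link' , ch')) (lt , seg) i with ∨-true i
    ... | inj₁ h with ==D-sound {d} h
    ...   | refl = u , link , ok e (first ch) , either u e refl (proj₂ link) (inj₂ lt)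
    help (sel d₁ u d₂ t) e (ne , (link , ch) , (link' , ch')) (lt , seg) i | inj₂ h with ==D-sound {d} h
    ...   | refl = t , link' , ok e (sel₂ ch') , later<other t v (proj₂ link') (Segment.later seg counting ≤-refl) (nonseed e refl)
    help (both d₁ u d₂ t) e (ne , (link , ch) , (link' , ch')) (lt , lt') i with ∨-true i
    ... | inj₁ h with ==D-sound {d} h
    ...   | refl = u , link , ok e (first ch) , either u e refl (proj₂ link) (inj₂ lt)
    help (both d₁ u d₂ t) e (ne , (link , ch) , (link' , ch')) (lt , lt') i | inj₂ h with ==D-sound {d} h
    ...   | refl = t , link' , ok e (both₂ ch') , either t e refl (proj₂ link') (inj₂ lt')
    help (read d₁ u t) e (ne , (link , ch) , (link' , is-inp)) lt i with ∨-true i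
    ... | inj₁ h with ==D-sound {d} h
    ...   | refl = u , link , ok e (first ch) , either u e refl (proj₂ link) lt
    help (read d₁ u t) e (ne , (link , ch) , (link' , is-inp)) lt i | inj₂ h with ==D-sound {d} h
    ...   | refl = t , link' , ok e (subst (SourceOK (gate read d₁ yp) yp) (sym is-inp) read₂) ,
                   seed<other t v (proj₂ link') (cong isSeed is-inp) (nonseed e refl)
    help (inp u t) e ((link , st) , (link' , st')) (lt , lt' , _) i = side-case d i
      where
      side-case : ∀ d → isIn inp d ≡ true → Source v d
      side-case zm _ = u , link , ok e (inp-zm st) , both-seeds u e refl st lt
      side-case zp _ = t , link' , ok e (inp-zp st') , both-seeds t e refl st' lt'
    help (outp u t) e ((link , d₁ , d₂ , is-both) , (link' , st)) lt i = side-case d i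
      where
      side-case : ∀ d → isIn outp d ≡ true → Source v d
      side-case yp _ = u , link , ok e (subst (SourceOK outp yp) (sym is-both) outp-yp) , either u e refl (proj₂ link) (inj₂ lt)
      side-case zm _ = t , link' , ok e (outp-zm st) , either t e refl (proj₂ link') (inj₁ st)

module AdderCircuit (w' g' ℓ n : ℕ) where
  open Adder w' g' ℓ n public

  private
    Bits : Set
    Bits = Vec Bool (n + n)

    low high : Bits → ℕ → Bool
    low b  = bits (V.take n b)
    high b = bits (V.drop n b)

  node-at : ∀ {p s} → spec⁺ p ≡ s → s ≢ none → ∃ λ v → Valid v × pos v ≡ p × specN v ≡ s
  node-at {p} e ne with node-here p (λ n → ne (trans (sym e) n))
  ... | v , valid , refl = v , valid , refl , trans (sym (lookup-pos specN none v valid)) e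

  spec-pos : ∀ v → Valid v → spec⁺ (pos v) ≡ specN v
  spec-pos v valid = lookup-pos specN none v valid

  spec-link : ∀ {v d u} → Link v d u → spec⁺ (pos v ⊕ d) ≡ specN u
  spec-link {u = u} (e , valid) = trans (cong spec⁺ (sym e)) (spec-pos u valid)

  value-pos : ∀ b v → Valid v → value⁺ b (pos v) ≡ valueN (low b) (high b) v
  value-pos b v valid = lookup-pos (valueN (low b) (high b)) (nothing , false) v valid

  value-link : ∀ b {v d u} → Link v d u → value⁺ b (pos v ⊕ d) ≡ valueN (low b) (high b) u
  value-link b {u = u} (e , valid) = trans (cong (value⁺ b) (sym e)) (value-pos b u valid)

  digit-pos : ∀ b v → Valid v → digit⁺ b (pos v) ≡ digitN (low b) (high b) v
  digit-pos b v valid = lookup-pos (digitN (low b) (high b)) false v valid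

  digit-link : ∀ b {v d u} → Link v d u → digit⁺ b (pos v ⊕ d) ≡ digitN (low b) (high b) u
  digit-link b {u = u} (e , valid) = trans (cong (digit⁺ b) (sym e)) (digit-pos b u valid)

  private
    source⁺ : ∀ p d → isIn (spec⁺ p) d ≡ true →
      SourceOK (spec⁺ p) d (spec⁺ (p ⊕ d)) × rank⁺ (p ⊕ d) < rank⁺ p
    source⁺ p d i with node-at {p} refl (λ e → contradiction (trans (sym i) (cong (λ s → isIn s d) e)) λ ())
    ... | v , valid , refl , e with source-node v valid d (subst (λ s → isIn s d ≡ true) (sym e) i)
    ...   | u , link@(e' , valid') , ok , lt rewrite spec-link {v} {d} {u} link | sym e
          | sym e' | lookup-pos rankN 0 u valid' | lookup-pos rankN 0 v valid = ok , lt

    gate-≢⁺ : ∀ {p m d e} → spec⁺ p ≡ gate m d e → d ≢ e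
    gate-≢⁺ {p} {m} {d} {e} s with node-at {p} s (λ ())
    ... | v , valid , refl , s' = help (wiring v) s' (linked v valid)
      where
      help : ∀ W → specOf W ≡ gate m d e → Linked v W → d ≢ e
      help (sel _ _ _ _)  refl (ne , _) = ne
      help (both _ _ _ _) refl (ne , _) = ne
      help (read _ _ _)   refl (ne , _) = ne

    root-base⁺ : ∀ {p} → spec⁺ p ≡ root → p ≡ pos (floor right 0 0)
    root-base⁺ {p} s with node-at {p} s (λ ())
    ... | v , valid , refl , s' = help (wiring v) s' (linked v valid)
      where
      help : ∀ W → specOf W ≡ root → Linked v W → pos v ≡ pos (floor right 0 0)
      help root refl e = cong pos e

    value-eq : ∀ b b' {v} → Valid v → valueN (low b) (high b) v ≡ valueN (low b') (high b') v →
      value⁺ b (pos v) ≡ value⁺ b' (pos v)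
    value-eq b b' {v} valid e = trans (value-pos b v valid) (trans e (sym (value-pos b' v valid)))

    value-src : ∀ b b' {v d u} → Link v d u → value⁺ b (pos v ⊕ d) ≡ value⁺ b' (pos v ⊕ d) →
      valueN (low b) (high b) u ≡ valueN (low b') (high b') u
    value-src b b' {v} {d} {u} link e = trans (sym (value-link b {v} link)) (trans e (value-link b' {v} link))

    val-stone⁺ : ∀ b b' p → Stone (spec⁺ p) → value⁺ b p ≡ value⁺ b' p
    val-stone⁺ b b' p st with node-at {p} refl (λ e → contradiction (subst Stone e st) λ ())
    ... | v , valid , refl , e = value-eq b b' valid (help (wiring v) (subst Stone (sym e) st) (valued v))
      where
      help : ∀ W → Stone (specOf W) → Valued v W → valueN (low b) (high b) v ≡ valueN (low b') (high b') v
      help root        st h = trans (h _ _) (sym (h _ _))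
      help (stone _ _) st h = trans (h _ _) (sym (h _ _))
      help none ()
      help (wire _ _) ()
      help (sel _ _ _ _) ()
      help (both _ _ _ _) ()
      help (read _ _ _) ()
      help (inp _ _) ()
      help (outp _ _) ()

    val-wire⁺ : ∀ b b' {p d} → spec⁺ p ≡ wire d → value⁺ b (p ⊕ d) ≡ value⁺ b' (p ⊕ d) → value⁺ b p ≡ value⁺ b' p
    val-wire⁺ b b' {p} {d} s src with node-at {p} s (λ ())
    ... | v , valid , refl , s' = value-eq b b' valid (help (wiring v) s' (linked v valid) (valued v))
      where
      help : ∀ W → specOf W ≡ wire d → Linked v W → Valued v W → valueN (low b) (high b) v ≡ valueN (low b') (high b') v
      help (wire _ u) refl (link , _) (f , h) = trans (h _ _ (bits-padded (V.take n b)) (bits-padded (V.drop n b)))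
        (trans (cong f (value-src b b' {v} link src)) (sym (h _ _ (bits-padded (V.take n b')) (bits-padded (V.drop n b')))))

    val-sel⁺ : ∀ b b' {p d e} → spec⁺ p ≡ gate sel d e → value⁺ b (p ⊕ d) ≡ value⁺ b' (p ⊕ d) →
      (needs sel (value⁺ b (p ⊕ d)) ≡ true → value⁺ b (p ⊕ e) ≡ value⁺ b' (p ⊕ e)) → value⁺ b p ≡ value⁺ b' p
    val-sel⁺ b b' {p} {d} {e} s src₁ src₂ with node-at {p} s (λ ())
    ... | v , valid , refl , s' = value-eq b b' valid (help (wiring v) s' (linked v valid) (valued v))
      where
      help : ∀ W → specOf W ≡ gate sel d e → Linked v W → Valued v W → valueN (low b) (high b) v ≡ valueN (low b') (high b') v
      help (sel _ u _ t) refl (_ , (link , _) , (link' , _)) (f , h) =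
        trans (h _ _) (trans (cong₂ _,_ first-part (cong (f ∘ proj₂) first≡)) (sym (h _ _)))
        where
        first≡ : valueN (low b) (high b) u ≡ valueN (low b') (high b') u
        first≡ = value-src b b' {v} link src₁
        choose : ∀ m {x y} → (m ≡ nothing → x ≡ y) → (m ▹ x) ≡ (m ▹ y)
        choose (just _) _ = refl
        choose nothing  h = h refl
        nothing-needs : ∀ {x} → proj₁ x ≡ nothing → needs sel x ≡ true
        nothing-needs {nothing , _} refl = refl
        first-part : proj₁ (valueN (low b) (high b) u) ▹ proj₁ (valueN (low b) (high b) t)
                   ≡ proj₁ (valueN (low b') (high b') u) ▹ proj₁ (valueN (low b') (high b') t)
        first-part = trans (choose _ λ n → cong proj₁ (value-src b b' {v} link' (src₂ (nothing-needs
            (trans (cong proj₁ (value-link b {v} link)) n)))))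
          (cong (λ x → proj₁ x ▹ proj₁ (valueN (low b') (high b') t)) first≡)

    val-both⁺ : ∀ b b' {p d e} → spec⁺ p ≡ gate both d e → value⁺ b (p ⊕ d) ≡ value⁺ b' (p ⊕ d) →
      value⁺ b (p ⊕ e) ≡ value⁺ b' (p ⊕ e) → value⁺ b p ≡ value⁺ b' p
    val-both⁺ b b' {p} {d} {e} s src₁ src₂ with node-at {p} s (λ ())
    ... | v , valid , refl , s' = value-eq b b' valid (help (wiring v) s' (linked v valid) (valued v))
      where
      help : ∀ W → specOf W ≡ gate both d e → Linked v W → Valued v W → valueN (low b) (high b) v ≡ valueN (low b') (high b') v
      help (both _ u _ t) refl (_ , (link , _) , (link' , _)) (f , h) =
        trans (h _ _) (trans (cong₂ f (value-src b b' {v} link src₁) (value-src b b' {v} link' src₂)) (sym (h _ _)))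

    val-read⁺ : ∀ b b' {p d e} → spec⁺ p ≡ gate read d e → value⁺ b (p ⊕ d) ≡ value⁺ b' (p ⊕ d) →
      digit⁺ b (p ⊕ e) ≡ digit⁺ b' (p ⊕ e) → value⁺ b p ≡ value⁺ b' p
    val-read⁺ b b' {p} {d} {e} s src₁ src₂ with node-at {p} s (λ ())
    ... | v , valid , refl , s' = value-eq b b' valid (help (wiring v) s' (linked v valid) (valued v))
      where
      help : ∀ W → specOf W ≡ gate read d e → Linked v W → Valued v W → valueN (low b) (high b) v ≡ valueN (low b') (high b') v
      help (read _ u t) refl (_ , (link , _) , (link' , _)) (f , h) =
        trans (h _ _) (trans (cong₂ f (value-src b b' {v} link src₁)
          (trans (sym (digit-link b {v} {yp} link')) (trans src₂ (digit-link b' {v} {yp} link')))) (sym (h _ _)))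

    digit-outp⁺ : ∀ b {p} → spec⁺ p ≡ outp → digit⁺ b p ≡ proj₂ (value⁺ b (p ⊕ yp))
    digit-outp⁺ b {p} s with node-at {p} s (λ ())
    ... | v , valid , refl , s' = help (wiring v) s' (linked v valid) (valued v)
      where
      help : ∀ W → specOf W ≡ outp → Linked v W → Valued v W → digit⁺ b (pos v) ≡ proj₂ (value⁺ b (pos v ⊕ yp))
      help (outp u _) refl ((link , _) , _) h =
        trans (digit-pos b v valid) (trans (h _ _) (sym (cong proj₂ (value-link b {v} {yp} link))))

    base-valid : Valid (floor right 0 0)
    base-valid = z≤n , z≤n

  circuit : Circuit
  circuit = record
    { Input = Bits ; inputs = allBits (n + n) ; input∈ = allBits-complete
    ; spec = spec⁺ ; value = value⁺ ; digit = digit⁺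
    ; support = map pos nodes
    ; covers = λ p ne → covers⁺ p (node-here p ne)
    ; rank = rank⁺ ; source = source⁺
    ; gate-≢ = λ {p} → gate-≢⁺ {p}
    ; base = pos (floor right 0 0)
    ; base-root = spec-pos (floor right 0 0) base-valid
    ; root-base = λ {p} → root-base⁺ {p}
    ; val-stone = val-stone⁺
    ; val-wire = λ b b' {p} → val-wire⁺ b b' {p}
    ; val-sel = λ b b' {p} → val-sel⁺ b b' {p}
    ; val-both = λ b b' {p} → val-both⁺ b b' {p}
    ; val-read = λ b b' {p} → val-read⁺ b b' {p}
    ; digit-outp = λ b {p} → digit-outp⁺ b {p}
    }
    where
    covers⁺ : ∀ p → Here p → p ∈ map pos nodes
    covers⁺ p (v , valid , refl) = ∈-map⁺ pos (node∈ v valid)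

-- Binary addition

bitℕ : Bool → ℕ
bitℕ b = if b then 1 else 0

valℕ : ℕ → (ℕ → Bool) → ℕ
valℕ zero    f = 0
valℕ (suc k) f = valℕ k f + 2 ^ k * bitℕ (f k)

valℕ-suc : ∀ k f → valℕ (suc k) f ≡ bitℕ (f 0) + 2 * valℕ k (f ∘ suc)
valℕ-suc zero    f = trans (+-identityʳ (bitℕ (f 0))) (sym (+-identityʳ (bitℕ (f 0))))
valℕ-suc (suc k) f = begin
  valℕ (suc k) f + 2 ^ suc k * x                       ≡⟨ cong (_+ 2 ^ suc k * x) (valℕ-suc k f) ⟩
  bitℕ (f 0) + 2 * valℕ k (f ∘ suc) + 2 ^ suc k * x    ≡⟨ +-assoc (bitℕ (f 0)) _ _ ⟩
  bitℕ (f 0) + (2 * valℕ k (f ∘ suc) + 2 * 2 ^ k * x)  ≡⟨ cong (λ m → bitℕ (f 0) + (2 * valℕ k (f ∘ suc) + m)) (*-assoc 2 (2 ^ k) x) ⟩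
  bitℕ (f 0) + (2 * valℕ k (f ∘ suc) + 2 * (2 ^ k * x)) ≡⟨ cong (bitℕ (f 0) +_) (*-distribˡ-+ 2 (valℕ k (f ∘ suc)) (2 ^ k * x)) ⟨
  bitℕ (f 0) + 2 * (valℕ k (f ∘ suc) + 2 ^ k * x)      ∎
  where
  open ≡-Reasoning
  x = bitℕ (f (suc k))

val-bits : ∀ {k} (v : Vec Bool k) → val v ≡ valℕ k (bits v)
val-bits V.[]       = refl
val-bits {suc k} (x V.∷ v) = trans (cong (λ m → bitℕ x + 2 * m) (val-bits v)) (sym (valℕ-suc k (bits (x V.∷ v))))

val-tabulate : ∀ k (f : ℕ → Bool) → val (V.tabulate {n = k} (f ∘ toℕ)) ≡ valℕ k f
val-tabulate zero    f = refl
val-tabulate (suc k) f = trans (cong (λ m → bitℕ (f 0) + 2 * m) (val-tabulate k (f ∘ suc))) (sym (valℕ-suc k f))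

bits-lookup : ∀ {k} (v : Vec Bool k) i → bits v (toℕ i) ≡ V.lookup v i
bits-lookup (x V.∷ v) Fin.zero    = refl
bits-lookup (x V.∷ v) (Fin.suc i) = bits-lookup v i

module _ (A B : ℕ → Bool) where
  open Carries A B

  full-adder : ∀ a b c → bitℕ ((a xor b) xor c) + 2 * bitℕ (fromMaybe c (carryOf a b)) ≡ bitℕ a + bitℕ b + bitℕ c
  full-adder false false false = refl
  full-adder false false true  = refl
  full-adder false true  false = refl
  full-adder false true  true  = refl
  full-adder true  false false = refl
  full-adder true  false true  = refl
  full-adder true  true  false = refl
  full-adder true  true  true  = refl

  ripple : ∀ k → valℕ k sumBit + 2 ^ k * bitℕ (carry k) ≡ valℕ k A + valℕ k B
  ripple zero    = refl
  ripple (suc k) = begin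
    S + p * s + 2 * p * c'                  ≡⟨ solve 4 (λ S p s c' → S :+ p :* s :+ con 2 :* p :* c' := S :+ p :* (s :+ con 2 :* c')) refl S p s c' ⟩
    S + p * (s + 2 * c')                    ≡⟨ cong (λ m → S + p * m) (full-adder (A k) (B k) (carry k)) ⟩
    S + p * (a + b + c)                     ≡⟨ solve 5 (λ S p a b c → S :+ p :* (a :+ b :+ c) := (S :+ p :* c) :+ (p :* a :+ p :* b)) refl S p a b c ⟩
    S + p * c + (p * a + p * b)             ≡⟨ cong (_+ (p * a + p * b)) (ripple k) ⟩
    valℕ k A + valℕ k B + (p * a + p * b)   ≡⟨ solve 4 (λ X Y x y → (X :+ Y) :+ (x :+ y) := (X :+ x) :+ (Y :+ y)) refl (valℕ k A) (valℕ k B) (p * a) (p * b) ⟩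
    valℕ k A + p * a + (valℕ k B + p * b)   ∎
    where
    open ≡-Reasoning
    open +-*-Solver
    S = valℕ k sumBit
    p = 2 ^ k
    s = bitℕ (sumBit k)
    c = bitℕ (carry k)
    c' = bitℕ (carry (suc k))
    a = bitℕ (A k)
    b = bitℕ (B k)

  sum-padded : ∀ n → A n ≡ false → B n ≡ false → valℕ (suc n) sumBit ≡ valℕ n A + valℕ n B
  sum-padded n a b = begin
    valℕ (suc n) sumBit                                     ≡⟨ +-identityʳ _ ⟨
    valℕ (suc n) sumBit + 0                                 ≡⟨ cong (valℕ (suc n) sumBit +_) (*-zeroʳ (2 ^ suc n)) ⟨
    valℕ (suc n) sumBit + 2 ^ suc n * 0                     ≡⟨ cong (λ m → valℕ (suc n) sumBit + 2 ^ suc n * bitℕ m) no-carry ⟨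
    valℕ (suc n) sumBit + 2 ^ suc n * bitℕ (carry (suc n))  ≡⟨ ripple (suc n) ⟩
    valℕ (suc n) A + valℕ (suc n) B                         ≡⟨ cong₂ _+_ (top A a) (top B b) ⟩
    valℕ n A + valℕ n B                                     ∎
    where
    open ≡-Reasoning
    no-carry : carry (suc n) ≡ false
    no-carry rewrite a | b = refl
    top : ∀ f → f n ≡ false → valℕ (suc n) f ≡ valℕ n f
    top f e rewrite e = trans (cong (valℕ n f +_) (*-zeroʳ (2 ^ n))) (+-identityʳ (valℕ n f))

peak : (ℕ → ℕ) → ℕ → ℕ
peak f zero    = f 0
peak f (suc n) = peak f n ⊔ f (suc n)

≤peak : ∀ f n i → i ≤ n → f i ≤ peak f n
≤peak f zero    .zero z≤n = ≤-refl
≤peak f (suc n) i     i≤  with i ≤? n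
... | yes i≤n = ≤-trans (≤peak f n i i≤n) (m≤m⊔n _ _)
... | no  i≰n with ≤-antisym i≤ (≰⇒> i≰n)
...   | refl = m≤n⊔m (peak f n) (f (suc n))

module AdderComputer (w' g' ℓ n : ℕ) (n< : n < blocks (blocks (suc w' + suc w') (suc g' + suc g')) ℓ) where
  open AdderCircuit w' g' ℓ n public
  open CircuitGrowth circuit using (required)
  open CircuitTiles circuit using (required⇒in; Timing)

  private
    along< : ∀ r {i} → i < w → along r i < w + w
    along< false i< = ≤-trans i< (m≤m+n w w)
    along< true  i< = +-monoˡ-< w i<

    order< : ∀ s {k} → k < g → order s k < g + g
    order< right k< = ≤-trans k< (m≤m+n g g)
    order< left  k< = +-monoˡ-< g k<

    along-injective : ∀ r r' {i i'} → i < w → i' < w → along r i ≡ along r' i' → r ≡ r' × i ≡ i'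
    along-injective false false _ _ e = refl , e
    along-injective true  true  _ _ e = refl , +-cancelʳ-≡ w _ _ e
    along-injective false true  i< _ refl = contradiction i< (m+n≮n _ w)
    along-injective true  false _ i'< refl = contradiction i'< (m+n≮n _ w)

    order-injective : ∀ s s' {k k'} → k < g → k' < g → order s k ≡ order s' k' → s ≡ s' × k ≡ k'
    order-injective right right _ _ e = refl , e
    order-injective left  left  _ _ e = refl , +-cancelʳ-≡ g _ _ e
    order-injective right left  k< _ refl = contradiction k< (m+n≮n _ g)
    order-injective left  right _ k'< refl = contradiction k'< (m+n≮n _ g)

  record BitPlace (j : ℕ) : Set where
    field
      Y : ℕ
      s : Side
      k : ℕ
      r : Bool
      i : ℕ
      Y<   : Y < ℓ
      k<   : k < g
      i<   : i < w
      index≡ : index⁺ Y s k r i ≡ j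

  private
    split-order : ∀ t → t < g + g → ∃ λ s → ∃ λ k → k < g × order s k ≡ t
    split-order t t< with t <? g
    ... | yes t<g = right , t , t<g , refl
    ... | no  t≮g = left , t ∸ g , +-cancelʳ-< g _ _ (subst (_< g + g) (sym (m∸n+n≡m (≮⇒≥ t≮g))) t<) , m∸n+n≡m (≮⇒≥ t≮g)

    split-along : ∀ t → t < w + w → ∃ λ r → ∃ λ i → i < w × along r i ≡ t
    split-along t t< with t <? w
    ... | yes t<w = false , t , t<w , refl
    ... | no  t≮w = true , t ∸ w , +-cancelʳ-< w _ _ (subst (_< w + w) (sym (m∸n+n≡m (≮⇒≥ t≮w))) t<) , m∸n+n≡m (≮⇒≥ t≮w)

  abstract
    locate : ∀ j → j < lay ℓ → BitPlace j
    locate j j< with blocks-find (grp (g + g)) ℓ j j<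
    ... | Y , x , Y< , x< , e₁ with blocks-find (w + w) (g + g) x x<
    ...   | t , y , t< , y< , e₂ with split-order t t< | split-along y y<
    ...     | s , k , k< , refl | r , i , i< , refl = record
      { Y = Y ; s = s ; k = k ; r = r ; i = i ; Y< = Y< ; k< = k< ; i< = i<
      ; index≡ = trans (+-assoc (lay Y) (grp (order s k)) (along r i)) (trans (cong (lay Y +_) e₂) e₁)
      }

  index-injective⁺ : ∀ {Y s k r i Y' s' k' r' i'} → k < g → i < w → k' < g → i' < w →
    index⁺ Y s k r i ≡ index⁺ Y' s' k' r' i' → (Y , s , k , r , i) ≡ (Y' , s' , k' , r' , i')
  index-injective⁺ {Y} {s} {k} {r} {i} {Y'} {s'} {k'} {r'} {i'} k< i< k'< i'< e
    with blocks-injective (grp (g + g)) Y Y' (inner s r k< i<) (inner s' r' k'< i'<)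
           (trans (sym (+-assoc (lay Y) _ _)) (trans e (+-assoc (lay Y') _ _)))
    where
    inner : ∀ s r {k i} → k < g → i < w → grp (order s k) + along r i < grp (g + g)
    inner s r {k} {i} k< i< = subst (grp (order s k) + along r i <_) (+-identityʳ (grp (g + g)))
      (blocks-< (w + w) 0 (order< s k<) (along< r i<))
  ... | refl , e₁ with blocks-injective (w + w) (order s k) (order s' k') (along< r i<) (along< r' i'<) e₁
  ...   | e₂ , e₃ with order-injective s s' k< k'< e₂ | along-injective r r' i< i'< e₃
  ...     | refl , refl | refl , refl = refl

  bitNode : ∀ {j} → BitPlace j → Bool → Lane → Node
  bitNode p c l = node (cell s k r i c) Y l
    where open BitPlace p

  bitNode-valid : ∀ {j} (p : BitPlace j) c l → Valid (bitNode p c l)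
  bitNode-valid p c l = (k< , i<) , Y<
    where open BitPlace p

  private
    inPlace : (i : Fin n) → BitPlace (toℕ i)
    inPlace i = locate (toℕ i) (<-trans (toℕ<n i) n<)

    outPlace : (i : Fin (suc n)) → BitPlace (toℕ i)
    outPlace i = locate (toℕ i) (<-≤-trans (toℕ<n i) n<)

    inAt : Bool → Fin n → Pos
    inAt c i = pos (bitNode (inPlace i) c l4)

    outAt : Fin (suc n) → Pos
    outAt i = pos (bitNode (outPlace i) true l0)

  inputPositions : Vec Pos (n + n)
  inputPositions = V.tabulate (inAt false) V.++ V.tabulate (inAt true)

  outputPositions : Vec Pos (suc n)
  outputPositions = V.tabulate outAt

  private
    in-spec : ∀ {j} (p : BitPlace j) c → j < n → specN (bitNode p c l4) ≡ inp
    in-spec p c j< with index⁺ (BitPlace.Y p) (BitPlace.s p) (BitPlace.k p) (BitPlace.r p) (BitPlace.i p) <? n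
    ... | yes _ = refl
    ... | no ¬lt = contradiction (subst (_< n) (sym (BitPlace.index≡ p)) j<) ¬lt

    lookup-in : ∀ i → V.lookup inputPositions i ≡ [ inAt false , inAt true ]′ (splitAt n i)
    lookup-in i = trans (lookup-splitAt n (V.tabulate (inAt false)) (V.tabulate (inAt true)) i) (help (splitAt n i))
      where
      help : ∀ x → [ V.lookup (V.tabulate (inAt false)) , V.lookup (V.tabulate (inAt true)) ]′ x ≡
                   [ inAt false , inAt true ]′ x
      help (inj₁ j) = lookup∘tabulate (inAt false) j
      help (inj₂ j) = lookup∘tabulate (inAt true) j

    lookup-input : ∀ (b : Vec Bool (n + n)) i → V.lookup b i ≡
      [ V.lookup (V.take n b) , V.lookup (V.drop n b) ]′ (splitAt n i)
    lookup-input b i = trans (cong (λ v → V.lookup v i) (sym (take++drop≡id n b)))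
      (lookup-splitAt n (V.take n b) (V.drop n b) i)

    ins-inp : ∀ i → spec⁺ (V.lookup inputPositions i) ≡ inp
    ins-inp i = trans (cong spec⁺ (lookup-in i)) (help (splitAt n i))
      where
      at-inp : ∀ c j → spec⁺ (inAt c j) ≡ inp
      at-inp c j = trans (spec-pos (bitNode (inPlace j) c l4) (bitNode-valid (inPlace j) c l4)) (in-spec (inPlace j) c (toℕ<n j))
      help : ∀ x → spec⁺ ([ inAt false , inAt true ]′ x) ≡ inp
      help (inj₁ j) = at-inp false j
      help (inj₂ j) = at-inp true j

    outs-outp : ∀ i → spec⁺ (V.lookup outputPositions i) ≡ outp
    outs-outp i = trans (cong spec⁺ (lookup∘tabulate outAt i)) (spec-pos (bitNode (outPlace i) true l0) (bitNode-valid (outPlace i) true l0))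

    input-cell : ∀ v → Valid v → specN v ≡ inp → InputCell v
    input-cell v valid e = help (wiring v) e (clocked v valid)
      where
      help : ∀ W → specOf W ≡ inp → Clocked v W → InputCell v
      help (inp _ _) _ (_ , _ , c) = c

    inp-ins : ∀ p → spec⁺ p ≡ inp → ∃ λ i → p ≡ V.lookup inputPositions i
    inp-ins p e with node-at {p} e (λ ())
    ... | v , valid , refl , e' with input-cell v valid e'
    ...   | s , k , r , i , c , Y , refl , lt = at-side c
      where
      j : Fin n
      j = fromℕ< lt
      at-place : ∀ c → pos (node (cell s k r i c) Y l4) ≡ inAt c j
      at-place c with index-injective⁺ {BitPlace.Y q} {BitPlace.s q} {BitPlace.k q} {BitPlace.r q} {BitPlace.i q} {Y} {s} {k} {r} {i}
          (BitPlace.k< q) (BitPlace.i< q) (proj₁ (proj₁ valid)) (proj₂ (proj₁ valid))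
          (trans (BitPlace.index≡ q) (toℕ-fromℕ< lt))
        where q = inPlace j
      ... | e = cong (λ { (Y , s , k , r , i) → pos (node (cell s k r i c) Y l4) }) (sym e)
      at-side : ∀ c → ∃ λ i' → pos (node (cell s k r i c) Y l4) ≡ V.lookup inputPositions i'
      at-side false = j ↑ˡ n , trans (at-place false) (sym (trans (lookup-in (j ↑ˡ n))
        (cong [ inAt false , inAt true ]′ (splitAt-↑ˡ n j n))))
      at-side true  = n ↑ʳ j , trans (at-place true) (sym (trans (lookup-in (n ↑ʳ j))
        (cong [ inAt false , inAt true ]′ (splitAt-↑ʳ n n j))))

  open CircuitComputer circuit inputPositions outputPositions ins-inp inp-ins outs-outp (V.replicate (n + n) false) public

  module _ (b : Vec Bool (n + n)) where
    private
      A B⁺ : ℕ → Bool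
      A  = bits (V.take n b)
      B⁺ = bits (V.drop n b)
    open Carries A B⁺

    longestRun : ℕ
    longestRun = peak run n

    private
      run-beyond : ∀ i → n < i → run i ≡ 0
      run-beyond (suc i) (s≤s n≤i) rewrite bits-padded (V.take n b) i n≤i | bits-padded (V.drop n b) i n≤i = refl

      run≤ : ∀ i → run i ≤ longestRun
      run≤ i with i ≤? n
      ... | yes i≤n = ≤peak run n i i≤n
      ... | no  i≰n = ≤-trans (≤-reflexive (run-beyond i (≰⇒> i≰n))) z≤n

    waiting : Measure
    waiting = record
      { M     = λ p c → run p ⊓ c
      ; cap   = λ c → longestRun ⊓ c
      ; M≤cap = λ p c≤ → ⊓-mono-≤ (run≤ p) c≤
      }
    open Clock waiting using (clock; clock<; b₅)

    private
      grows : ∀ p len c → 1 ≤ len → prefix p len ≡ nothing → run p ⊓ c < run (p + len) ⊓ suc c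
      grows p len c 1≤ e = ⊓-mono-< (≤-trans (+-monoˡ-≤ (run p) 1≤) (≤-reflexive (sym (run-prefix p len e)))) ≤-refl

      delay⁺ : Pos → ℕ
      delay⁺ = lookupWith clock 0

      delay-pos : ∀ v → Valid v → delay⁺ (pos v) ≡ clock v
      delay-pos = lookup-pos clock 0

      delay-<⁺ : ∀ p d → isSeed (spec⁺ p) ≡ false → required b p d ≡ true →
        isSeed (spec⁺ (p ⊕ d)) ≡ true ⊎ delay⁺ (p ⊕ d) < delay⁺ p
      delay-<⁺ p d ns r with node-at {p} refl (λ e → contradiction (trans (sym (required⇒in b p d r)) (cong (λ s → isIn s d) e)) λ ())
      ... | v , valid , refl , e = help (wiring v) e (linked v valid) (clocked v valid)
        where
        Goal : Dir → Set
        Goal d = isSeed (spec⁺ (pos v ⊕ d)) ≡ true ⊎ delay⁺ (pos v ⊕ d) < delay⁺ (pos v)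
        by-seed : ∀ {d u} → Link v d u → isSeed (specN u) ≡ true → Goal d
        by-seed {d} link s = inj₁ (trans (cong isSeed (spec-link {v} {d} link)) s)
        by-clock : ∀ {d u} → Link v d u → clock u < clock v → Goal d
        by-clock {d} {u} (e' , valid') lt = inj₂ (subst (λ q → delay⁺ q < delay⁺ (pos v)) e'
          (subst (_< delay⁺ (pos v)) (sym (delay-pos u valid')) (subst (clock u <_) (sym (delay-pos v valid)) lt)))
        req : ∀ {s} → s ≡ spec⁺ (pos v) → CircuitGrowth.reqOf circuit s b (pos v) d ≡ true
        req refl = r
        absurd-seed : ∀ {s} → s ≡ spec⁺ (pos v) → isSeed s ≡ true → Goal d
        absurd-seed refl s = contradiction (trans (sym ns) s) λ ()
        ∧-true : ∀ {a b} → (a ∧ b) ≡ true → a ≡ true × b ≡ true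
        ∧-true {true} e = refl , e
        needs-nothing : ∀ {x} → needs sel x ≡ true → proj₁ x ≡ nothing
        needs-nothing {nothing , _} _ = refl
        help : ∀ W → specOf W ≡ spec⁺ (pos v) → Linked v W → Clocked v W → Goal d
        help none e _ _ = contradiction (req e) λ ()
        help root e _ _ = absurd-seed e refl
        help (stone _ _) e _ _ = absurd-seed e refl
        help (inp _ _) e _ _ = absurd-seed e refl
        help (wire d' u) e (link , _) c with ==D-sound {d} (req e)
        help (wire d' u) e (link , _) (inj₁ st) | refl = by-seed link (Stone-seed st)
        help (wire d' u) e (link , _) (inj₂ lt) | refl = by-clock link (lt waiting)
        help (sel d₁ u d₂ t) e (_ , (link , _) , (link' , _)) (lt , seg) with ∨-true {d ==D d₁} (req e)
        ... | inj₁ h with ==D-sound {d} h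
        ...   | refl = by-clock link (lt waiting)
        help (sel d₁ u d₂ t) e (_ , (link , _) , (link' , _)) (lt , seg) | inj₂ h with ∧-true {d ==D d₂} h
        ...   | h₁ , h₂ with ==D-sound {d} h₁
        ...     | refl = by-clock link' (later waiting (grows from len count 1≤len
                    (propagates A B⁺ (trans (cong proj₁ (sym (value-link b {v} {d₁} link))) (needs-nothing h₂)))))
          where open Segment seg
        help (both d₁ u d₂ t) e (_ , (link , _) , (link' , _)) (lt , lt') with ∨-true {d ==D d₁} (req e)
        ... | inj₁ h with ==D-sound {d} h
        ...   | refl = by-clock link (lt waiting)
        help (both d₁ u d₂ t) e (_ , (link , _) , (link' , _)) (lt , lt') | inj₂ h with ∧-true {d ==D d₂} h
        ...   | h₁ , _ with ==D-sound {d} h₁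
        ...     | refl = by-clock link' (lt' waiting)
        help (read d₁ u t) e (_ , (link , _) , (link' , is-inp)) c with ∨-true {d ==D d₁} (req e)
        ... | inj₁ h with ==D-sound {d} h
        help (read d₁ u t) e (_ , (link , _) , (link' , is-inp)) (inj₁ st) | inj₁ h | refl = by-seed link (Stone-seed st)
        help (read d₁ u t) e (_ , (link , _) , (link' , is-inp)) (inj₂ lt) | inj₁ h | refl = by-clock link (lt waiting)
        help (read d₁ u t) e (_ , (link , _) , (link' , is-inp)) c | inj₂ h with ∧-true {d ==D yp} h
        ...   | h₁ , _ with ==D-sound {d} h₁
        ...     | refl = by-seed {yp} link' (cong isSeed is-inp)
        help (outp u t) e ((link , _) , (link' , st)) lt = side-case d (req e)
          where
          side-case : ∀ d → isIn outp d ≡ true → Goal d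
          side-case yp _ = by-clock {yp} link (lt waiting)
          side-case zm _ = by-seed {zm} link' (Stone-seed st)

    timing : Timing b
    timing = record { delay = delay⁺ ; delay-< = delay-<⁺ }

    private
      digits : ∀ i → digit⁺ b (V.lookup inputPositions i) ≡ V.lookup b i
      digits i = trans (cong (digit⁺ b) (lookup-in i)) (trans (help (splitAt n i)) (sym (lookup-input b i)))
        where
        help : ∀ x → digit⁺ b ([ inAt false , inAt true ]′ x) ≡
          [ V.lookup (V.take n b) , V.lookup (V.drop n b) ]′ x
        help (inj₁ j) = trans (digit-pos b (bitNode (inPlace j) false l4) (bitNode-valid (inPlace j) false l4))
          (trans (cong A (BitPlace.index≡ (inPlace j))) (bits-lookup (V.take n b) j))
        help (inj₂ j) = trans (digit-pos b (bitNode (inPlace j) true l4) (bitNode-valid (inPlace j) true l4))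
          (trans (cong B⁺ (BitPlace.index≡ (inPlace j))) (bits-lookup (V.drop n b) j))

      sumVec : Vec Bool (suc n)
      sumVec = V.tabulate (sumBit ∘ toℕ)

      is-sum : IsSum n b sumVec
      is-sum = trans (val-tabulate (suc n) sumBit)
        (trans (sum-padded A B⁺ n (bits-padded (V.take n b) n ≤-refl) (bits-padded (V.drop n b) n ≤-refl))
               (sym (cong₂ _+_ (val-bits (V.take n b)) (val-bits (V.drop n b)))))

      out-digit : ∀ i → digit⁺ b (V.lookup outputPositions i) ≡ V.lookup sumVec i
      out-digit i = trans (cong (digit⁺ b) (lookup∘tabulate outAt i))
        (trans (digit-pos b (bitNode (outPlace i) true l0) (bitNode-valid (outPlace i) true l0))
          (trans (cong sumBit (BitPlace.index≡ (outPlace i))) (sym (lookup∘tabulate (sumBit ∘ toℕ) i))))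

    private
      delay-bound : ∀ p → spec⁺ p ≢ none → delay⁺ p < b₅
      delay-bound p ne with node-here p ne
      ... | v , valid , refl = subst (_< b₅) (sym (delay-pos v valid)) (clock< v valid)

      finished : ∃ λ r → ParRun (sys computer) (seed b) r × r ≤ suc b₅
      finished = run-time b timing b₅ delay-bound

      result : ∃ λ A → UniquelyAssembles (sys computer) (seed b) A ×
        ∃ λ c → IsSum n b c × Represents computer A c
      result = proj₁ assembled , proj₁ (proj₂ assembled) , sumVec , is-sum , λ i →
        _ , proj₂ (proj₂ assembled) i , cong bitLabel (out-digit i)
        where
        assembled = computes b timing

    time : ℕ
    time = proj₁ finished

    adds : AdderRun n computer b time
    adds = seed b , seed-isInput b b digits , result , proj₁ (proj₂ finished)

    time≤ : time ≤ suc b₅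
    time≤ = proj₂ (proj₂ finished)

-- Sums over all inputs

sumAll-suc : ∀ k (f : Vec Bool (suc k) → ℕ) → sumAll f ≡ sumAll {k} (λ v → f (false V.∷ v) + f (true V.∷ v))
sumAll-suc k f = go (allBits k)
  where
  go : ∀ vs → sum (map f (concatMap (λ v → (false V.∷ v) ∷ (true V.∷ v) ∷ []) vs)) ≡
              sum (map (λ v → f (false V.∷ v) + f (true V.∷ v)) vs)
  go []       = refl
  go (v ∷ vs) = trans (sym (+-assoc (f (false V.∷ v)) _ _)) (cong (f (false V.∷ v) + f (true V.∷ v) +_) (go vs))

sumAll-≤ : ∀ {k} {f h : Vec Bool k → ℕ} → (∀ v → f v ≤ h v) → sumAll f ≤ sumAll h
sumAll-≤ {k} = sum-map-≤ (allBits k)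

sumAll-cong : ∀ {k} {f h : Vec Bool k → ℕ} → (∀ v → f v ≡ h v) → sumAll f ≡ sumAll h
sumAll-cong {k} e = ≤-antisym (sumAll-≤ {k} (≤-reflexive ∘ e)) (sumAll-≤ {k} (≤-reflexive ∘ sym ∘ e))

sumAll-+ : ∀ {k} (f h : Vec Bool k → ℕ) → sumAll (λ v → f v + h v) ≡ sumAll f + sumAll h
sumAll-+ {k} f h = go (allBits k)
  where
  open +-*-Solver
  go : ∀ vs → sum (map (λ v → f v + h v) vs) ≡ sum (map f vs) + sum (map h vs)
  go []       = refl
  go (v ∷ vs) = trans (cong (f v + h v +_) (go vs))
    (solve 4 (λ a b c d → (a :+ b) :+ (c :+ d) := (a :+ c) :+ (b :+ d)) refl (f v) (h v) _ _)

sumAll-* : ∀ {k} c (f : Vec Bool k → ℕ) → sumAll (λ v → c * f v) ≡ c * sumAll f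
sumAll-* {k} c f = go (allBits k)
  where
  go : ∀ vs → sum (map (λ v → c * f v) vs) ≡ c * sum (map f vs)
  go []       = sym (*-zeroʳ c)
  go (v ∷ vs) = trans (cong (c * f v +_) (go vs)) (sym (*-distribˡ-+ c (f v) _))

double : ∀ x → x + x ≡ 2 * x
double x = cong (x +_) (sym (+-identityʳ x))

sumAll-const : ∀ k c → sumAll {k} (λ _ → c) ≡ c * 2 ^ k
sumAll-const zero    c = trans (+-identityʳ c) (sym (*-identityʳ c))
sumAll-const (suc k) c = trans (sumAll-suc k (λ _ → c)) (trans (sumAll-const k (c + c))
  (trans (cong (_* 2 ^ k) (trans (double c) (*-comm 2 c))) (*-assoc c 2 (2 ^ k))))

sumAll-take-drop : ∀ m {k} (F : Vec Bool m → Vec Bool k → ℕ) →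
  sumAll (λ b → F (V.take m b) (V.drop m b)) ≡ sumAll {m} (λ u → sumAll {k} (F u))
sumAll-take-drop zero    F = sym (+-identityʳ _)
sumAll-take-drop (suc m) {k} F = begin
  sumAll (λ b → F (V.take (suc m) b) (V.drop (suc m) b))
    ≡⟨ sumAll-suc (m + k) (λ b → F (V.take (suc m) b) (V.drop (suc m) b)) ⟩
  sumAll (λ b → F (false V.∷ V.take m b) (V.drop m b) + F (true V.∷ V.take m b) (V.drop m b))
    ≡⟨ sumAll-take-drop m (λ u v → F (false V.∷ u) v + F (true V.∷ u) v) ⟩
  sumAll {m} (λ u → sumAll {k} (λ v → F (false V.∷ u) v + F (true V.∷ u) v))
    ≡⟨ sumAll-cong (λ u → sumAll-+ (F (false V.∷ u)) (F (true V.∷ u))) ⟩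
  sumAll {m} (λ u → sumAll {k} (F (false V.∷ u)) + sumAll {k} (F (true V.∷ u)))
    ≡⟨ sumAll-suc m (λ u → sumAll {k} (F u)) ⟨
  sumAll {suc m} (λ u → sumAll {k} (F u)) ∎
  where open ≡-Reasoning

sumTo : ℕ → (ℕ → ℕ) → ℕ
sumTo zero    f = 0
sumTo (suc k) f = sumTo k f + f k

≤sumTo : ∀ f k i → i < k → f i ≤ sumTo k f
≤sumTo f (suc k) i i< with i <? k
... | yes i<k = ≤-trans (≤sumTo f k i i<k) (m≤m+n _ _)
... | no  i≮k with ≤-antisym (m<1+n⇒m≤n i<) (≮⇒≥ i≮k)
...   | refl = m≤n+m (f k) (sumTo k f)

sumTo-* : ∀ f k c x → (∀ i → f i * c ≤ x) → sumTo k f * c ≤ k * x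
sumTo-* f zero    c x h = z≤n
sumTo-* f (suc k) c x h = begin
  (sumTo k f + f k) * c     ≡⟨ *-distribʳ-+ c (sumTo k f) (f k) ⟩
  sumTo k f * c + f k * c   ≤⟨ +-mono-≤ (sumTo-* f k c x h) (h k) ⟩
  k * x + x                 ≡⟨ +-comm (k * x) x ⟩
  suc k * x                 ∎
  where open ≤-Reasoning

sumAll-sumTo : ∀ {m} k (f : Vec Bool m → ℕ → ℕ) →
  sumAll (λ b → sumTo k (f b)) ≡ sumTo k (λ i → sumAll (λ b → f b i))
sumAll-sumTo {m} zero f = sumAll-const m 0
sumAll-sumTo (suc k) f = trans (sumAll-+ (λ b → sumTo k (f b)) (λ b → f b k)) (cong (_+ sumAll (λ b → f b k)) (sumAll-sumTo k f))

differs : ∀ {k} → (ℕ → Bool) → ℕ → ℕ → Vec Bool k → ℕ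
differs a s       zero    v          = 1
differs a s       (suc l) V.[]       = 0
differs a zero    (suc l) (x V.∷ v)  = if a 0 xor x then differs (a ∘ suc) zero l v else 0
differs a (suc s) (suc l) (x V.∷ v)  = differs (a ∘ suc) s (suc l) v

differs-true : ∀ {k} a s l (v : Vec Bool k) → s + l ≤ k →
  (∀ t → t < l → (a (s + t) xor bits v (s + t)) ≡ true) → differs a s l v ≡ 1
differs-true a s       zero    v          _       h = refl
differs-true a zero    (suc l) V.[]       ()      h
differs-true a (suc s) (suc l) V.[]       ()      h
differs-true a zero    (suc l) (x V.∷ v)  (s≤s ≤k) h =
  trans (if-then (h 0 (s≤s z≤n))) (differs-true (a ∘ suc) zero l v ≤k λ t t< → h (suc t) (s≤s t<))
differs-true a (suc s) (suc l) (x V.∷ v)  (s≤s ≤k) h = differs-true (a ∘ suc) s (suc l) v ≤k h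

sumAll-differs : ∀ k a s l → sumAll {k} (differs a s l) * 2 ^ l ≤ 2 ^ k
sumAll-differs k a s zero = ≤-reflexive (trans (*-identityʳ (sumAll {k} (λ _ → 1))) (trans (sumAll-const k 1) (+-identityʳ (2 ^ k))))
sumAll-differs zero    a s       (suc l) = z≤n
sumAll-differs (suc k) a zero    (suc l) = begin
  sumAll {suc k} (differs a zero (suc l)) * (2 * 2 ^ l)
    ≡⟨ cong (_* (2 * 2 ^ l)) (trans (sumAll-suc k (differs a zero (suc l))) (sumAll-cong {k} one-way)) ⟩
  sumAll {k} (differs (a ∘ suc) zero l) * (2 * 2 ^ l)
    ≡⟨ solve 2 (λ x p → x :* (con 2 :* p) := con 2 :* (x :* p)) refl (sumAll {k} (differs (a ∘ suc) zero l)) (2 ^ l) ⟩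
  2 * (sumAll {k} (differs (a ∘ suc) zero l) * 2 ^ l)
    ≤⟨ *-monoʳ-≤ 2 (sumAll-differs k (a ∘ suc) zero l) ⟩
  2 * 2 ^ k ∎
  where
  open ≤-Reasoning
  open +-*-Solver
  one-way : ∀ v → differs a zero (suc l) (false V.∷ v) + differs a zero (suc l) (true V.∷ v) ≡ differs (a ∘ suc) zero l v
  one-way v with a 0
  ... | false = refl
  ... | true  = +-identityʳ _
sumAll-differs (suc k) a (suc s) (suc l) = begin
  sumAll {suc k} (differs a (suc s) (suc l)) * 2 ^ suc l
    ≡⟨ cong (_* 2 ^ suc l) (trans (sumAll-suc k (differs a (suc s) (suc l))) (sumAll-+ {k} (differs (a ∘ suc) s (suc l)) (differs (a ∘ suc) s (suc l)))) ⟩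
  (x + x) * 2 ^ suc l
    ≡⟨ solve 2 (λ x p → (x :+ x) :* p := con 2 :* (x :* p)) refl x (2 ^ suc l) ⟩
  2 * (x * 2 ^ suc l)
    ≤⟨ *-monoʳ-≤ 2 (sumAll-differs k (a ∘ suc) s (suc l)) ⟩
  2 * 2 ^ k ∎
  where
  open ≤-Reasoning
  open +-*-Solver
  x = sumAll {k} (differs (a ∘ suc) s (suc l))

peak-attained : ∀ f n l → l ≤ peak f n → ∃ λ i → i ≤ n × l ≤ f i
peak-attained f zero    l h = 0 , z≤n , h
peak-attained f (suc n) l h with l ≤? f (suc n)
... | yes l≤ = suc n , ≤-refl , l≤
... | no  l≰ with ⊔-sel (peak f n) (f (suc n))
...   | inj₂ e = contradiction (subst (l ≤_) e h) l≰
...   | inj₁ e with peak-attained f n l (subst (l ≤_) e h)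
...     | i , i≤ , l≤ = i , m≤n⇒m≤1+n i≤ , l≤

run-window : ∀ A B l j → l ≤ Carries.run A B j →
  ∃ λ s → s + l ≡ j × ∀ t → t < l → (A (s + t) xor B (s + t)) ≡ true
run-window A B zero    j       h = j , +-identityʳ j , λ _ ()
run-window A B (suc l) (suc j) h with A j xor B j in e
... | true with run-window A B l j (≤-pred h)
...   | s , refl , all = s , +-suc s l , λ t t< → last t (m<1+n⇒m≤n t<)
  where
  last : ∀ t → t ≤ l → (A (s + t) xor B (s + t)) ≡ true
  last t t≤ with t <? l
  ... | yes t<l = all t t<l
  ... | no  t≮l with ≤-antisym t≤ (≮⇒≥ t≮l)
  ...   | refl = e

-- Numerical bounds

cube : ℕ → ℕ
cube m = m * m * m

cbrt : ∀ n → ∃ λ m → cube m ≤ n × n < cube (suc m)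
cbrt zero = 0 , z≤n , s≤s z≤n
cbrt (suc n) with cbrt n
... | m , lo , hi with suc n <? cube (suc m)
...   | yes lt = m , m≤n⇒m≤1+n lo , lt
...   | no ≮  = suc m , ≮⇒≥ ≮ , ≤-<-trans hi (cube-< (suc m))
  where
  cube-< : ∀ m → cube m < cube (suc m)
  cube-< m = *-mono-< (*-mono-< (n<1+n m) (n<1+n m)) (n<1+n m)

n<2^[1+log] : ∀ n → n < 2 ^ suc ⌊log₂ n ⌋
n<2^[1+log] n with n <? 2 ^ suc ⌊log₂ n ⌋
... | yes lt = lt
... | no  ≮ = contradiction (≤-trans (≤-reflexive (sym (⌊log₂[2^n]⌋≡n (suc ⌊log₂ n ⌋)))) (⌊log₂⌋-mono-≤ (≮⇒≥ ≮))) (<-irrefl refl)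

log≥1 : ∀ n → 2 ≤ n → 1 ≤ ⌊log₂ n ⌋
log≥1 n 2≤n = ≤-trans (≤-reflexive (sym (⌊log₂[2^n]⌋≡n 1))) (⌊log₂⌋-mono-≤ 2≤n)

clock-total : ∀ w' g' ℓ n 𝓜 → let open Clocks.Clock w' g' ℓ n 𝓜 in
  b₅ ≡ 27 + 8 * (e₁ + (e₁ + (e₂ + (e₂ + e₃))))
clock-total w' g' ℓ n 𝓜 = trans (at-≡ 6 e₁ b₄) (trans (cong (λ x → 6 + (oct e₁ + x)) (at-≡ 4 e₂ b₃))
  (trans (cong (λ x → 6 + (oct e₁ + (4 + (oct e₂ + x)))) (at-≡ 5 e₃ b₂))
  (trans (cong (λ x → 6 + (oct e₁ + (4 + (oct e₂ + (5 + (oct e₃ + x)))))) (at-≡ 4 e₂ b₁))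
  (trans (cong (λ x → 6 + (oct e₁ + (4 + (oct e₂ + (5 + (oct e₃ + (4 + (oct e₂ + x)))))))) (at-≡ 8 e₁ 0))
    (collect (oct-≡ e₁) (oct-≡ e₂) (oct-≡ e₃))))))
  where
  open Clocks.Clock w' g' ℓ n 𝓜
  open +-*-Solver
  collect : ∀ {x y z} → x ≡ 8 * e₁ → y ≡ 8 * e₂ → z ≡ 8 * e₃ →
    6 + (x + (4 + (y + (5 + (z + (4 + (y + (8 + (x + 0))))))))) ≡ 27 + 8 * (e₁ + (e₁ + (e₂ + (e₂ + e₃))))
  collect refl refl refl = solve 3 (λ a b c →
    con 6 :+ (con 8 :* a :+ (con 4 :+ (con 8 :* b :+ (con 5 :+ (con 8 :* c :+ (con 4 :+ (con 8 :* b :+ (con 8 :+ (con 8 :* a :+ con 0)))))))))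
    := con 27 :+ con 8 :* (a :+ (a :+ (b :+ (b :+ c))))) refl e₁ e₂ e₃

cube-≤ : ∀ c m n x → cube m ≤ n → x ≤ c * m → x ^ 3 ≤ c ^ 3 * n
cube-≤ c m n x m≤ x≤ = begin
  x ^ 3              ≤⟨ ^-monoˡ-≤ 3 x≤ ⟩
  (c * m) ^ 3        ≡⟨ solve 2 (λ c m → (c :* m) :^ 3 := c :^ 3 :* (m :* m :* m)) refl c m ⟩
  c ^ 3 * cube m     ≤⟨ *-monoʳ-≤ (c ^ 3) m≤ ⟩
  c ^ 3 * n          ∎
  where
  open ≤-Reasoning
  open +-*-Solver

module Construction (n m : ℕ) (m³≤n : cube m ≤ n) (n<m³ : n < cube (suc m)) where

  fits : n < blocks (blocks (suc m + suc m) (suc m + suc m)) (suc m)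
  fits = <-≤-trans n<m³ (≤-trans (≤-reflexive (*-assoc (suc m) (suc m) (suc m)))
    (≤-trans (*-monoʳ-≤ (suc m) (*-mono-≤ (m≤m+n (suc m) (suc m)) (m≤m+n (suc m) (suc m))))
      (≤-reflexive (sym (trans (blocks-≡ (blocks (suc m + suc m) (suc m + suc m)) (suc m))
        (cong (suc m *_) (blocks-≡ (suc m + suc m) (suc m + suc m))))))))

  open AdderComputer m m (suc m) n fits public using (computer; time; adds; time≤; longestRun; waiting)

  private
    low high : Vec Bool (n + n) → ℕ → Bool
    low b  = bits (V.take n b)
    high b = bits (V.drop n b)

  time-run : ∀ b → time b ≤ 28 + 40 * longestRun b
  time-run b = ≤-trans (time≤ b) (≤-trans (≤-reflexive (cong suc (clock-total m m (suc m) n (waiting b))))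
    (+-monoʳ-≤ 28 (≤-trans (*-monoʳ-≤ 8 (+-mono-≤ μ (+-mono-≤ μ (+-mono-≤ μ (+-mono-≤ μ μ)))))
      (≤-reflexive (solve 1 (λ x → con 8 :* (x :+ (x :+ (x :+ (x :+ x)))) := con 40 :* x) refl (longestRun b))))))
    where
    open +-*-Solver
    μ : ∀ {x} → longestRun b ⊓ x ≤ longestRun b
    μ = m⊓n≤m _ _

  time-worst : 1 ≤ m → ∀ b → time b ≤ 172 * m
  time-worst 1≤m b = ≤-trans (time≤ b) (≤-trans (≤-reflexive (cong suc (clock-total m m (suc m) n (waiting b))))
    (≤-trans (+-monoʳ-≤ 28 (*-monoʳ-≤ 8 (+-mono-≤ μ (+-mono-≤ μ (+-mono-≤ μ (+-mono-≤ μ μ))))))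
      (≤-trans (≤-reflexive (solve 1 (λ x → con 28 :+ con 8 :* ((con 1 :+ x :+ (con 1 :+ x)) :+ ((con 1 :+ x :+ (con 1 :+ x)) :+
          ((con 1 :+ x :+ (con 1 :+ x)) :+ ((con 1 :+ x :+ (con 1 :+ x)) :+ (con 1 :+ x))))) := con 100 :+ con 72 :* x) refl m))
        (≤-trans (+-monoˡ-≤ (72 * m) (≤-trans (≤-reflexive (sym (*-identityʳ 100))) (*-monoʳ-≤ 100 1≤m)))
          (≤-reflexive (sym (*-distribʳ-+ m 100 72)))))))
    where
    open +-*-Solver
    μ : ∀ {x} → longestRun b ⊓ x ≤ x
    μ = m⊓n≤n _ _

  -- Runs of length 2 (1 + ⌊log₂ n⌋) occur for at most one input in n.
  private
    lg l L X : ℕ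
    lg = ⌊log₂ n ⌋
    l  = suc lg
    L  = l + l
    X  = 2 ^ (n + n)

    window : Vec Bool (n + n) → ℕ → ℕ
    window b s = differs (low b) s L (V.drop n b)

    windows : ℕ → ℕ
    windows s = sumAll (λ b → window b s)

    has-window : ∀ b → L ≤ longestRun b → 1 ≤ sumTo (suc n) (window b)
    has-window b long with peak-attained (Carries.run (low b) (high b)) n L long
    ... | j , j≤n , L≤ with run-window (low b) (high b) L j L≤
    ...   | s , refl , all = ≤-trans (≤-reflexive (sym (differs-true (low b) s L (V.drop n b) j≤n all)))
            (≤sumTo (window b) (suc n) s (s≤s (≤-trans (m≤m+n s L) j≤n)))

    either-≤ : ∀ {t a k x} → t ≤ a ⊎ (t ≤ k × 1 ≤ x) → t ≤ a + k * x
    either-≤ {a = a} {k} {x} (inj₁ t≤a) = ≤-trans t≤a (m≤m+n a (k * x))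
    either-≤ {a = a} {k} {x} (inj₂ (t≤k , 1≤x)) = ≤-trans t≤k (≤-trans (≤-reflexive (sym (*-identityʳ k)))
      (≤-trans (*-monoʳ-≤ k 1≤x) (m≤n+m (k * x) a)))

    time-window : ∀ {k} → (∀ b → time b ≤ k) → ∀ b → time b ≤ (28 + 40 * L) + k * sumTo (suc n) (window b)
    time-window {k} worst b = either-≤ {a = 28 + 40 * L} {k} {sumTo (suc n) (window b)} (cases (L ≤? longestRun b))
      where
      cases : Dec (L ≤ longestRun b) → time b ≤ 28 + 40 * L ⊎ (time b ≤ k × 1 ≤ sumTo (suc n) (window b))
      cases (yes long) = inj₂ (worst b , has-window b long)
      cases (no short) = inj₁ (≤-trans (time-run b) (+-monoʳ-≤ 28 (*-monoʳ-≤ 40 (<⇒≤ (≰⇒> short)))))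

    windows-≤ : ∀ s → windows s * 2 ^ L ≤ X
    windows-≤ s = begin
      windows s * 2 ^ L
        ≡⟨ cong (_* 2 ^ L) (sumAll-take-drop n (λ u v → differs (bits u) s L v)) ⟩
      sumAll {n} (λ u → sumAll {n} (differs (bits u) s L)) * 2 ^ L
        ≡⟨ *-comm _ (2 ^ L) ⟩
      2 ^ L * sumAll {n} (λ u → sumAll {n} (differs (bits u) s L))
        ≡⟨ sumAll-* {n} (2 ^ L) (λ u → sumAll {n} (differs (bits u) s L)) ⟨
      sumAll {n} (λ u → 2 ^ L * sumAll {n} (differs (bits u) s L))
        ≤⟨ sumAll-≤ {n} (λ u → ≤-trans (≤-reflexive (*-comm (2 ^ L) _)) (sumAll-differs n (bits u) s L)) ⟩
      sumAll {n} (λ _ → 2 ^ n)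
        ≡⟨ sumAll-const n (2 ^ n) ⟩
      2 ^ n * 2 ^ n
        ≡⟨ ^-distribˡ-+-* 2 n n ⟨
      X ∎
      where open ≤-Reasoning

    all-windows : suc n * sumTo (suc n) windows ≤ X
    all-windows = *-cancelˡ-≤ (suc n) (begin
      suc n * (suc n * S)   ≡⟨ solve 2 (λ k S → k :* (k :* S) := S :* (k :* k)) refl (suc n) S ⟩
      S * (suc n * suc n)   ≤⟨ *-monoʳ-≤ S (*-mono-≤ (n<2^[1+log] n) (n<2^[1+log] n)) ⟩
      S * (2 ^ l * 2 ^ l)   ≡⟨ cong (S *_) (^-distribˡ-+-* 2 l l) ⟨
      S * 2 ^ L             ≤⟨ sumTo-* windows (suc n) (2 ^ L) X windows-≤ ⟩
      suc n * X             ∎)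
      where
      open ≤-Reasoning
      open +-*-Solver
      S = sumTo (suc n) windows

    m≤n⁺ : m ≤ suc n
    m≤n⁺ = ≤-trans (m≤cube m) (≤-trans m³≤n (n≤1+n n))
      where
      m≤cube : ∀ m → m ≤ cube m
      m≤cube zero    = z≤n
      m≤cube (suc m) = ≤-trans (m≤m*n (suc m) (suc m)) (m≤m*n (suc m * suc m) (suc m))

    average : ∀ a k → (∀ b → time b ≤ a + k * sumTo (suc n) (window b)) →
      sumAll time ≤ a * X + k * sumTo (suc n) windows
    average a k bound = begin
      sumAll time
        ≤⟨ sumAll-≤ {n + n} bound ⟩
      sumAll {n + n} (λ b → a + k * sumTo (suc n) (window b))
        ≡⟨ sumAll-+ {n + n} (λ _ → a) (λ b → k * sumTo (suc n) (window b)) ⟩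
      sumAll {n + n} (λ _ → a) + sumAll {n + n} (λ b → k * sumTo (suc n) (window b))
        ≡⟨ cong₂ _+_ (sumAll-const (n + n) a)
             (trans (sumAll-* {n + n} k (λ b → sumTo (suc n) (window b))) (cong (k *_) (sumAll-sumTo (suc n) window))) ⟩
      a * X + k * sumTo (suc n) windows ∎
      where open ≤-Reasoning

    total : ∀ a c → a * X + c * m * sumTo (suc n) windows ≤ (a + c) * X
    total a c = begin
      a * X + c * m * S    ≡⟨ cong (a * X +_) (*-assoc c m S) ⟩
      a * X + c * (m * S)  ≤⟨ +-monoʳ-≤ (a * X) (*-monoʳ-≤ c (≤-trans (*-monoˡ-≤ S m≤n⁺) all-windows)) ⟩
      a * X + c * X        ≡⟨ *-distribʳ-+ X a c ⟨
      (a + c) * X          ∎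
      where
      open ≤-Reasoning
      S = sumTo (suc n) windows

  time-average : 1 ≤ m → 1 ≤ ⌊log₂ n ⌋ → sumAll time ≤ 360 * ⌊log₂ n ⌋ * 2 ^ (n + n)
  time-average 1≤m 1≤lg = ≤-trans (average (28 + 40 * L) (172 * m) (time-window (time-worst 1≤m)))
    (≤-trans (total (28 + 40 * L) 172) (*-monoˡ-≤ X small))
    where
    open +-*-Solver
    small : 28 + 40 * L + 172 ≤ 360 * lg
    small = ≤-trans (≤-reflexive (solve 1 (λ x → con 28 :+ con 40 :* (con 1 :+ x :+ (con 1 :+ x)) :+ con 172 := con 280 :+ con 80 :* x) refl lg))
      (≤-trans (+-monoˡ-≤ (80 * lg) (≤-trans (≤-reflexive (sym (*-identityʳ 280))) (*-monoʳ-≤ 280 1≤lg)))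
        (≤-reflexive (sym (*-distribʳ-+ lg 280 80))))

theorem6 : Σ ℕ λ c → Σ ℕ λ n₀ → ∀ n → 1 ≤ n →
    Σ (TAC (n + n) (suc n)) λ M → Σ (Vec Bool (n + n) → ℕ) λ rt →
    (∀ b → AdderRun n M b (rt b))
    × (n₀ ≤ n → (∀ b → rt b ^ 3 ≤ c ^ 3 * n)
    × sumAll rt ≤ c * ⌊log₂ n ⌋ * 2 ^ (n + n))
theorem6 = 360 , 2 , λ n 1≤n → build n 1≤n (cbrt n)
  where
  build : ∀ n → 1 ≤ n → (∃ λ m → cube m ≤ n × n < cube (suc m)) →
    Σ (TAC (n + n) (suc n)) λ M → Σ (Vec Bool (n + n) → ℕ) λ rt →
    (∀ b → AdderRun n M b (rt b))
    × (2 ≤ n → (∀ b → rt b ^ 3 ≤ 360 ^ 3 * n)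
    × sumAll rt ≤ 360 * ⌊log₂ n ⌋ * 2 ^ (n + n))
  build n 1≤n (m , lo , hi) = computer , time , adds , λ 2≤n →
    (λ b → cube-≤ 360 m n (time b) lo (≤-trans (time-worst 1≤m b) (*-monoˡ-≤ m (m≤m+n 172 188)))) ,
    time-average 1≤m (log≥1 n 2≤n)
    where
    open Construction n m lo hi
    m-pos : ∀ m → n < cube (suc m) → 1 ≤ m
    m-pos zero    h = contradiction (≤-trans (s≤s 1≤n) h) λ { (s≤s ()) }
    m-pos (suc m) _ = s≤s z≤n
    1≤m : 1 ≤ m
    1≤m = m-pos m hi
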